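{- Let $G$ be a controllable-choice MSG over processes $\mathcal{P}$ and message labels $\mathcal{C}$. Then there exist a finite set $D$ of control data and a deadlock-free CFM $\mathcal{A}$ over processes $\mathcal{P}$ and message labels $\mathcal{C}\times D$ such that $h(\mathcal{L}(\mathcal{A}))=\mathcal{L}(G)$, where $h$ is the letter-to-letter morphism mapping $p!q((m,d))\mapsto p!q(m)$ and $p?q((m,d))\mapsto p?q(m)$. In particular, $G$ is realizable by a deadlock-free CFM whose messages carry bounded additional control data.
   Context: bMSC, MSG: A basic Message Sequence Chart (bMSC) is a tuple $M=(E,<,\mathcal{P},\mathcal{T},P,\mathcal{M},l)$ where $E$ is a finite set of events, $\mathcal{T}:E\to\{\mathrm{send},\mathrm{receive}\}$, $P:E\to\mathcal{P}$, $\mathcal{M}$ a bijection from sends to receives with $P(e)\neq P(\mathcal{M}(e))$ (messages), $l$ labels messages in $\mathcal{C}$, and the visual order $<$ is the reflexive-transitive closure of $\mathcal{M}\cup\bigcup_p<_p$ with $<_p$ a total order on $P^{ -1}(p)$; $<$ is a partial order and the bMSC is FIFO (for messages $(e,f),(e',f')$: $e<_pe'$ and $P(f)=P(f')=p'$ imply $f<_{p'}f'$). Events are letters of $\Sigma=\{p!q(m)\}\cup\{q?p(m)\}$ ($p!q(m)$: $p$ sends $m$ to $q$; $q?p(m)$: $q$ receives $m$ from $p$); $\mathcal{L}(M)$ is the set of linearizations (words listing all events in an order consistent with $<$). Weak sequential composition $M_1\cdot M_2$: union of events with order the transitive closure of $<_1\cup<_2\cup\bigcup_p(P_1^{ -1}(p)\times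 P_2^{ -1}(p))$. An MSG is $G=(\mathcal{S},\tau,s_0,s_f,L)$: finite states, edges $\tau$, initial $s_0$ with no incoming edge, terminal $s_f$ with no outgoing edge, all nodes reachable from $s_0$ and $s_f$ reachable from all nodes, $L$ labels nodes by bMSCs. Paths, runs (paths from $s_0$ to $s_f$), $L(s_1\dots s_k)=L(s_1)\cdots L(s_k)$, $\mathcal{L}(G)=\bigcup_{\sigma\text{ run}}\mathcal{L}(L(\sigma))$. Controllable-choice: $p$ initiates $M$ if some event of $M$ on $p$ is minimal in $<$. $\mathrm{triggers}(s)$ is the set of $p$ such that some nonempty path $\sigma_1\dots\sigma_n$ with $(s,\sigma_1)\in\tau$ has $p$ initiating $L(\sigma)$. A choice node has more than one outgoing edge; it is local-choice iff its triggers set is a singleton. A send event $e$ of bMSC $M$ is resolving for $P'\subseteq\mathcal{P}$ iff every $p\in P'$ has an event $e_p$ of $M$ on $p$ with $e<e_p$. A choice node $u$ is controllable-choice iff for every path $\sigma$ from $s_0$ to $u$, and for every path $\sigma=s_1\dots u$ with $(u,s_1)\in\tau$, $L(\sigma)$ contains a resolving event for $\mathrm{triggers}(u)$. An MSG is controllable-choice iff every choice node is local-choice or controllable-choice. CFM: a Communicating Finite-State Machine over $\mathcal{P}$ and labels $\mathcal{C}'$ is a family $(\mathcal{A}_p)_{p\in\mathcal{P}}$ of finite automata $\mathcal{A}_p=(\mathcal{S}_p,A_p,\to_p,s_p,F_p)$ with actions $A_p\subseteq\{p!q(m)\}\cup\{p?q(m)\}$ ($m\in\mathcal{C}'$), initial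 state $s_p$ and local accepting states $F_p$, communicating through unbounded FIFO channels $\mathcal{B}_{p,q}$: $p!q(m)$ appends $m$ to $\mathcal{B}_{p,q}$, $p?q(m)$ is enabled only if $m$ is at the head of $\mathcal{B}_{q,p}$ and removes it. A configuration consists of local states and channel contents; the initial configuration has all initial states and empty channels; a configuration is accepting if every $\mathcal{A}_p$ is in $F_p$ and all channels are empty. $\mathcal{L}(\mathcal{A})$ is the set of action words of executions from the initial to an accepting configuration. A configuration is a deadlock if no accepting configuration is reachable from it; the CFM is deadlock-free if no deadlock is reachable from the initial configuration. -}

module Defs where

open import Data.Nat using (ℕ; zero; suc; _+_; _<_; _≤_; _⊔_)
open import Data.Fin using (Fin; toℕ; splitAt; _↑ˡ_; _↑ʳ_)
open import Data.List using (List; []; _∷_; _++_; [_]; map; tabulate; foldr; allFin)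
open import Data.Product using (Σ; ∃; _×_; _,_)
open import Data.Sum using (_⊎_; [_,_]′)
open import Data.Empty using (⊥)
open import Relation.Nullary using (¬_)
open import Relation.Binary.PropositionalEquality using (_≡_; _≢_)
open import Relation.Binary.Construct.Closure.ReflexiveTransitive using (Star)
open import Function.Definitions using (Injective)

data Kind : Set where
  send receive : Kind

data Act (P C : Set) : Set where
  -- snd p q m  is  p!q(m) : p sends m to q
  snd : P → P → C → Act P C
  -- rcv q p m  is  q?p(m) : q receives m from p
  rcv : P → P → C → Act P C

actor : ∀ {P C} → Act P C → P
actor (snd p _ _) = p
actor (rcv q _ _) = q

-- bMSCs.  Events are Fin size.  The message bijection M (sends → receives)
-- is encoded by an involution 'partner' swapping the two ends of each
-- message; the total orders <_p are encoded by a position 'pos' which is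
-- injective on each process; 'lab' gives the label of the message of each
-- event (both ends carry the same label).

record BMSCData (P C : Set) : Set where
  field
    size    : ℕ
    kind    : Fin size → Kind
    proc    : Fin size → P
    partner : Fin size → Fin size
    lab     : Fin size → C
    pos     : Fin size → ℕ

module _ {P C : Set} (M : BMSCData P C) where
  open BMSCData M

  VEdge : Fin size → Fin size → Set
  VEdge e f = (kind e ≡ send × partner e ≡ f) ⊎ (proc e ≡ proc f × pos e < pos f)

  _≤v_ : Fin size → Fin size → Set
  _≤v_ = Star VEdge

  record IsBMSC : Set where
    field
      send→recv   : ∀ e → kind e ≡ send → kind (partner e) ≡ receive
      recv→send   : ∀ e → kind e ≡ receive → kind (partner e) ≡ send
      involutive  : ∀ e → partner (partner e) ≡ e
      lab-msg     : ∀ e → lab (partner e) ≡ lab e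
      proc-diff   : ∀ e → proc e ≢ proc (partner e)
      pos-inj     : ∀ e f → proc e ≡ proc f → pos e ≡ pos f → e ≡ f
      antisym     : ∀ e f → e ≤v f → f ≤v e → e ≡ f
      fifo        : ∀ e e' → kind e ≡ send → kind e' ≡ send →
                    proc e ≡ proc e' → pos e < pos e' →
                    proc (partner e) ≡ proc (partner e') →
                    pos (partner e) < pos (partner e')

  letter : Fin size → Act P C
  letter e with kind e
  ... | send    = snd (proc e) (proc (partner e)) (lab e)
  ... | receive = rcv (proc e) (proc (partner e)) (lab e)

  Lin : List (Act P C) → Set
  Lin w = Σ (Fin size → Fin size) λ π →
            Injective _≡_ _≡_ π ×
            (∀ i j → π i ≤v π j → toℕ i ≤ toℕ j) ×
            (w ≡ tabulate (λ i → letter (π i)))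

  Initiates : P → Set
  Initiates p = ∃ λ e → proc e ≡ p × (∀ f → f ≤v e → f ≡ e)

  Resolving : Fin size → (P → Set) → Set
  Resolving e P' = kind e ≡ send × (∀ p → P' p → ∃ λ f → proc f ≡ p × e ≤v f)

  HasResolving : (P → Set) → Set
  HasResolving P' = ∃ λ e → Resolving e P'

record BMSC (P C : Set) : Set where
  field
    dat   : BMSCData P C
    isBMSC : IsBMSC dat

maxPos : ∀ {P C} → BMSCData P C → ℕ
maxPos M = foldr _⊔_ 0 (map pos (allFin size))
  where open BMSCData M

-- weak sequential composition (all events of M₁ precede those of M₂ on
-- each process)
_·_ : ∀ {P C} → BMSCData P C → BMSCData P C → BMSCData P C
M₁ · M₂ = record
  { size    = n₁ + n₂
  ; kind    = λ e → [ M₁.kind , M₂.kind ]′ (splitAt n₁ e)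
  ; proc    = λ e → [ M₁.proc , M₂.proc ]′ (splitAt n₁ e)
  ; partner = λ e → [ (λ a → M₁.partner a ↑ˡ n₂) , (λ b → n₁ ↑ʳ M₂.partner b) ]′ (splitAt n₁ e)
  ; lab     = λ e → [ M₁.lab , M₂.lab ]′ (splitAt n₁ e)
  ; pos     = λ e → [ M₁.pos , (λ b → suc (maxPos M₁) + M₂.pos b) ]′ (splitAt n₁ e)
  }
  where
  module M₁ = BMSCData M₁
  module M₂ = BMSCData M₂
  n₁ = M₁.size
  n₂ = M₂.size

record MSG (P C : Set) : Set₁ where
  field
    k      : ℕ
    τ      : Fin k → Fin k → Set
    s₀     : Fin k
    sf     : Fin k
    L      : Fin k → BMSC P C
    s₀-noIn  : ∀ s → ¬ τ s s₀
    sf-noOut : ∀ s → ¬ τ sf s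
    reach₀   : ∀ s → Star τ s₀ s
    reachf   : ∀ s → Star τ s sf

module _ {P C : Set} (G : MSG P C) where
  open MSG G

  data Path : Fin k → Fin k → Set where
    ⟦_⟧   : ∀ s → Path s s
    _∷⟨_⟩_ : ∀ s {t u} → τ s t → Path t u → Path s u

  bmscOf : ∀ {s u} → Path s u → BMSCData P C
  bmscOf ⟦ s ⟧ = BMSC.dat (L s)
  bmscOf (s ∷⟨ _ ⟩ σ) = BMSC.dat (L s) · bmscOf σ

  LangMSG : List (Act P C) → Set
  LangMSG w = Σ (Path s₀ sf) λ ρ → Lin (bmscOf ρ) w

  Triggers : Fin k → P → Set
  Triggers s p = ∃ λ t → ∃ λ u → τ s t × Σ (Path t u) λ σ → Initiates (bmscOf σ) p

  ChoiceNode : Fin k → Set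
  ChoiceNode s = ∃ λ t → ∃ λ t' → τ s t × τ s t' × t ≢ t'

  LocalChoice : Fin k → Set
  LocalChoice s = ∃ λ p → Triggers s p × (∀ q → Triggers s q → q ≡ p)

  ControllableNode : Fin k → Set
  ControllableNode u =
    (∀ (σ : Path s₀ u) → HasResolving (bmscOf σ) (Triggers u)) ×
    (∀ s₁ → τ u s₁ → (σ : Path s₁ u) → HasResolving (bmscOf σ) (Triggers u))

  ControllableChoice : Set
  ControllableChoice = ∀ u → ChoiceNode u → LocalChoice u ⊎ ControllableNode u

record CFM (np : ℕ) (C : Set) : Set₁ where
  field
    nst     : Fin np → ℕ
    δ       : (p : Fin np) → Fin (nst p) → Act (Fin np) C → Fin (nst p) → Set
    δ-actor : ∀ p s a s' → δ p s a s' → actor a ≡ p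
    init    : (p : Fin np) → Fin (nst p)
    final   : (p : Fin np) → Fin (nst p) → Set

module _ {np : ℕ} {C : Set} (A : CFM np C) where
  open CFM A

  record Config : Set where
    constructor conf
    field
      st : (p : Fin np) → Fin (nst p)
      ch : Fin np → Fin np → List C
  open Config

  Step : Config → Act (Fin np) C → Config → Set
  Step c a@(snd p q m) c' =
    δ p (st c p) a (st c' p) ×
    (∀ r → r ≢ p → st c' r ≡ st c r) ×
    ch c' p q ≡ ch c p q ++ [ m ] ×
    (∀ r r' → ¬ (r ≡ p × r' ≡ q) → ch c' r r' ≡ ch c r r')
  Step c a@(rcv p q m) c' =
    δ p (st c p) a (st c' p) ×
    (∀ r → r ≢ p → st c' r ≡ st c r) ×
    ch c q p ≡ m ∷ ch c' q p ×
    (∀ r r' → ¬ (r ≡ q × r' ≡ p) → ch c' r r' ≡ ch c r r')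

  data Run : Config → List (Act (Fin np) C) → Config → Set where
    done : ∀ {c} → Run c [] c
    step : ∀ {c a c' w c''} → Step c a c' → Run c' w c'' → Run c (a ∷ w) c''

  initConfig : Config
  initConfig = conf init (λ _ _ → [])

  Accepting : Config → Set
  Accepting c = (∀ p → final p (st c p)) × (∀ p q → ch c p q ≡ [])

  LangCFM : List (Act (Fin np) C) → Set
  LangCFM w = ∃ λ c → Run initConfig w c × Accepting c

  DeadlockFree : Set
  DeadlockFree = ∀ c w → Run initConfig w c →
                 ∃ λ c' → ∃ λ w' → Run c w' c' × Accepting c'

h : ∀ {P C D : Set} → Act P (C × D) → Act P C
h (snd p q (m , _)) = snd p q m
h (rcv q p (m , _)) = rcv q p m

{-# OPTIONS --safe #-}

-- A run is cut into batches of bounded length.  When a choice node c recurs with events in between, all events beyond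
-- its second occurrence are causally after one send of the cycle: a resolving event, or the first event of the leader.
-- Hence the process of that send can decide at its first event of the current batch how to go on, and every process
-- that may act first in the next batch learns the decision in time.  Messages carry the label of their batch and the
-- decision known to the sender.
--
-- A process q may be absent from arbitrarily many batches while messages for it accumulate in several channels, and
-- must not read them in the wrong order.  Therefore a batch also promises from which process q receives next; this is
-- fixed together with the batch, hence known to q, and the later batches have to keep the promise.
--
-- The edge relation is not decidable, so that it is not known where the first choice of a run is.  All processes start
-- along a fixed default path from s₀ to sf; a run that leaves this path exhibits a choice node where it does, and
-- with it a decider.  Different processes may vote concurrently for leaving the path at different nodes.  The earliest
-- exit wins, since everything beyond it is causally after the vote for it.
module Submission where

open import Defs
open import Data.Nat using (ℕ; zero; suc; _+_; _*_; _⊔_; _≤_; _<_; z≤n; s≤s; _≤?_; _<?_)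
import Data.Nat.Properties as ℕₚ
open import Data.Nat.Induction using (<-wellFounded)
open import Data.Fin as Fin using (Fin; zero; suc; toℕ; splitAt; _↑ˡ_; _↑ʳ_)
import Data.Fin.Properties as Finₚ
open import Data.Fin.Induction using (po-wellFounded)
open import Data.List as List using (List; []; _∷_; _++_; [_]; map; tabulate; foldr; allFin; length; take; drop; filter; concat; upTo; _ʳ++_)
import Data.List.Properties as Listₚ
open import Data.List.Membership.Propositional using (_∈_; _∉_; find)
import Data.List.Membership.Propositional.Properties as ∈ₚ
open import Data.List.Relation.Unary.Any as Any using (Any; here; there)
import Data.List.Relation.Unary.Any.Properties as Anyₚ
open import Data.List.Relation.Unary.All as All using (All; []; _∷_)
import Data.List.Relation.Unary.All.Properties as Allₚ
open import Data.List.Relation.Unary.AllPairs using (AllPairs; []; _∷_)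
open import Data.Maybe using (Maybe; just; nothing)
open import Data.Maybe.Properties using (just-injective)
open import Data.Product using (Σ; ∃; _×_; _,_; proj₁; proj₂)
open import Data.Product.Properties using (≡-dec)
open import Data.Sum using (_⊎_; inj₁; inj₂; [_,_]′)
open import Data.Bool using (Bool; true; false)
open import Data.List.Relation.Binary.Pointwise as Pointwise using (Pointwise; []; _∷_)
open import Data.List.Relation.Unary.AllPairs.Properties as AllPairsₚ using ()
import Data.Vec.Properties as Vecₚ
open import Data.Vec as Vec using (Vec; []; _∷_)
open import Data.Empty using (⊥; ⊥-elim)
open import Function using (_∘_)
open import Induction.WellFounded using (Acc; acc; WellFounded)
open import Relation.Nullary using (¬_; Dec; yes; no; contradiction)
open import Relation.Nullary.Decidable using (_×-dec_; _⊎-dec_; ¬?)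
open import Relation.Binary.PropositionalEquality using (_≡_; _≢_; refl; sym; trans; cong; cong₂; subst; subst₂; isEquivalence)
open import Relation.Binary.Definitions using (tri<; tri≈; tri>; DecidableEquality)
open import Relation.Binary.Construct.Closure.ReflexiveTransitive using (Star; ε; _◅_; _◅◅_)

-- The transitions of a CFM form an arbitrary relation, so they may demand witnesses that cannot be
-- computed. A vote is cast only together with a plan, a chain of further batches up to `sf`; this
-- is what yields deadlock-freedom although neither `τ` nor `Triggers` is decidable. There are
-- finitely many labels, so a label can recur in a run and does not tell which batch a message comes
-- from. The invariant therefore refers to a chain of numbered batches that no process sees; FIFO
-- order and the promises show that the head of a channel is always taken for the batch it was sent
-- in. A vote may shorten this chain while other processes are ahead of the voter. Everything
-- executed survives, because a causally minimal event beyond the new exit would have to come after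
-- the voter's first event in the batch, which is still missing. A cycle of nodes without events
-- offers no send to attach a decision to, and it may be repeated at will. Hence the planned batches
-- after the default path list only nodes with events, and only these are counted by the bounds.

infix 9 _‼_

_‼_ : ∀ {A : Set} → List A → ℕ → Maybe A
[]       ‼ _     = nothing
(x ∷ xs) ‼ zero  = just x
(x ∷ xs) ‼ suc i = xs ‼ i

module _ {A : Set} where

  ‼-++ˡ : ∀ (xs : List A) {ys i x} → xs ‼ i ≡ just x → (xs ++ ys) ‼ i ≡ just x
  ‼-++ˡ (x ∷ xs) {i = zero}  eq = eq
  ‼-++ˡ (x ∷ xs) {i = suc i} eq = ‼-++ˡ xs eq

  ‼-++ʳ : ∀ (xs : List A) {ys} i → (xs ++ ys) ‼ (length xs + i) ≡ ys ‼ i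
  ‼-++ʳ []       i = refl
  ‼-++ʳ (x ∷ xs) i = ‼-++ʳ xs i

  ‼-< : ∀ (xs : List A) {i x} → xs ‼ i ≡ just x → i < length xs
  ‼-< (x ∷ xs) {zero}  eq = s≤s z≤n
  ‼-< (x ∷ xs) {suc i} eq = s≤s (‼-< xs eq)

  ‼-++⁻ : ∀ (xs : List A) {ys i x} → (xs ++ ys) ‼ i ≡ just x →
          xs ‼ i ≡ just x ⊎ ∃ λ j → i ≡ length xs + j × ys ‼ j ≡ just x
  ‼-++⁻ []       eq = inj₂ (_ , refl , eq)
  ‼-++⁻ (x ∷ xs) {i = zero}  eq = inj₁ eq
  ‼-++⁻ (x ∷ xs) {i = suc i} eq with ‼-++⁻ xs eq
  ... | inj₁ p = inj₁ p
  ... | inj₂ (j , p , q) = inj₂ (j , cong suc p , q)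

  ‼-take⁺ : ∀ n (xs : List A) {i x} → i < n → xs ‼ i ≡ just x → take n xs ‼ i ≡ just x
  ‼-take⁺ (suc n) (x ∷ xs) {zero}  _ eq = eq
  ‼-take⁺ (suc n) (x ∷ xs) {suc i} (s≤s lt) eq = ‼-take⁺ n xs lt eq

  ‼-take⁻ : ∀ n (xs : List A) {i x} → take n xs ‼ i ≡ just x → i < n × xs ‼ i ≡ just x
  ‼-take⁻ (suc n) (x ∷ xs) {zero}  eq = s≤s z≤n , eq
  ‼-take⁻ (suc n) (x ∷ xs) {suc i} eq with ‼-take⁻ n xs eq
  ... | lt , eq′ = s≤s lt , eq′

  ‼-drop : ∀ n (xs : List A) i → drop n xs ‼ i ≡ xs ‼ (n + i)
  ‼-drop zero    xs       i = refl
  ‼-drop (suc n) []       i = refl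
  ‼-drop (suc n) (x ∷ xs) i = ‼-drop n xs i

-- Maxima, minimal elements, finite codings and facts about lists

foldr-⊔-ub : ∀ {x : ℕ} {xs} → x ∈ xs → x ≤ foldr _⊔_ 0 xs
foldr-⊔-ub {xs = y ∷ ys} (here refl) = ℕₚ.m≤m⊔n y _
foldr-⊔-ub {xs = y ∷ ys} (there p)   = ℕₚ.≤-trans (foldr-⊔-ub p) (ℕₚ.m≤n⊔m y _)

maxOver : ∀ {n} → (Fin n → ℕ) → ℕ
maxOver f = foldr _⊔_ 0 (map f (allFin _))

maxOver-ub : ∀ {n} (f : Fin n → ℕ) x → f x ≤ maxOver f
maxOver-ub f x = foldr-⊔-ub (∈ₚ.∈-map⁺ f (∈ₚ.∈-allFin x))

argmin : ∀ n {P : Fin n → Set} → (∀ x → Dec (P x)) → (f : Fin n → ℕ) →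
         (∃ λ x → P x × ∀ y → P y → f x ≤ f y) ⊎ (∀ y → ¬ P y)
argmin zero    P? f = inj₂ λ ()
argmin (suc n) P? f with argmin n (P? ∘ suc) (f ∘ suc) | P? zero
... | inj₂ none | no ¬p = inj₂ λ { zero → ¬p ; (suc y) → none y }
... | inj₂ none | yes p = inj₁ (zero , p , λ { zero _ → ℕₚ.≤-refl ; (suc y) q → contradiction q (none y) })
... | inj₁ (x , px , mn) | no ¬p = inj₁ (suc x , px , λ { zero q → contradiction q ¬p ; (suc y) q → mn y q })
... | inj₁ (x , px , mn) | yes p with f zero ≤? f (suc x)
...   | yes le = inj₁ (zero , p , λ { zero _ → ℕₚ.≤-refl ; (suc y) q → ℕₚ.≤-trans le (mn y q) })
...   | no  gt = inj₁ (suc x , px , λ { zero _ → ℕₚ.<⇒≤ (ℕₚ.≰⇒> gt) ; (suc y) q → mn y q })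

module _ {A : Set} {R : A → A → Set} (R? : ∀ x y → Dec (R x y)) where

  -- Only the starting point has to be accessible, and only within the list: the event orders below
  -- are well-founded on the events of one run, not on all pairs of an index and a node event.
  minimal : ∀ (xs : List A) {x} → Acc (λ u v → R u v × u ∈ xs) x → x ∈ xs →
            ∃ λ m → m ∈ xs × ∀ {y} → y ∈ xs → ¬ R y m
  minimal xs {x} (acc below) x∈ with Any.any? (λ y → R? y x) xs
  ... | no none = x , x∈ , λ y∈ r → none (lose y∈ r)
    where lose : ∀ {y} {ys : List A} → y ∈ ys → R y x → Any (λ z → R z x) ys
          lose (here refl) r = here r
          lose (there p)   r = there (lose p r)
  ... | yes some with find some
  ...   | y , y∈ , r = minimal xs (below (r , y∈)) y∈

zero? : ∀ n → n ≡ 0 ⊎ 0 < n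
zero? zero    = inj₁ refl
zero? (suc n) = inj₂ (s≤s z≤n)

send≢receive : send ≢ receive
send≢receive ()

_≟ᴷ_ : DecidableEquality Kind
send    ≟ᴷ send    = yes refl
send    ≟ᴷ receive = no λ ()
receive ≟ᴷ send    = no λ ()
receive ≟ᴷ receive = yes refl

record Coding (A : Set) : Set where
  field
    codes   : ℕ
    to      : A → Fin codes
    from    : Fin codes → A
    from-to : ∀ a → from (to a) ≡ a

module _ where
  open Coding

  finCoding : ∀ n → Coding (Fin n)
  finCoding n = record { codes = n ; to = λ i → i ; from = λ i → i ; from-to = λ _ → refl }

  infixr 2 _×ᶜ_
  _×ᶜ_ : ∀ {A B : Set} → Coding A → Coding B → Coding (A × B)
  _×ᶜ_ {A} {B} c d = record
    { codes   = codes c * codes d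
    ; to      = λ (a , b) → Fin.combine (to c a) (to d b)
    ; from    = λ i → decoded (Fin.remQuot (codes d) i)
    ; from-to = λ (a , b) → trans (cong decoded (Finₚ.remQuot-combine (to c a) (to d b)))
                                  (cong₂ _,_ (from-to c a) (from-to d b)) }
    where
    decoded : Fin (codes c) × Fin (codes d) → A × B
    decoded (i , j) = from c i , from d j

  maybeCoding : ∀ {A : Set} → Coding A → Coding (Maybe A)
  maybeCoding {A} c = record
    { codes   = suc (codes c)
    ; to      = λ { nothing → zero ; (just a) → suc (to c a) }
    ; from    = λ { zero → nothing ; (suc i) → just (from c i) }
    ; from-to = λ { nothing → refl ; (just a) → cong just (from-to c a) } }

  boolCoding : Coding Bool
  boolCoding = record
    { codes   = 2
    ; to      = λ { false → zero ; true → suc zero }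
    ; from    = λ { zero → false ; (suc _) → true }
    ; from-to = λ { false → refl ; true → refl } }

  vecCoding : ∀ {A : Set} → Coding A → ∀ n → Coding (Vec A n)
  vecCoding c zero = record { codes = 1 ; to = λ _ → zero ; from = λ _ → [] ; from-to = λ { [] → refl } }
  vecCoding {A} c (suc n) = record
    { codes   = codes rest
    ; to      = λ { (a ∷ as) → to rest (a , as) }
    ; from    = λ i → cons (from rest i)
    ; from-to = λ { (a ∷ as) → cong cons (from-to rest (a , as)) } }
    where
    rest : Coding (A × Vec A n)
    rest = c ×ᶜ vecCoding c n
    cons : A × Vec A n → Vec A (suc n)
    cons (a , as) = a ∷ as

pointwise-map : ∀ {A B : Set} {R S : A → B → Set} {xs ys} → (∀ {x y} → x ∈ xs → R x y → S x y) →
                Pointwise R xs ys → Pointwise S xs ys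
pointwise-map f []       = []
pointwise-map f (r ∷ rs) = f (here refl) r ∷ pointwise-map (f ∘ there) rs

injective⇒surjective : ∀ {n} (f : Fin n → Fin n) → (∀ {i j} → f i ≡ f j → i ≡ j) → ∀ t → ∃ λ i → f i ≡ t
injective⇒surjective {suc n} f inj t with Finₚ.any? (λ i → f i Fin.≟ t)
... | yes r = r
... | no none = contradiction
        (Finₚ.injective⇒≤ {f = λ i → Fin.punchOut (λ eq → none (i , sym eq))} (λ {i} {j} eq → inj (Finₚ.punchOut-injective (λ e → none (i , sym e)) (λ e → none (j , sym e)) eq)))
        (ℕₚ.<⇒≱ (ℕₚ.n<1+n n))

module _ {A : Set} where

  allPairs-ʳ++ : ∀ {R : A → A → Set} xs {ys} → AllPairs R (xs ʳ++ ys) →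
                 AllPairs (λ a b → R b a) xs × (∀ {a b} → a ∈ xs → b ∈ ys → R a b) × AllPairs R ys
  allPairs-ʳ++ []       ps = [] , (λ ()) , ps
  allPairs-ʳ++ (x ∷ xs) ps with allPairs-ʳ++ xs ps
  ... | qs , cross , r ∷ rs = All.tabulate (λ y∈ → cross y∈ (here refl)) ∷ qs ,
          (λ { (here refl) b∈ → All.lookup r b∈ ; (there a∈) b∈ → cross a∈ (there b∈) }) , rs

  ∈-ʳ++⁻ : ∀ (xs : List A) {ys x} → x ∈ xs ʳ++ ys → x ∈ xs ⊎ x ∈ ys
  ∈-ʳ++⁻ []       x∈ = inj₂ x∈
  ∈-ʳ++⁻ (y ∷ xs) x∈ with ∈-ʳ++⁻ xs x∈
  ... | inj₁ p         = inj₁ (there p)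
  ... | inj₂ (here eq) = inj₁ (here eq)
  ... | inj₂ (there p) = inj₂ p

  ∈-ʳ++⁺ : ∀ (xs : List A) {ys x} → x ∈ xs ⊎ x ∈ ys → x ∈ xs ʳ++ ys
  ∈-ʳ++⁺ []       (inj₂ p)           = p
  ∈-ʳ++⁺ (y ∷ xs) (inj₁ (here refl)) = ∈-ʳ++⁺ xs (inj₂ (here refl))
  ∈-ʳ++⁺ (y ∷ xs) (inj₁ (there p))   = ∈-ʳ++⁺ xs (inj₁ p)
  ∈-ʳ++⁺ (y ∷ xs) (inj₂ p)           = ∈-ʳ++⁺ xs (inj₂ (there p))

  allPairs-lookup : ∀ {R : A → A → Set} {xs} → AllPairs R xs → ∀ {i j} → i Fin.< j → R (List.lookup xs i) (List.lookup xs j)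
  allPairs-lookup (r ∷ _)  {zero}  {suc j} _       = All.lookup r (∈ₚ.∈-lookup j)
  allPairs-lookup (_ ∷ rs) {suc i} {suc j} (s≤s l) = allPairs-lookup rs l

  tabulate-cast : ∀ {m n} (eq : m ≡ n) (f : Fin m → A) → tabulate f ≡ tabulate (f ∘ Fin.cast (sym eq))
  tabulate-cast refl f = Listₚ.tabulate-cong λ i → cong f (sym (Finₚ.cast-is-id refl i))

-- Events and paths

module Walks {np nc : ℕ} (G : MSG (Fin np) (Fin nc)) where

  open MSG G public

  dat : Fin k → BMSCData (Fin np) (Fin nc)
  dat s = BMSC.dat (L s)

  module Node (s : Fin k) where
    open BMSCData (dat s) public
    open IsBMSC (BMSC.isBMSC (L s)) public

  NodeEvent : Set
  NodeEvent = Σ (Fin k) λ s → Fin (Node.size s)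

  Event : Set
  Event = ℕ × NodeEvent

  position : NodeEvent → ℕ
  position (s , x) = Node.pos s x

  abstract

    -- Strictly above every position, so that (i , x) ↦ i * B + pos x is lexicographic.
    B : ℕ
    B = suc (maxOver λ s → maxPos (dat s))

    position<B : ∀ x → position x < B
    position<B (s , x) = s≤s (ℕₚ.≤-trans
      (maxOver-ub (Node.pos s) x)
      (maxOver-ub (λ s → maxPos (dat s)) s))

  idx : Event → ℕ
  idx = proj₁

  kind : Event → Kind
  kind (_ , s , x) = Node.kind s x

  proc : Event → Fin np
  proc (_ , s , x) = Node.proc s x

  partner : Event → Event
  partner (i , s , x) = i , s , Node.partner s x

  label : Event → Fin nc
  label (_ , s , x) = Node.lab s x

  coord : Event → ℕ
  coord (i , x) = i * B + position x

  act : Kind → Fin np → Fin np → Fin nc → Act (Fin np) (Fin nc)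
  act send    = snd
  act receive = rcv

  letterOf : Event → Act (Fin np) (Fin nc)
  letterOf e = act (kind e) (proc e) (proc (partner e)) (label e)

  Edge : Event → Event → Set
  Edge e f = (kind e ≡ send × partner e ≡ f) ⊎ (proc e ≡ proc f × coord e < coord f)

  record Valid (ns : List (Fin k)) (e : Event) : Set where
    constructor valid
    field at : ns ‼ idx e ≡ just (proj₁ (proj₂ e))
  open Valid public

  _≟ᴱ_ : DecidableEquality Event
  _≟ᴱ_ = ≡-dec ℕₚ._≟_ (≡-dec Fin._≟_ Fin._≟_)

  edge? : ∀ e f → Dec (Edge e f)
  edge? e f = ((kind e ≟ᴷ send) ×-dec (partner e ≟ᴱ f)) ⊎-dec ((proc e Fin.≟ proc f) ×-dec (coord e <? coord f))

  kind-partner-send : ∀ e → kind e ≡ send → kind (partner e) ≡ receive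
  kind-partner-send (_ , s , x) = Node.send→recv s x

  kind-partner-receive : ∀ e → kind e ≡ receive → kind (partner e) ≡ send
  kind-partner-receive (_ , s , x) = Node.recv→send s x

  partner-involutive : ∀ e → partner (partner e) ≡ e
  partner-involutive (i , s , x) = cong (λ y → i , s , y) (Node.involutive s x)

  label-partner : ∀ e → label (partner e) ≡ label e
  label-partner (_ , s , x) = Node.lab-msg s x

  proc-partner : ∀ e → proc e ≢ proc (partner e)
  proc-partner (_ , s , x) = Node.proc-diff s x

  coord< : ∀ (e : Event) → coord e < suc (idx e) * B
  coord< (i , x) = subst (i * B + position x <_) (ℕₚ.+-comm (i * B) B) (ℕₚ.+-monoʳ-< (i * B) (position<B x))

  *B≤coord : ∀ (e : Event) → idx e * B ≤ coord e
  *B≤coord (i , x) = ℕₚ.m≤m+n (i * B) _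

  idx<⇒coord< : ∀ (e f : Event) → idx e < idx f → coord e < coord f
  idx<⇒coord< e f lt = ℕₚ.<-≤-trans (coord< e) (ℕₚ.≤-trans (ℕₚ.*-monoˡ-≤ B lt) (*B≤coord f))

  coord≤⇒idx≤ : ∀ (e f : Event) → coord e ≤ coord f → idx e ≤ idx f
  coord≤⇒idx≤ e f le = ℕₚ.≮⇒≥ λ lt → ℕₚ.<⇒≱ (idx<⇒coord< f e lt) le

  idx<⇒coord<* : ∀ e {κ} → idx e < κ → coord e < κ * B
  idx<⇒coord<* e lt = ℕₚ.<-≤-trans (coord< e) (ℕₚ.*-monoˡ-≤ B lt)

  valid-node : ∀ {ns s t i} {x : Fin (Node.size s)} {y : Fin (Node.size t)} →
               Valid ns (i , s , x) → Valid ns (i , t , y) → s ≡ t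
  valid-node p q = just-injective (trans (sym (at p)) (at q))

  coord-injective : ∀ {ns e f} → Valid ns e → Valid ns f → proc e ≡ proc f → coord e ≡ coord f → e ≡ f
  coord-injective {e = e} {f} ve vf pe ce
    with ℕₚ.≤-antisym (coord≤⇒idx≤ e f (ℕₚ.≤-reflexive ce)) (coord≤⇒idx≤ f e (ℕₚ.≤-reflexive (sym ce)))
  coord-injective {e = i , s , x} {i , t , y} ve vf pe ce | refl with valid-node {x = x} {y} ve vf
  ... | refl with Node.pos-inj s x y pe (ℕₚ.+-cancelˡ-≡ (i * B) _ _ ce)
  ...   | refl = refl

  fifo : ∀ {ns e f} → Valid ns e → Valid ns f → kind e ≡ send → kind f ≡ send →
         proc e ≡ proc f → proc (partner e) ≡ proc (partner f) → coord e < coord f →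
         coord (partner e) < coord (partner f)
  fifo {e = e@(i , s , x)} {f@(j , t , y)} ve vf ke kf pe pp lt
    with ℕₚ.m≤n⇒m<n∨m≡n (coord≤⇒idx≤ e f (ℕₚ.<⇒≤ lt))
  ... | inj₁ i<j = idx<⇒coord< (partner e) (partner f) i<j
  ... | inj₂ refl with valid-node {x = x} {y} ve vf
  ...   | refl = ℕₚ.+-monoʳ-< (i * B) (Node.fifo s x y ke kf pe (ℕₚ.+-cancelˡ-< (i * B) _ _ lt) pp)

  edge-coord-irrefl : ∀ e → ¬ Edge e e
  edge-coord-irrefl e (inj₁ (ke , eq)) = proc-partner e (sym (cong proc eq))
  edge-coord-irrefl e (inj₂ (_ , lt))  = ℕₚ.<-irrefl refl lt

  edge-idx : ∀ {e f} → Edge e f → idx e ≤ idx f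
  edge-idx (inj₁ (_ , refl)) = ℕₚ.≤-refl
  edge-idx {e} {f} (inj₂ (_ , lt)) = coord≤⇒idx≤ e f (ℕₚ.<⇒≤ lt)

  edge-within : ∀ {i s} {x y : Fin (Node.size s)} → Edge (i , s , x) (i , s , y) → VEdge (dat s) x y
  edge-within (inj₁ (ke , refl)) = inj₁ (ke , refl)
  edge-within {i} (inj₂ (pe , lt)) = inj₂ (pe , ℕₚ.+-cancelˡ-< (i * B) _ _ lt)

  node-wf : ∀ s → WellFounded (λ x y → _≤v_ (dat s) x y × x ≢ y)
  node-wf s = po-wellFounded record
    { isPreorder = record
      { isEquivalence = isEquivalence
      ; reflexive     = λ { refl → ε }
      ; trans         = _◅◅_ }
    ; antisym = λ {x} {y} → Node.antisym s x y }

  _⊏⟨_⟩_ : Event → List (Fin k) → Event → Set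
  e ⊏⟨ ns ⟩ f = Edge e f × Valid ns e

  -- On arbitrary events `Edge` may have cycles, since two nodes may compete for the same index.
  -- Validity leaves one node per index; then edges never decrease the index, and edges within one
  -- index belong to the visual order of that node, a finite partial order. The induction is
  -- lexicographic.
  ⊏-acc : ∀ ns {e} → Valid ns e → Acc (λ u v → u ⊏⟨ ns ⟩ v) e
  ⊏-acc ns {i , s , x} = outer (<-wellFounded i) (node-wf s x)
    where
    Goal : Event → Set
    Goal e = Valid ns e → Acc (λ u v → u ⊏⟨ ns ⟩ v) e

    inner : ∀ {i} → (∀ {j} → j < i → ∀ t y → Goal (j , t , y)) →
            ∀ {s x} → Acc (λ x y → _≤v_ (dat s) x y × x ≢ y) x → Goal (i , s , x)
    inner {i} ih {s} {x} (acc below) v = acc λ { {j , t , y} (ed , v′) → before j t y ed v′ }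
      where
      before : ∀ j t y → Edge (j , t , y) (i , s , x) → Goal (j , t , y)
      before j t y ed v′ with ℕₚ.m≤n⇒m<n∨m≡n (edge-idx ed)
      ... | inj₁ j<i = ih j<i t y v′
      ... | inj₂ refl with valid-node {x = y} {x} v′ v
      ...   | refl = inner ih (below ((edge-within ed ◅ ε) , λ { refl → edge-coord-irrefl (i , s , x) ed })) v′

    outer : ∀ {i} → Acc _<_ i → ∀ {s x} → Acc (λ x y → _≤v_ (dat s) x y × x ≢ y) x → Goal (i , s , x)
    outer (acc below) = inner λ j<i t y → outer (below j<i) (node-wf t y)

  eventsFrom : ℕ → List (Fin k) → List Event
  eventsFrom i []       = []
  eventsFrom i (s ∷ ns) = map (λ x → i , s , x) (allFin (Node.size s)) ++ eventsFrom (suc i) ns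

  events : List (Fin k) → List Event
  events = eventsFrom 0

  private
    ∈-eventsFrom⁺ : ∀ i ns {j s x} → ns ‼ j ≡ just s → (i + j , s , x) ∈ eventsFrom i ns
    ∈-eventsFrom⁺ i (s ∷ ns) {zero} {_} {x} refl rewrite ℕₚ.+-identityʳ i =
      ∈ₚ.∈-++⁺ˡ (∈ₚ.∈-map⁺ (λ x → i , s , x) (∈ₚ.∈-allFin x))
    ∈-eventsFrom⁺ i (s ∷ ns) {suc j} {_} {x} eq rewrite ℕₚ.+-suc i j =
      ∈ₚ.∈-++⁺ʳ (map (λ x → i , s , x) (allFin (Node.size s))) (∈-eventsFrom⁺ (suc i) ns eq)

    ∈-eventsFrom⁻ : ∀ i ns {e} → e ∈ eventsFrom i ns → ∃ λ j → idx e ≡ i + j × ns ‼ j ≡ just (proj₁ (proj₂ e))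
    ∈-eventsFrom⁻ i (s ∷ ns) e∈ with ∈ₚ.∈-++⁻ (map (λ x → i , s , x) (allFin (Node.size s))) e∈
    ... | inj₁ p with ∈ₚ.∈-map⁻ (λ x → i , s , x) p
    ...   | x , _ , refl = 0 , sym (ℕₚ.+-identityʳ i) , refl
    ∈-eventsFrom⁻ i (s ∷ ns) e∈ | inj₂ q with ∈-eventsFrom⁻ (suc i) ns q
    ... | j , eq , eq′ = suc j , trans eq (sym (ℕₚ.+-suc i j)) , eq′

  ∈-events⁺ : ∀ {ns e} → Valid ns e → e ∈ events ns
  ∈-events⁺ {ns} v = ∈-eventsFrom⁺ 0 ns (at v)

  ∈-events⁻ : ∀ {ns e} → e ∈ events ns → Valid ns e
  ∈-events⁻ {ns} e∈ with ∈-eventsFrom⁻ 0 ns e∈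
  ... | j , refl , eq = valid eq

  shift : ℕ → Event → Event
  shift o (i , x) = o + i , x

  coord-shift : ∀ o e → coord (shift o e) ≡ o * B + coord e
  coord-shift o (i , x) = trans (cong (_+ position x) (ℕₚ.*-distribʳ-+ B o i)) (ℕₚ.+-assoc (o * B) (i * B) _)

  shift-edge : ∀ o {e f} → Edge e f → Edge (shift o e) (shift o f)
  shift-edge o (inj₁ (ke , refl)) = inj₁ (ke , refl)
  shift-edge o {e} {f} (inj₂ (pe , lt)) = inj₂ (pe , subst₂ _<_ (sym (coord-shift o e)) (sym (coord-shift o f)) (ℕₚ.+-monoʳ-< (o * B) lt))

  valid-drop : ∀ n {ns e} → Valid (drop n ns) e → Valid ns (shift n e)
  valid-drop n {ns} {e} v = valid (trans (sym (‼-drop n ns (idx e))) (at v))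

  valid-++ʳ : ∀ xs {ys e} → Valid ys e → Valid (xs ++ ys) (shift (length xs) e)
  valid-++ʳ xs {e = e} v = valid (trans (‼-++ʳ xs (idx e)) (at v))

  First : List (Fin k) → Fin np → Event → Set
  First ns q e = Valid ns e × proc e ≡ q × (∀ f → Valid ns f → proc f ≡ q → coord e ≤ coord f)

  Takes : List (Fin k) → Fin np → Set
  Takes ns q = ∃ λ e → Valid ns e × proc e ≡ q

  first? : ∀ ns q → (∃ λ e → First ns q e) ⊎ ¬ Takes ns q
  first? [] q = inj₂ λ { (_ , valid () , _) }
  first? (s ∷ ns) q with argmin (Node.size s) (λ x → Node.proc s x Fin.≟ q) (Node.pos s)
  ... | inj₁ (x , px , mn) = inj₁ ((0 , s , x) , valid refl , px , λ
          { (zero , .s , y) (valid refl) py → mn y py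
          ; f@(suc j , t , y) v py → ℕₚ.<⇒≤ (idx<⇒coord< (0 , s , x) f (s≤s z≤n)) })
  ... | inj₂ none with first? ns q
  ...   | inj₁ (e , v , pe , mn) = inj₁ (shift 1 e , valid (at v) , pe , λ
          { (zero , .s , y) (valid refl) py → contradiction py (none y)
          ; (suc j , y) vf py → subst₂ _≤_ (sym (coord-shift 1 e)) (sym (coord-shift 1 (j , y))) (ℕₚ.+-monoʳ-≤ (1 * B) (mn (j , y) (valid (at vf)) py)) })
  ...   | inj₂ ¬t = inj₂ λ { ((zero , .s , x) , valid refl , p) → none x p ; ((suc j , x) , v , p) → ¬t ((j , x) , valid (at v) , p) }

  takes⇒first : ∀ {ns q} → Takes ns q → ∃ λ e → First ns q e
  takes⇒first {ns} {q} t with first? ns q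
  ... | inj₁ r = r
  ... | inj₂ ¬t = contradiction t ¬t

  first-unique : ∀ {ns q e f} → First ns q e → First ns q f → e ≡ f
  first-unique {e = e} {f} (ve , pe , me) (vf , pf , mf) =
    coord-injective ve vf (trans pe (sym pf)) (ℕₚ.≤-antisym (me f vf pf) (mf e ve pe))

  first-++ : ∀ {xs} ys {q e} → First xs q e → First (xs ++ ys) q e
  first-++ {xs} ys {q} {e} (v , p , m) = valid (‼-++ˡ xs (at v)) , p , least
    where
    least : ∀ f → Valid (xs ++ ys) f → proc f ≡ q → coord e ≤ coord f
    least f vf pf with ‼-++⁻ xs (at vf)
    ... | inj₁ v′ = m f (valid v′) pf
    ... | inj₂ (j , refl , _) = ℕₚ.<⇒≤ (idx<⇒coord< e f (ℕₚ.<-≤-trans (‼-< xs (at v)) (ℕₚ.m≤m+n _ j)))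

  first-++ʳ : ∀ xs {ys q e} → ¬ Takes xs q → First ys q e → First (xs ++ ys) q (shift (length xs) e)
  first-++ʳ xs {ys} {q} {e} ¬t (v , p , m) = valid-++ʳ xs {e = e} v , p , least
    where
    least : ∀ f → Valid (xs ++ ys) f → proc f ≡ q → coord (shift (length xs) e) ≤ coord f
    least f@(_ , x) vf pf with ‼-++⁻ xs (at vf)
    ... | inj₁ v′ = contradiction (f , valid v′ , pf) ¬t
    ... | inj₂ (j , refl , v′) = subst₂ _≤_ (sym (coord-shift (length xs) e)) (sym (coord-shift (length xs) (j , x)))
                                   (ℕₚ.+-monoʳ-≤ (length xs * B) (m (j , x) (valid v′) pf))

  -- Events of the bMSC of a path as indexed node events

  node-pos≤ : ∀ s x → Node.pos s x ≤ maxPos (dat s)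
  node-pos≤ s = maxOver-ub (Node.pos s)

  -- Nodes without events may be left out of the list.
  data Thin : ∀ {s u} → Path G s u → List (Fin k) → Set where
    keep₁ : ∀ {s} → Thin ⟦ s ⟧ (s ∷ [])
    skip₁ : ∀ {s} → Node.size s ≡ 0 → Thin ⟦ s ⟧ []
    keep  : ∀ {s t u} {e : τ s t} {σ : Path G t u} {ns} → Thin σ ns → Thin (s ∷⟨ e ⟩ σ) (s ∷ ns)
    skip  : ∀ {s t u} {e : τ s t} {σ : Path G t u} {ns} → Node.size s ≡ 0 → Thin σ ns → Thin (s ∷⟨ e ⟩ σ) ns

  private
    none : ∀ {A : Set} {n} → n ≡ 0 → Fin n → A
    none refl ()

  size : ∀ {s u} → Path G s u → ℕ
  size σ = BMSCData.size (bmscOf G σ)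

  -- Events of `bmscOf` are elements of nested sums. Replacing them by a list index and a node event
  -- turns splitting and joining of runs into arithmetic on the index, and makes omitted nodes
  -- invisible.
  toEvent : ∀ {s u} {σ : Path G s u} {ns} → Thin σ ns → Fin (size σ) → Event
  toEvent (keep₁ {s})  x = 0 , s , x
  toEvent (skip₁ z)    x = none z x
  toEvent (keep {s} θ) x = [ (λ a → 0 , s , a) , (λ b → shift 1 (toEvent θ b)) ]′ (splitAt (Node.size s) x)
  toEvent (skip {s} z θ) x = [ none z , toEvent θ ]′ (splitAt (Node.size s) x)

  toEvent-valid : ∀ {s u} {σ : Path G s u} {ns} (θ : Thin σ ns) x → Valid ns (toEvent θ x)
  toEvent-valid keep₁ x = valid refl
  toEvent-valid (skip₁ z) x = none z x
  toEvent-valid (keep {s} θ) x with splitAt (Node.size s) x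
  ... | inj₁ a = valid refl
  ... | inj₂ b = valid (at (toEvent-valid θ b))
  toEvent-valid (skip {s} z θ) x with splitAt (Node.size s) x
  ... | inj₁ a = none z a
  ... | inj₂ b = toEvent-valid θ b

  data-toEvent : ∀ {s u} {σ : Path G s u} {ns} (θ : Thin σ ns) x → let module M = BMSCData (bmscOf G σ) in
                 (M.kind x , M.proc x , M.lab x) ≡ (kind (toEvent θ x) , proc (toEvent θ x) , label (toEvent θ x))
  data-toEvent keep₁ x = refl
  data-toEvent (skip₁ z) x = none z x
  data-toEvent (keep {s} θ) x with splitAt (Node.size s) x
  ... | inj₁ a = refl
  ... | inj₂ b = data-toEvent θ b
  data-toEvent (skip {s} z θ) x with splitAt (Node.size s) x
  ... | inj₁ a = none z a
  ... | inj₂ b = data-toEvent θ b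

  module _ {s u} {σ : Path G s u} {ns} (θ : Thin σ ns) (x : Fin (size σ)) where

    kind-toEvent : BMSCData.kind (bmscOf G σ) x ≡ kind (toEvent θ x)
    kind-toEvent = cong proj₁ (data-toEvent θ x)

    proc-toEvent : BMSCData.proc (bmscOf G σ) x ≡ proc (toEvent θ x)
    proc-toEvent = cong (proj₁ ∘ proj₂) (data-toEvent θ x)

    label-toEvent : BMSCData.lab (bmscOf G σ) x ≡ label (toEvent θ x)
    label-toEvent = cong (proj₂ ∘ proj₂) (data-toEvent θ x)

  partner-toEvent : ∀ {s u} {σ : Path G s u} {ns} (θ : Thin σ ns) x →
                    toEvent θ (BMSCData.partner (bmscOf G σ) x) ≡ partner (toEvent θ x)
  partner-toEvent keep₁ x = refl
  partner-toEvent (skip₁ z) x = none z x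
  partner-toEvent (keep {s} {σ = σ} θ) x with splitAt (Node.size s) x
  ... | inj₁ a rewrite Finₚ.splitAt-↑ˡ (Node.size s) (Node.partner s a) (size σ) = refl
  ... | inj₂ b rewrite Finₚ.splitAt-↑ʳ (Node.size s) (size σ) (BMSCData.partner (bmscOf G σ) b) =
        cong (shift 1) (partner-toEvent θ b)
  partner-toEvent (skip {s} {σ = σ} z θ) x with splitAt (Node.size s) x
  ... | inj₁ a = none z a
  ... | inj₂ b rewrite Finₚ.splitAt-↑ʳ (Node.size s) (size σ) (BMSCData.partner (bmscOf G σ) b) = partner-toEvent θ b

  shift1-< : ∀ e f → coord e < coord f → coord (shift 1 e) < coord (shift 1 f)
  shift1-< e f lt = subst₂ _<_ (sym (coord-shift 1 e)) (sym (coord-shift 1 f)) (ℕₚ.+-monoʳ-< (1 * B) lt)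

  shift1-<⁻ : ∀ e f → coord (shift 1 e) < coord (shift 1 f) → coord e < coord f
  shift1-<⁻ e f lt = ℕₚ.+-cancelˡ-< (1 * B) _ _ (subst₂ _<_ (coord-shift 1 e) (coord-shift 1 f) lt)

  -- The numbers differ: composition shifts by `maxPos` of each single node, coordinates by the
  -- common `B`. Both shifts exceed all positions before them, so the induced orders agree.
  pos-toEvent : ∀ {s u} {σ : Path G s u} {ns} (θ : Thin σ ns) x y →
                BMSCData.pos (bmscOf G σ) x < BMSCData.pos (bmscOf G σ) y →
                coord (toEvent θ x) < coord (toEvent θ y)
  pos-toEvent keep₁ x y lt = lt
  pos-toEvent (skip₁ z) x y lt = none z x
  pos-toEvent (keep {s} θ) x y lt with splitAt (Node.size s) x | splitAt (Node.size s) y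
  ... | inj₁ a | inj₁ b = lt
  ... | inj₁ a | inj₂ b = idx<⇒coord< (0 , s , a) (shift 1 (toEvent θ b)) (s≤s z≤n)
  ... | inj₂ a | inj₁ b = contradiction (ℕₚ.≤-trans lt (node-pos≤ s b)) (ℕₚ.<⇒≱ (s≤s (ℕₚ.m≤n⇒m≤1+n (ℕₚ.m≤m+n _ _))))
  ... | inj₂ a | inj₂ b = shift1-< (toEvent θ a) (toEvent θ b) (pos-toEvent θ a b (ℕₚ.+-cancelˡ-< (suc (maxPos (dat s))) _ _ lt))
  pos-toEvent (skip {s} z θ) x y lt with splitAt (Node.size s) x | splitAt (Node.size s) y
  ... | inj₁ a | _      = none z a
  ... | inj₂ a | inj₁ b = none z b
  ... | inj₂ a | inj₂ b = pos-toEvent θ a b (ℕₚ.+-cancelˡ-< (suc (maxPos (dat s))) _ _ lt)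

  pos-toEvent⁻ : ∀ {s u} {σ : Path G s u} {ns} (θ : Thin σ ns) x y →
                 coord (toEvent θ x) < coord (toEvent θ y) →
                 BMSCData.pos (bmscOf G σ) x < BMSCData.pos (bmscOf G σ) y
  pos-toEvent⁻ keep₁ x y lt = lt
  pos-toEvent⁻ (skip₁ z) x y lt = none z x
  pos-toEvent⁻ (keep {s} θ) x y lt with splitAt (Node.size s) x | splitAt (Node.size s) y
  ... | inj₁ a | inj₁ b = lt
  ... | inj₁ a | inj₂ b = s≤s (ℕₚ.≤-trans (node-pos≤ s a) (ℕₚ.m≤m+n _ _))
  ... | inj₂ a | inj₁ b = contradiction lt (ℕₚ.<⇒≯ (idx<⇒coord< (0 , s , b) (shift 1 (toEvent θ a)) (s≤s z≤n)))
  ... | inj₂ a | inj₂ b = ℕₚ.+-monoʳ-< (suc (maxPos (dat s))) (pos-toEvent⁻ θ a b (shift1-<⁻ (toEvent θ a) (toEvent θ b) lt))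
  pos-toEvent⁻ (skip {s} z θ) x y lt with splitAt (Node.size s) x | splitAt (Node.size s) y
  ... | inj₁ a | _      = none z a
  ... | inj₂ a | inj₁ b = none z b
  ... | inj₂ a | inj₂ b = ℕₚ.+-monoʳ-< (suc (maxPos (dat s))) (pos-toEvent⁻ θ a b lt)

  fromEvent : ∀ {s u} {σ : Path G s u} {ns} (θ : Thin σ ns) {e} → Valid ns e → ∃ λ x → toEvent θ x ≡ e
  fromEvent keep₁ {zero , s , x} (valid refl) = x , refl
  fromEvent keep₁ {suc i , s , x} (valid ())
  fromEvent (skip₁ z) (valid ())
  fromEvent (keep {s} {σ = σ} θ) {zero , .s , x} (valid refl) =
    x ↑ˡ size σ , cong [ _ , _ ]′ (Finₚ.splitAt-↑ˡ (Node.size s) x (size σ))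
  fromEvent (keep {s} {σ = σ} θ) {suc i , y} (valid v) with fromEvent θ {i , y} (valid v)
  ... | x , refl = Node.size s ↑ʳ x , cong [ _ , _ ]′ (Finₚ.splitAt-↑ʳ (Node.size s) (size σ) x)
  fromEvent (skip {s} {σ = σ} z θ) v with fromEvent θ v
  ... | x , refl = Node.size s ↑ʳ x , cong [ _ , _ ]′ (Finₚ.splitAt-↑ʳ (Node.size s) (size σ) x)

  toEvent-injective : ∀ {s u} {σ : Path G s u} {ns} (θ : Thin σ ns) {x y} → toEvent θ x ≡ toEvent θ y → x ≡ y
  toEvent-injective keep₁ refl = refl
  toEvent-injective (skip₁ z) {x} _ = none z x
  toEvent-injective (keep {s} θ) {x} {y} eq with splitAt (Node.size s) x in ex | splitAt (Node.size s) y in ey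
  toEvent-injective (keep θ) refl | inj₁ a | inj₁ .a = trans (sym (Finₚ.splitAt⁻¹-↑ˡ ex)) (Finₚ.splitAt⁻¹-↑ˡ ey)
  toEvent-injective (keep θ) () | inj₁ a | inj₂ b
  toEvent-injective (keep θ) () | inj₂ a | inj₁ b
  toEvent-injective (keep {s} θ) eq | inj₂ a | inj₂ b =
    trans (sym (Finₚ.splitAt⁻¹-↑ʳ ex)) (trans (cong (Node.size s ↑ʳ_) (toEvent-injective θ (unshift eq))) (Finₚ.splitAt⁻¹-↑ʳ ey))
    where unshift : ∀ {e f} → shift 1 e ≡ shift 1 f → e ≡ f
          unshift refl = refl
  toEvent-injective (skip {s} z θ) {x} {y} eq with splitAt (Node.size s) x in ex | splitAt (Node.size s) y in ey
  ... | inj₁ a | _      = none z a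
  ... | inj₂ a | inj₁ b = none z b
  ... | inj₂ a | inj₂ b = trans (sym (Finₚ.splitAt⁻¹-↑ʳ ex)) (trans (cong (Node.size s ↑ʳ_) (toEvent-injective θ eq)) (Finₚ.splitAt⁻¹-↑ʳ ey))

  module _ {s u} {σ : Path G s u} {ns} (θ : Thin σ ns) where

    toEvent-edge : ∀ {x y} → VEdge (bmscOf G σ) x y → Edge (toEvent θ x) (toEvent θ y)
    toEvent-edge {x} (inj₁ (ke , refl)) = inj₁ (trans (sym (kind-toEvent θ x)) ke , sym (partner-toEvent θ x))
    toEvent-edge {x} {y} (inj₂ (pe , lt)) = inj₂ (subst₂ _≡_ (proc-toEvent θ x) (proc-toEvent θ y) pe , pos-toEvent θ x y lt)

    toEvent-edge⁻ : ∀ {x y} → Edge (toEvent θ x) (toEvent θ y) → VEdge (bmscOf G σ) x y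
    toEvent-edge⁻ {x} (inj₁ (ke , eq)) = inj₁ (trans (kind-toEvent θ x) ke , toEvent-injective θ (trans (partner-toEvent θ x) eq))
    toEvent-edge⁻ {x} {y} (inj₂ (pe , lt)) =
      inj₂ (subst₂ _≡_ (sym (proc-toEvent θ x)) (sym (proc-toEvent θ y)) pe , pos-toEvent⁻ θ x y lt)

    letter-toEvent : ∀ x → letter (bmscOf G σ) x ≡ letterOf (toEvent θ x)
    letter-toEvent x = trans by-kind (cong₄ (kind-toEvent θ x) (proc-toEvent θ x)
      (trans (proc-toEvent θ (BMSCData.partner (bmscOf G σ) x)) (cong proc (partner-toEvent θ x))) (label-toEvent θ x))
      where
      by-kind : letter (bmscOf G σ) x ≡ act (BMSCData.kind (bmscOf G σ) x) (BMSCData.proc (bmscOf G σ) x)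
                  (BMSCData.proc (bmscOf G σ) (BMSCData.partner (bmscOf G σ) x)) (BMSCData.lab (bmscOf G σ) x)
      by-kind with BMSCData.kind (bmscOf G σ) x
      ... | send    = refl
      ... | receive = refl
      cong₄ : ∀ {a a′ p p′ q q′ m m′} → a ≡ a′ → p ≡ p′ → q ≡ q′ → m ≡ m′ → act a p q m ≡ act a′ p′ q′ m′
      cong₄ refl refl refl refl = refl

  _⊑⟨_⟩_ : Event → List (Fin k) → Event → Set
  e ⊑⟨ ns ⟩ f = Star (λ x y → Edge x y × Valid ns x × Valid ns y) e f

  toEvent-≤v : ∀ {s u} {σ : Path G s u} {ns} (θ : Thin σ ns) {x y} →
               _≤v_ (bmscOf G σ) x y → toEvent θ x ⊑⟨ ns ⟩ toEvent θ y
  toEvent-≤v θ ε = ε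
  toEvent-≤v θ (r ◅ rs) = (toEvent-edge θ r , toEvent-valid θ _ , toEvent-valid θ _) ◅ toEvent-≤v θ rs

  -- The form in which resolving events are used. Any event of `p` will do as `e`, because `p`
  -- decides before its first event in the batch, so that its decision is below all of them.
  Informed : List (Fin k) → Fin np → Fin np → Set
  Informed ns p r = ∃ λ e → ∃ λ f → Valid ns e × Valid ns f × proc e ≡ p × proc f ≡ r × e ⊑⟨ ns ⟩ f

  resolving⇒informed : ∀ {s u} {σ : Path G s u} {ns} (θ : Thin σ ns) {T : Fin np → Set} →
                       HasResolving (bmscOf G σ) T →
                       ∃ λ p → Takes ns p × ∀ r → T r → Informed ns p r
  resolving⇒informed θ (x , _ , reach) = proc (toEvent θ x) , (toEvent θ x , toEvent-valid θ x , refl) , λ r tr →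
    let y , py , le = reach r tr in
    toEvent θ x , toEvent θ y , toEvent-valid θ x , toEvent-valid θ y , refl , trans (sym (proc-toEvent θ y)) py , toEvent-≤v θ le

  ⊑-++ʳ : ∀ xs {ys e f} → e ⊑⟨ ys ⟩ f → shift (length xs) e ⊑⟨ xs ++ ys ⟩ shift (length xs) f
  ⊑-++ʳ xs ε = ε
  ⊑-++ʳ xs (_◅_ {e} {f} (ed , ve , vf) rs) =
    (shift-edge (length xs) {e} {f} ed , valid-++ʳ xs {e = e} ve , valid-++ʳ xs {e = f} vf) ◅ ⊑-++ʳ xs rs

  informed-++ʳ : ∀ xs {ys p r} → Informed ys p r → Informed (xs ++ ys) p r
  informed-++ʳ xs (e , f , ve , vf , pe , pf , le) =
    shift (length xs) e , shift (length xs) f , valid-++ʳ xs {e = e} ve , valid-++ʳ xs {e = f} vf , pe , pf , ⊑-++ʳ xs le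

  takes-++ʳ : ∀ xs {ys q} → Takes ys q → Takes (xs ++ ys) q
  takes-++ʳ xs (e , v , p) = shift (length xs) e , valid-++ʳ xs {e = e} v , p

  -- The start nothing stands for a virtual node before s₀.
  data Step⁺ : Maybe (Fin k) → Fin k → Set where
    enter : Step⁺ nothing s₀
    edge  : ∀ {a b} → τ a b → Step⁺ (just a) b

  -- A walk visits nodes after its start up to and including its end; the list keeps all visited nodes that have events.
  data Walk : Maybe (Fin k) → Maybe (Fin k) → List (Fin k) → Set where
    []   : ∀ {a} → Walk a a []
    keep : ∀ {a b u ns} → Step⁺ a b → Walk (just b) u ns → Walk a u (b ∷ ns)
    skip : ∀ {a b u ns} → Step⁺ a b → Node.size b ≡ 0 → Walk (just b) u ns → Walk a u ns

  _++ʷ_ : ∀ {a u v ns ms} → Walk a u ns → Walk u v ms → Walk a v (ns ++ ms)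
  []         ++ʷ w′ = w′
  keep e w   ++ʷ w′ = keep e (w ++ʷ w′)
  skip e z w ++ʷ w′ = skip e z (w ++ʷ w′)

  -- The start `b` lies on the path but is not listed by the walk. Both thinnings are produced
  -- together, since a kept start must be listed by the caller and a skipped one must not.
  walk⇒path : ∀ {b u ns} → Walk (just b) (just u) ns →
              Σ (Path G b u) λ σ → Thin σ (b ∷ ns) × (Node.size b ≡ 0 → Thin σ ns)
  walk⇒path [] = ⟦ _ ⟧ , keep₁ , skip₁
  walk⇒path (keep (edge t) w) with walk⇒path w
  ... | σ , θ , _ = _ ∷⟨ t ⟩ σ , keep θ , λ z → skip z θ
  walk⇒path (skip (edge t) z w) with walk⇒path w
  ... | σ , _ , θ = _ ∷⟨ t ⟩ σ , keep (θ z) , λ z′ → skip z′ (θ z)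

  walk⇒edge : ∀ {a u ns i s} → Walk (just a) (just u) ns → ns ‼ i ≡ just s →
              ∃ λ b → τ a b × Σ (Path G b u) λ σ → Thin σ ns
  walk⇒edge [] ()
  walk⇒edge (keep (edge t) w) _ with walk⇒path w
  ... | σ , θ , _ = _ , t , σ , θ
  walk⇒edge (skip (edge t) z w) _ with walk⇒path w
  ... | σ , _ , θ = _ , t , σ , θ z

  -- A send without an earlier event of its process has no predecessor at all.
  triggers : ∀ {u z ns e} → Walk (just u) (just z) ns → kind e ≡ send → First ns (proc e) e → Triggers G u (proc e)
  triggers {e = e} w ke (v , _ , least) with walk⇒edge w (at v)
  ... | b , t , σ , θ with fromEvent θ v
  ...   | x , refl = b , _ , t , σ , x , proc-toEvent θ x , minimal-x
    where
    no-edge : ∀ {y} → ¬ VEdge (bmscOf G σ) y x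
    no-edge {y} ed with toEvent-edge θ ed
    ... | inj₁ (ky , eq) = send≢receive (trans (sym ke) (subst (λ f → kind f ≡ receive) eq (kind-partner-send (toEvent θ y) ky)))
    ... | inj₂ (py , lt) = ℕₚ.<⇒≱ lt (least _ (toEvent-valid θ y) py)

    minimal-x : ∀ y → _≤v_ (bmscOf G σ) y x → y ≡ x
    minimal-x y ε = refl
    minimal-x y (r ◅ rs) with minimal-x _ rs
    ... | refl = contradiction r no-edge

  minimalEvent : ∀ ns (es : List Event) → (∀ {e} → e ∈ es → Valid ns e) → ∀ {e} → e ∈ es →
                 ∃ λ m → m ∈ es × ∀ {f} → f ∈ es → ¬ Edge f m
  minimalEvent ns es ok e∈ = minimal edge? es (weaken (⊏-acc ns (ok e∈))) e∈
    where
    weaken : ∀ {e} → Acc (λ u v → u ⊏⟨ ns ⟩ v) e → Acc (λ u v → Edge u v × u ∈ es) e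
    weaken (acc below) = acc λ { (ed , u∈) → weaken (below (ed , ok u∈)) }

  -- Messages do not cross nodes: the send of a receive is in the same node and below it, so a
  -- minimal event of the node is a send, and nothing of its process precedes it.
  initialSend : ∀ {b} ns → Node.size b ≢ 0 → ∃ λ x → kind (0 , b , x) ≡ send × First (b ∷ ns) (Node.proc b x) (0 , b , x)
  initialSend {b} ns ne with nonempty (Node.size b) ne
    where nonempty : ∀ n → n ≢ 0 → Fin n
          nonempty zero    ne = contradiction refl ne
          nonempty (suc n) _  = zero
  ... | x₀ with minimalEvent (b ∷ []) (events (b ∷ [])) ∈-events⁻ {0 , b , x₀} (∈-events⁺ {b ∷ []} (valid refl))
  ...   | m , m∈ , min with ∈-events⁻ {b ∷ []} m∈
  initialSend ns ne | x₀ | (suc _ , _) , _ , _ | valid ()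
  initialSend {b} ns ne | x₀ | (zero , .b , x) , m∈ , min | valid refl = x , ks , valid refl , refl , least
    where
    ks : kind (0 , b , x) ≡ send
    ks with kind (0 , b , x) in eq
    ... | send = refl
    ... | receive = contradiction (inj₁ (kind-partner-receive (0 , b , x) eq , partner-involutive (0 , b , x)))
                                  (min (∈-events⁺ {b ∷ []} {partner (0 , b , x)} (valid refl)))
    least : ∀ f → Valid (b ∷ ns) f → proc f ≡ Node.proc b x → coord (0 , b , x) ≤ coord f
    least (zero , .b , y) (valid refl) py = ℕₚ.≮⇒≥ λ lt → min (∈-events⁺ {b ∷ []} {0 , b , y} (valid refl)) (inj₂ (py , lt))
    least f@(suc j , _) _ _ = ℕₚ.<⇒≤ (idx<⇒coord< (0 , b , x) f (s≤s z≤n))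

  lastOf : Maybe (Fin k) → List (Fin k) → Maybe (Fin k)
  lastOf a []       = a
  lastOf a (b ∷ bs) = lastOf (just b) bs

  data Consecutive : Maybe (Fin k) → List (Fin k) → Set where
    []  : ∀ {a} → Consecutive a []
    _∷_ : ∀ {a b bs} → Step⁺ a b → Consecutive (just b) bs → Consecutive a (b ∷ bs)

  consecutive⇒walk : ∀ {a bs} → Consecutive a bs → Walk a (lastOf a bs) bs
  consecutive⇒walk []       = []
  consecutive⇒walk (e ∷ es) = keep e (consecutive⇒walk es)

  consecutive-take : ∀ {a bs} n → Consecutive a bs → Consecutive a (take n bs)
  consecutive-take zero    _        = []
  consecutive-take (suc n) []       = []
  consecutive-take (suc n) (e ∷ es) = e ∷ consecutive-take n es

  consecutive-drop : ∀ {a bs} n → Consecutive a bs → Consecutive (lastOf a (take n bs)) (drop n bs)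
  consecutive-drop zero    es       = es
  consecutive-drop (suc n) []       = []
  consecutive-drop (suc n) (e ∷ es) = consecutive-drop n es

  lastOf-drop : ∀ a n bs → lastOf (lastOf a (take n bs)) (drop n bs) ≡ lastOf a bs
  lastOf-drop a zero    bs       = refl
  lastOf-drop a (suc n) []       = refl
  lastOf-drop a (suc n) (b ∷ bs) = lastOf-drop (just b) n bs

  take-take≤ : ∀ {m n} → m ≤ n → ∀ (bs : List (Fin k)) → take m (take n bs) ≡ take m bs
  take-take≤ z≤n bs = refl
  take-take≤ (s≤s m≤n) [] = refl
  take-take≤ (s≤s m≤n) (b ∷ bs) = cong (b ∷_) (take-take≤ m≤n bs)

-- Batches

awaited : ∀ {A : Set} → Kind → A → A → A
awaited send    q r = q
awaited receive q r = r

-- A label codes a batch: a stretch of the run that is fixed as a whole.  The promise out ℓ q names the process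
-- from which q receives next after the batch (q itself if q does not receive next); last ℓ q is the promise still
-- pending for q when the batch is entered, with the number of nodes used of the batch that made it.
-- The label ℓ₀ is a default run, which processes leave when they learn of a different choice.
record Labels {np nc : ℕ} (G : MSG (Fin np) (Fin nc)) : Set where
  open Walks G
  field
    NL K   : ℕ
    start  : Fin NL → Maybe (Fin k)
    end    : Fin NL → Fin k
    path   : Fin NL → List (Fin k)
    last   : Fin NL → Fin np → Maybe (Fin np) × ℕ
    out    : Fin NL → Fin np → Fin np
    must   : Fin NL → Maybe (Fin np)
    path≤  : ∀ ℓ → length (path ℓ) ≤ K
    ℓ₀     : Fin NL
    start₀ : start ℓ₀ ≡ nothing
    must₀  : must ℓ₀ ≡ nothing
    path₀  : Consecutive nothing (path ℓ₀)
    end₀   : lastOf nothing (path ℓ₀) ≡ just sf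

module Protocol {np nc : ℕ} (G : MSG (Fin np) (Fin nc)) (Λ : Labels G) where

  open Walks G public
  open Labels Λ public

  -- A vote is a cutoff (number of nodes of the batch to use) with the label of the batch to continue with;
  -- the order of votes is lexicographic, smaller cutoffs winning.
  Vote : Set
  Vote = Fin (suc (suc K) * NL)

  infix 4 _≤ᵛ_
  _≤ᵛ_ : Vote → Vote → Set
  v ≤ᵛ v′ = toℕ v ≤ toℕ v′

  abstract

    cutoff : Vote → ℕ
    cutoff v = toℕ (proj₁ (Fin.remQuot {suc (suc K)} NL v))

    target : Vote → Fin NL
    target v = proj₂ (Fin.remQuot {suc (suc K)} NL v)

    -- The cutoff `suc K` exceeds the length of every path. Hence it is larger than the cutoff of
    -- any legitimate vote, and all events of a batch lie before it.
    noExit : Vote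
    noExit = Fin.combine (Fin.fromℕ (suc K)) ℓ₀

    cutoff-noExit : cutoff noExit ≡ suc K
    cutoff-noExit = trans (cong (toℕ ∘ proj₁) (Finₚ.remQuot-combine (Fin.fromℕ (suc K)) ℓ₀)) (Finₚ.toℕ-fromℕ (suc K))

    mkVote : ∀ {κ} → κ ≤ K → ∀ ℓ → ∃ λ v → cutoff v ≡ κ × target v ≡ ℓ
    mkVote {κ} κ≤ ℓ = Fin.combine i ℓ ,
      trans (cong (toℕ ∘ proj₁) (Finₚ.remQuot-combine i ℓ)) (Finₚ.toℕ-fromℕ< _) ,
      cong proj₂ (Finₚ.remQuot-combine i ℓ)
      where i : Fin (suc (suc K))
            i = Fin.fromℕ< (s≤s (ℕₚ.m≤n⇒m≤1+n κ≤))

    cutoff-mono : ∀ {v v′} → v ≤ᵛ v′ → cutoff v ≤ cutoff v′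
    cutoff-mono {v} {v′} le = ℕₚ.≮⇒≥ λ lt → ℕₚ.<⇒≱
      (subst₂ (λ x y → toℕ x < toℕ y) (Finₚ.combine-remQuot {suc (suc K)} NL v′) (Finₚ.combine-remQuot {suc (suc K)} NL v)
        (Finₚ.combine-monoˡ-< (target v′) (target v) lt)) le

  ≤ᵛ-antisym : ∀ {v v′} → v ≤ᵛ v′ → v′ ≤ᵛ v → v ≡ v′
  ≤ᵛ-antisym le ge = Finₚ.toℕ-injective (ℕₚ.≤-antisym le ge)

  _⊓ᵛ_ : Vote → Vote → Vote
  v ⊓ᵛ v′ with toℕ v ≤? toℕ v′
  ... | yes _ = v
  ... | no  _ = v′

  ⊓ᵛ-≤ˡ : ∀ v v′ → v ⊓ᵛ v′ ≤ᵛ v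
  ⊓ᵛ-≤ˡ v v′ with toℕ v ≤? toℕ v′
  ... | yes _ = ℕₚ.≤-refl
  ... | no ¬p = ℕₚ.<⇒≤ (ℕₚ.≰⇒> ¬p)

  ⊓ᵛ-≤ʳ : ∀ v v′ → v ⊓ᵛ v′ ≤ᵛ v′
  ⊓ᵛ-≤ʳ v v′ with toℕ v ≤? toℕ v′
  ... | yes p = p
  ... | no _  = ℕₚ.≤-refl

  ⊓ᵛ-elim : ∀ (P : Vote → Set) v v′ → P v → P v′ → P (v ⊓ᵛ v′)
  ⊓ᵛ-elim P v v′ p p′ with toℕ v ≤? toℕ v′
  ... | yes _ = p
  ... | no  _ = p′

  -- The default run may be left at any of its choice nodes by a decision taken after processes have
  -- entered it, so no next sender can be fixed along with `ℓ₀`.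
  promise : Fin NL → Fin np → Maybe (Fin np)
  promise ℓ q with ℓ Fin.≟ ℓ₀
  ... | yes _ = nothing
  ... | no  _ = just (out ℓ q)

  promise-root : ∀ {ℓ q} → ℓ ≡ ℓ₀ → promise ℓ q ≡ nothing
  promise-root {ℓ} eq with ℓ Fin.≟ ℓ₀
  ... | yes _ = refl
  ... | no ¬p = contradiction eq ¬p

  promise-other : ∀ {ℓ q} → ℓ ≢ ℓ₀ → promise ℓ q ≡ just (out ℓ q)
  promise-other {ℓ} ne with ℓ Fin.≟ ℓ₀
  ... | yes p = contradiction p ne
  ... | no _  = refl

  awaitedBy : Event → Fin np
  awaitedBy e = awaited (kind e) (proc e) (proc (partner e))

  -- The pending promise nothing is that of ℓ₀, which does not restrict anything.
  Keeps : Fin NL → Fin np → Event → Set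
  Keeps ℓ q e = proj₁ (last ℓ q) ≡ nothing ⊎ proj₁ (last ℓ q) ≡ just (awaitedBy e)

  -- Process `p` may let batch `ℓ` end after `cutoff v` nodes and continue with `target v`. Outside
  -- `ℓ₀` the label already fixes decider, cutoff and end node, and only the target is open. In `ℓ₀`
  -- all of it is open; the second case of `informs` is a local choice whose leader need not have
  -- any event before the exit.
  record Legit (ℓ : Fin NL) (v : Vote) (p : Fin np) : Set where
    field
      node      : Fin k
      node-root : ℓ ≡ ℓ₀ → lastOf nothing (take (cutoff v) (path ℓ)) ≡ just node
      node-end  : ℓ ≢ ℓ₀ → end ℓ ≡ node
      full      : ℓ ≢ ℓ₀ → cutoff v ≡ length (path ℓ)
      cutoff≤   : cutoff v ≤ length (path ℓ)
      walk-to   : Walk (start ℓ) (just node) (take (cutoff v) (path ℓ))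
      starts    : start (target v) ≡ just node
      not-root  : target v ≢ ℓ₀
      obliged   : ℓ ≢ ℓ₀ → must ℓ ≡ just p × Takes (path ℓ) p
      informs   : ∀ r → Triggers G node r → Informed (take (cutoff v) (path ℓ)) p r ⊎ (ℓ ≡ ℓ₀ × r ≡ p)
      last-in   : ∀ q → ℓ ≡ ℓ₀ ⊎ Takes (path ℓ) q → last (target v) q ≡ (promise ℓ q , cutoff v)
      last-out  : ∀ q → ℓ ≢ ℓ₀ → ¬ Takes (path ℓ) q → last (target v) q ≡ last ℓ q
      kept      : ∀ q e → First (path (target v)) q e → Keeps (target v) q e
      walk-from : ∃ λ z → Walk (just node) (just z) (path (target v))

  legit<noExit : ∀ {ℓ v p} → Legit ℓ v p → toℕ v < toℕ noExit
  legit<noExit {ℓ} {v} lg = ℕₚ.≰⇒> λ le → ℕₚ.<⇒≱ (s≤s (ℕₚ.≤-trans (Legit.cutoff≤ lg) (path≤ ℓ)))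
    (subst (_≤ cutoff v) cutoff-noExit (cutoff-mono {noExit} {v} le))

  idx<noExit : ∀ {ℓ e} → Valid (path ℓ) e → idx e < cutoff noExit
  idx<noExit {ℓ} v = subst (_ <_) (sym cutoff-noExit) (ℕₚ.<-≤-trans (‼-< (path ℓ) (at v)) (ℕₚ.m≤n⇒m≤1+n (path≤ ℓ)))

  -- Only `ℓ₀` has nodes beyond a cutoff. They form the default walk from the exit node to `sf`, and
  -- `e` is a send with no event of its process before it on this walk.
  triggers-tail : ∀ {ℓ v p e} (lg : Legit ℓ v p) → Valid (path ℓ) e → cutoff v ≤ idx e → kind e ≡ send →
                  (∀ f → Valid (path ℓ) f → proc f ≡ proc e → cutoff v ≤ idx f → coord e ≤ coord f) →
                  Triggers G (Legit.node lg) (proc e)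
  triggers-tail {ℓ} {v} {e = e} lg ve le ke least with ℓ Fin.≟ ℓ₀
  ... | no ne = contradiction (subst (_≤ idx e) (Legit.full lg ne) le) (ℕₚ.<⇒≱ (‼-< (path ℓ) (at ve)))
  ... | yes refl with ℕₚ.m≤n⇒∃[o]m+o≡n le
  triggers-tail {ℓ} {v} {e = .(cutoff v + j) , x} lg ve le ke least | yes refl | j , refl =
    triggers w ke (valid (trans (‼-drop (cutoff v) (path ℓ₀) j) (at ve)) , refl , λ f vf pf →
      ℕₚ.+-cancelˡ-≤ (cutoff v * B) _ _ (subst₂ _≤_ (coord-shift (cutoff v) (j , x)) (coord-shift (cutoff v) f)
        (least (shift (cutoff v) f) (valid-drop (cutoff v) {e = f} vf) pf (ℕₚ.m≤m+n _ _))))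
    where
    w : Walk (just (Legit.node lg)) (just sf) (drop (cutoff v) (path ℓ₀))
    w = subst₂ (λ a b → Walk a b (drop (cutoff v) (path ℓ₀))) (Legit.node-root lg refl)
          (trans (lastOf-drop nothing (cutoff v) (path ℓ₀)) end₀)
          (consecutive⇒walk (consecutive-drop (cutoff v) path₀))

  -- The nodes between the two cutoffs, followed by the batch entered at the later exit, form a walk
  -- from the node of the earlier exit. As `q` is quiet on the slice, `e` is its first event on this
  -- walk. Outside `ℓ₀` the two exit nodes coincide.
  triggers-next : ∀ {ℓ v₁ p₁ v₂ p₂ q e} (lg₁ : Legit ℓ v₁ p₁) (lg₂ : Legit ℓ v₂ p₂) → cutoff v₁ ≤ cutoff v₂ →
                  First (path (target v₂)) q e → kind e ≡ send →
                  (∀ f → Valid (path ℓ) f → proc f ≡ q → cutoff v₁ ≤ idx f → ¬ idx f < cutoff v₂) →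
                  Triggers G (Legit.node lg₁) q
  triggers-next {ℓ} {v₁} {_} {v₂} {_} {q} {e} lg₁ lg₂ le fe@(_ , pe , _) ke quiet with ℓ Fin.≟ ℓ₀
  ... | no ne = subst₂ (Triggers G) (trans (sym (Legit.node-end lg₂ ne)) (Legit.node-end lg₁ ne)) pe
                  (triggers (proj₂ (Legit.walk-from lg₂)) ke (subst (λ r → First _ r e) (sym pe) fe))
  ... | yes refl = subst (Triggers G (Legit.node lg₁)) pe
                     (triggers (w ++ʷ proj₂ (Legit.walk-from lg₂)) ke (subst (λ r → First _ r (shift (length slice) e)) (sym pe)
                       (first-++ʳ slice no-slice fe)))
    where
    slice : List (Fin k)
    slice = drop (cutoff v₁) (take (cutoff v₂) (path ℓ₀))
    prefix-eq : take (cutoff v₁) (take (cutoff v₂) (path ℓ₀)) ≡ take (cutoff v₁) (path ℓ₀)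
    prefix-eq = take-take≤ le (path ℓ₀)
    w : Walk (just (Legit.node lg₁)) (just (Legit.node lg₂)) slice
    w = subst₂ (λ a b → Walk a b slice)
          (trans (cong (lastOf nothing) prefix-eq) (Legit.node-root lg₁ refl))
          (trans (lastOf-drop nothing (cutoff v₁) _) (Legit.node-root lg₂ refl))
          (consecutive⇒walk (consecutive-drop (cutoff v₁) (consecutive-take (cutoff v₂) path₀)))
    no-slice : ¬ Takes slice q
    no-slice (f , vf , pf) with valid-drop (cutoff v₁) {e = f} vf
    ... | vf′ with ‼-take⁻ (cutoff v₂) (path ℓ₀) (at vf′)
    ...   | lt , eq = quiet (shift (cutoff v₁) f) (valid eq) pf (ℕₚ.m≤m+n _ _) lt

  -- Chains of batches

  data Chain : Fin NL → Fin NL → Set where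
    []  : ∀ {ℓ} → Chain ℓ ℓ
    ext : ∀ {ℓ ℓ′} v p → Legit ℓ v p → Chain (target v) ℓ′ → Chain ℓ ℓ′

  len : ∀ {ℓ ℓ′} → Chain ℓ ℓ′ → ℕ
  len []            = 0
  len (ext _ _ _ C) = suc (len C)

  lab : ∀ {ℓ ℓ′} → Chain ℓ ℓ′ → ℕ → Fin NL
  lab {ℓ} []            m       = ℓ
  lab {ℓ} (ext _ _ _ C) zero    = ℓ
  lab     (ext _ _ _ C) (suc m) = lab C m

  -- Beyond the last batch the value is noExit, so that the last batch is used up to its end.
  exit : ∀ {ℓ ℓ′} → Chain ℓ ℓ′ → ℕ → Vote
  exit []            m       = noExit
  exit (ext v _ _ C) zero    = v
  exit (ext _ _ _ C) (suc m) = exit C m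

  Decides : ∀ {ℓ ℓ′} → Chain ℓ ℓ′ → ℕ → Fin np → Set
  Decides []            m       p = ⊥
  Decides (ext _ q _ C) zero    p = p ≡ q
  Decides (ext _ _ _ C) (suc m) p = Decides C m p

  lab-0 : ∀ {ℓ ℓ′} (C : Chain ℓ ℓ′) → lab C 0 ≡ ℓ
  lab-0 []            = refl
  lab-0 (ext _ _ _ _) = refl

  lab-len : ∀ {ℓ ℓ′} (C : Chain ℓ ℓ′) → lab C (len C) ≡ ℓ′
  lab-len []            = refl
  lab-len (ext _ _ _ C) = lab-len C

  exit-len : ∀ {ℓ ℓ′} (C : Chain ℓ ℓ′) → exit C (len C) ≡ noExit
  exit-len []            = refl
  exit-len (ext _ _ _ C) = exit-len C

  lab-suc : ∀ {ℓ ℓ′} (C : Chain ℓ ℓ′) {m} → m < len C → lab C (suc m) ≡ target (exit C m)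
  lab-suc (ext _ _ _ C) {zero}  _       = lab-0 C
  lab-suc (ext _ _ _ C) {suc m} (s≤s l) = lab-suc C l

  decides⇒< : ∀ {ℓ ℓ′} (C : Chain ℓ ℓ′) {m p} → Decides C m p → m < len C
  decides⇒< (ext _ _ _ C) {zero}  d = s≤s z≤n
  decides⇒< (ext _ _ _ C) {suc m} d = s≤s (decides⇒< C d)

  decides⇒legit : ∀ {ℓ ℓ′} (C : Chain ℓ ℓ′) {m p} → Decides C m p → Legit (lab C m) (exit C m) p
  decides⇒legit (ext _ _ lg C) {zero}  refl = lg
  decides⇒legit (ext _ _ _ C)  {suc m} d    = decides⇒legit C d

  decider : ∀ {ℓ ℓ′} (C : Chain ℓ ℓ′) {m} → m < len C → ∃ λ p → Decides C m p
  decider (ext _ p _ C) {zero}  _       = p , refl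
  decider (ext _ _ _ C) {suc m} (s≤s l) = decider C l

  legitAt : ∀ {ℓ ℓ′} (C : Chain ℓ ℓ′) {m} → m < len C → ∃ λ p → Decides C m p × Legit (lab C m) (exit C m) p
  legitAt C l = let p , d = decider C l in p , d , decides⇒legit C d

  lab-other : ∀ {ℓ ℓ′} (C : Chain ℓ ℓ′) {m} → m < len C → lab C (suc m) ≢ ℓ₀
  lab-other C l eq = Legit.not-root (proj₂ (proj₂ (legitAt C l))) (trans (sym (lab-suc C l)) eq)

  lab-root⇒0 : ∀ {ℓ ℓ′} (C : Chain ℓ ℓ′) {m} → m ≤ len C → lab C m ≡ ℓ₀ → m ≡ 0
  lab-root⇒0 C {zero}  _ _  = refl
  lab-root⇒0 C {suc m} l eq = contradiction eq (lab-other C l)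

  -- A pending promise is renewed by a batch in which `q` takes part and handed on unchanged by the
  -- others. So the promise of batch `m` is pending up to the first later batch with an event of
  -- `q`. If that batch comes before `m′`, the promise pending at `m′` stems from a batch other than
  -- `ℓ₀`, whence the last clause.
  last-entry : ∀ {ℓ′} (C : Chain ℓ₀ ℓ′) q {m m′} → m < m′ → m′ ≤ len C → m ≡ 0 ⊎ Takes (path (lab C m)) q →
    ((∀ {i} → m < i → i < m′ → ¬ Takes (path (lab C i)) q) × last (lab C m′) q ≡ (promise (lab C m) q , cutoff (exit C m)))
    ⊎ (∃ λ i → m < i × i < m′ × Takes (path (lab C i)) q × last (lab C i) q ≡ (promise (lab C m) q , cutoff (exit C m))
         × proj₁ (last (lab C m′) q) ≢ nothing)
  last-entry C q {m} {suc m′} (s≤s m≤m′) l tk with ℕₚ.m≤n⇒m<n∨m≡n m≤m′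
  ... | inj₂ refl = inj₁ ((λ m<i i<1+m → contradiction (ℕₚ.<-≤-trans m<i (ℕₚ.≤-pred i<1+m)) (ℕₚ.<-irrefl refl)) ,
          trans (cong (λ ℓ → last ℓ q) (lab-suc C l)) (Legit.last-in (proj₂ (proj₂ (legitAt C l))) q (entry tk)))
    where entry : m ≡ 0 ⊎ Takes (path (lab C m)) q → lab C m ≡ ℓ₀ ⊎ Takes (path (lab C m)) q
          entry (inj₁ refl) = inj₁ (lab-0 C)
          entry (inj₂ t)    = inj₂ t
  ... | inj₁ m<m′ with first? (path (lab C m′)) q
  ...   | inj₁ (e , v , p , _) = inj₂ (through (last-entry C q m<m′ (ℕₚ.<⇒≤ l) tk))
    where
    other : lab C m′ ≢ ℓ₀
    other eq = contradiction (subst (m <_) (lab-root⇒0 C (ℕₚ.<⇒≤ l) eq) m<m′) λ ()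
    new : proj₁ (last (lab C (suc m′)) q) ≢ nothing
    new eq with trans (sym (trans (cong (λ ℓ → proj₁ (last ℓ q)) (lab-suc C l))
                 (trans (cong proj₁ (Legit.last-in (proj₂ (proj₂ (legitAt C l))) q (inj₂ (e , v , p)))) (promise-other other)))) eq
    ... | ()
    through : _ → ∃ λ i → m < i × i < suc m′ × Takes (path (lab C i)) q
                × last (lab C i) q ≡ (promise (lab C m) q , cutoff (exit C m)) × proj₁ (last (lab C (suc m′)) q) ≢ nothing
    through (inj₁ (_ , eq)) = m′ , m<m′ , ℕₚ.≤-refl , (e , v , p) , eq , new
    through (inj₂ (i , m<i , i<m′ , t , eq , _)) = i , m<i , ℕₚ.m≤n⇒m≤1+n i<m′ , t , eq , new
  ...   | inj₂ ¬t = pass (last-entry C q m<m′ (ℕₚ.<⇒≤ l) tk)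
    where
    other : lab C m′ ≢ ℓ₀
    other eq = contradiction (subst (m <_) (lab-root⇒0 C (ℕₚ.<⇒≤ l) eq) m<m′) λ ()
    same : last (lab C (suc m′)) q ≡ last (lab C m′) q
    same = trans (cong (λ ℓ → last ℓ q) (lab-suc C l)) (Legit.last-out (proj₂ (proj₂ (legitAt C l))) q other ¬t)
    between : (∀ {i} → m < i → i < m′ → ¬ Takes (path (lab C i)) q) → ∀ {i} → m < i → i < suc m′ → ¬ Takes (path (lab C i)) q
    between none {i} m<i (s≤s i≤m′) with ℕₚ.m≤n⇒m<n∨m≡n i≤m′
    ... | inj₁ i<m′ = none m<i i<m′
    ... | inj₂ refl = ¬t
    pass : _ → _
    pass (inj₁ (none , eq)) = inj₁ ((λ {i} → between none {i}) , trans same eq)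
    pass (inj₂ (i , m<i , i<m′ , t , eq , ne)) = inj₂ (i , m<i , ℕₚ.m≤n⇒m≤1+n i<m′ , t , eq , λ eq′ → ne (trans (sym (cong proj₁ same)) eq′))

  record Cuts {ℓ ℓ₁ ℓ₂} (C : Chain ℓ ℓ₁) (m : ℕ) (v : Vote) (p : Fin np) (C′ : Chain ℓ ℓ₂) : Set where
    field
      len-cut     : len C′ ≡ suc m
      lab-cut     : ∀ {i} → i ≤ m → lab C′ i ≡ lab C i
      exit-before : ∀ {i} → i < m → exit C′ i ≡ exit C i
      exit-cut    : exit C′ m ≡ v
      decides-before : ∀ {i q} → i < m → Decides C′ i q → Decides C i q
      decides-cut : ∀ {q} → Decides C′ m q → q ≡ p

  _⊕_ : ∀ {ℓ ℓ₁ ℓ₂} → Chain ℓ ℓ₁ → Chain ℓ₁ ℓ₂ → Chain ℓ ℓ₂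
  []            ⊕ F = F
  ext v p lg C  ⊕ F = ext v p lg (C ⊕ F)

  ⊕-assoc : ∀ {ℓ ℓ₁ ℓ₂ ℓ₃} (C : Chain ℓ ℓ₁) (D : Chain ℓ₁ ℓ₂) (E : Chain ℓ₂ ℓ₃) → (C ⊕ D) ⊕ E ≡ C ⊕ (D ⊕ E)
  ⊕-assoc []             D E = refl
  ⊕-assoc (ext v p lg C) D E = cong (ext v p lg) (⊕-assoc C D E)

  ⊕-[] : ∀ {ℓ ℓ₁} (C : Chain ℓ ℓ₁) → C ⊕ [] ≡ C
  ⊕-[] []             = refl
  ⊕-[] (ext v p lg C) = cong (ext v p lg) (⊕-[] C)

  cut : ∀ {ℓ ℓ₁ v p} (C : Chain ℓ ℓ₁) m → m ≤ len C → Legit (lab C m) v p →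
        Σ (Chain ℓ (target v)) (Cuts C m v p)
  cut {v = v} {p} [] zero _ lg = ext v p lg [] , record
    { len-cut = refl ; lab-cut = λ { z≤n → refl } ; exit-before = λ () ; exit-cut = refl
    ; decides-before = λ () ; decides-cut = λ eq → eq }
  cut {v = v} {p} (ext _ _ _ C) zero _ lg = ext v p lg [] , record
    { len-cut = refl ; lab-cut = λ { z≤n → refl } ; exit-before = λ () ; exit-cut = refl
    ; decides-before = λ () ; decides-cut = λ eq → eq }
  cut (ext w q lw C) (suc m) (s≤s l) lg with cut C m l lg
  ... | C′ , c = ext w q lw C′ , record
    { len-cut = cong suc len-cut
    ; lab-cut = λ { {zero} _ → refl ; {suc i} (s≤s i≤) → lab-cut i≤ }
    ; exit-before = λ { {zero} _ → refl ; {suc i} (s≤s i<) → exit-before i< }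
    ; exit-cut = exit-cut
    ; decides-before = λ { {zero} _ d → d ; {suc i} (s≤s i<) d → decides-before i< d }
    ; decides-cut = decides-cut }
    where open Cuts c

  extend-cuts : ∀ {ℓ ℓ₁ v p} (C : Chain ℓ ℓ₁) (lg : Legit ℓ₁ v p) → Cuts C (len C) v p (C ⊕ ext v p lg [])
  extend-cuts [] lg = record
    { len-cut = refl ; lab-cut = λ { z≤n → refl } ; exit-before = λ () ; exit-cut = refl
    ; decides-before = λ () ; decides-cut = λ eq → eq }
  extend-cuts (ext w q lw C) lg = record
    { len-cut = cong suc len-cut
    ; lab-cut = λ { {zero} _ → refl ; {suc i} (s≤s i≤) → lab-cut i≤ }
    ; exit-before = λ { {zero} _ → refl ; {suc i} (s≤s i<) → exit-before i< }
    ; exit-cut = exit-cut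
    ; decides-before = λ { {zero} _ d → d ; {suc i} (s≤s i<) d → decides-before i< d }
    ; decides-cut = decides-cut }
    where open Cuts (extend-cuts C lg)

  lab-⊕ : ∀ {ℓ ℓ₁ ℓ₂} (C : Chain ℓ ℓ₁) (F : Chain ℓ₁ ℓ₂) {m} → m ≤ len C → lab (C ⊕ F) m ≡ lab C m
  lab-⊕ []            F z≤n         = lab-0 F
  lab-⊕ (ext _ _ _ C) F {zero}  _   = refl
  lab-⊕ (ext _ _ _ C) F {suc m} (s≤s l) = lab-⊕ C F l

  exit-⊕ˡ : ∀ {ℓ ℓ₁ ℓ₂} (C : Chain ℓ ℓ₁) (F : Chain ℓ₁ ℓ₂) {m} → m < len C → exit (C ⊕ F) m ≡ exit C m
  exit-⊕ˡ (ext _ _ _ C) F {zero}  _       = refl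
  exit-⊕ˡ (ext _ _ _ C) F {suc m} (s≤s l) = exit-⊕ˡ C F l

  exit-⊕ : ∀ {ℓ ℓ₁ ℓ₂} (C : Chain ℓ ℓ₁) (F : Chain ℓ₁ ℓ₂) → exit (C ⊕ F) (len C) ≡ exit F 0
  exit-⊕ []            F = refl
  exit-⊕ (ext _ _ _ C) F = exit-⊕ C F

  decides-⊕ : ∀ {ℓ ℓ₁ ℓ₂} (C : Chain ℓ ℓ₁) (F : Chain ℓ₁ ℓ₂) {p} → Decides (C ⊕ F) (len C) p → Decides F 0 p
  decides-⊕ []            F d = d
  decides-⊕ (ext _ _ _ C) F d = decides-⊕ C F d

  len-⊕ : ∀ {ℓ ℓ₁ ℓ₂} (C : Chain ℓ ℓ₁) (F : Chain ℓ₁ ℓ₂) → len (C ⊕ F) ≡ len C + len F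
  len-⊕ []            F = refl
  len-⊕ (ext _ _ _ C) F = cong suc (len-⊕ C F)

  -- Events of a chain

  HEvent : Set
  HEvent = ℕ × Event

  record In {ℓ ℓ′} (C : Chain ℓ ℓ′) (x : HEvent) : Set where
    constructor inside
    field
      batch≤  : proj₁ x ≤ len C
      on-path : Valid (path (lab C (proj₁ x))) (proj₂ x)
      before  : idx (proj₂ x) < cutoff (exit C (proj₁ x))
  open In public

  -- Coordinates restart in every batch, so events of different batches are compared by the batch
  -- numbers. Messages stay within a batch, hence only the process order leads from one batch to
  -- another.
  HEdge : HEvent → HEvent → Set
  HEdge (m , e) (m′ , e′) = (m ≡ m′ × Edge e e′) ⊎ (m < m′ × proc e ≡ proc e′)

  hedge? : ∀ x y → Dec (HEdge x y)
  hedge? (m , e) (m′ , e′) = ((m ℕₚ.≟ m′) ×-dec edge? e e′) ⊎-dec ((m <? m′) ×-dec (proc e Fin.≟ proc e′))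

  in-partner : ∀ {ℓ ℓ′} {C : Chain ℓ ℓ′} {m e} → In C (m , e) → In C (m , partner e)
  in-partner (inside l v b) = inside l (valid (at v)) b

  in-noExit : ∀ {ℓ ℓ′} (C : Chain ℓ ℓ′) {m e} → m ≡ len C → Valid (path (lab C m)) e → In C (m , e)
  in-noExit C refl v = inside ℕₚ.≤-refl v (subst (λ w → _ < cutoff w) (sym (exit-len C)) (idx<noExit v))

  in-other : ∀ {ℓ ℓ′} (C : Chain ℓ ℓ′) {m e} → m ≤ len C → lab C m ≢ ℓ₀ → Valid (path (lab C m)) e → In C (m , e)
  in-other C {m} l ne v with ℕₚ.m≤n⇒m<n∨m≡n l
  ... | inj₂ eq = in-noExit C eq v
  ... | inj₁ m< = inside l v (subst (_ <_) (sym (Legit.full (proj₂ (proj₂ (legitAt C m<))) ne)) (‼-< (path (lab C m)) (at v)))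

  -- The machine and its invariant

  -- A count is zero or the successor of a coordinate, and coordinates on a path of at most `K`
  -- nodes are below `K * B`; so counts range up to `K * B` inclusive.
  bound : ℕ
  bound = suc (K * B)

  coord<K : ∀ {ℓ e} → Valid (path ℓ) e → coord e < K * B
  coord<K {ℓ} {e} v = idx<⇒coord<* e (ℕₚ.<-≤-trans (‼-< (path ℓ) (at v)) (path≤ ℓ))

  -- Control data: label of the batch, coordinate of the receive event, vote known to the sender.
  Control : Set
  Control = Fin NL × ℕ × Vote

  controlCoding : Coding (Fin NL × Fin bound × Vote)
  controlCoding = finCoding NL ×ᶜ finCoding bound ×ᶜ finCoding (suc (suc K) * NL)

  abstract

    controls : ℕ
    controls = Coding.codes controlCoding

    control : Fin controls → Control
    control d = let ℓ , c , v = Coding.from controlCoding d in ℓ , toℕ c , v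

    encodeControl : ∀ ℓ {c} → c < bound → ∀ v → ∃ λ d → control d ≡ (ℓ , c , v)
    encodeControl ℓ c< v = Coding.to controlCoding (ℓ , Fin.fromℕ< c< , v) ,
      trans (cong (λ (ℓ , c , v) → ℓ , toℕ c , v) (Coding.from-to controlCoding (ℓ , Fin.fromℕ< c< , v)))
            (cong (λ c → ℓ , c , v) (Finₚ.toℕ-fromℕ< c<))

  -- A process is in a batch; its events of the batch with coordinate below count are done.  The vote is the
  -- minimum of the votes for leaving the batch that it knows of.
  record State : Set where
    constructor state
    field
      batch : Fin NL
      count : ℕ
      vote  : Vote
      voted : Bool
  open State public

  stateCoding : Coding (Fin NL × Fin bound × Vote × Bool)
  stateCoding = finCoding NL ×ᶜ finCoding bound ×ᶜ finCoding (suc (suc K) * NL) ×ᶜ boolCoding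

  abstract

    states : ℕ
    states = Coding.codes stateCoding

    decode : Fin states → State
    decode i = let ℓ , c , v , b = Coding.from stateCoding i in state ℓ (toℕ c) v b

    encode : ∀ s → count s < bound → ∃ λ i → decode i ≡ s
    encode (state ℓ c v b) c< = Coding.to stateCoding (ℓ , Fin.fromℕ< c< , v , b) ,
      trans (cong (λ (ℓ , c , v , b) → state ℓ (toℕ c) v b) (Coding.from-to stateCoding (ℓ , Fin.fromℕ< c< , v , b)))
            (cong (λ c → state ℓ c v b) (Finₚ.toℕ-fromℕ< c<))

  Final : Fin NL → Set
  Final ℓ = Walk (start ℓ) (just sf) (path ℓ) × must ℓ ≡ nothing

  Plan : Fin NL → Set
  Plan ℓ = ∃ λ ℓ′ → Chain ℓ ℓ′ × Final ℓ′

  -- The process named by `must` may not pass, as the others rely on its decision to continue. The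
  -- plan demanded for casting becomes the plan of the invariant when the vote takes effect.
  data Permitted (q : Fin np) (ℓ : Fin NL) : Vote → Set where
    pass : must ℓ ≢ just q → Permitted q ℓ noExit
    cast : ∀ {v} → Legit ℓ v q → Plan (target v) → Permitted q ℓ v

  data Voting (q : Fin np) : State → State → Set where
    already : ∀ {ℓ c v} → Voting q (state ℓ c v true) (state ℓ c v true)
    now     : ∀ {ℓ c v v′} → Permitted q ℓ v′ → Voting q (state ℓ c v false) (state ℓ c v′ true)

  record Next (q : Fin np) (ℓ : Fin NL) (c : ℕ) (e : Event) : Set where
    constructor next
    field
      is-valid : Valid (path ℓ) e
      is-proc  : proc e ≡ q
      not-done : c ≤ coord e
      earlier  : ∀ f → Valid (path ℓ) f → proc f ≡ q → coord f < coord e → coord f < c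

  DoneBelow : Fin np → Fin NL → ℕ → ℕ → Set
  DoneBelow q ℓ κ c = ∀ f → Valid (path ℓ) f → proc f ≡ q → idx f < κ → coord f < c

  -- A process with knowledge of the next batch enters it with a send, otherwise with the receive it was promised.
  data SendJump (q : Fin np) : State → State → Set where
    send-jump : ∀ {ℓ c v e} → v ≢ noExit → DoneBelow q ℓ (cutoff v) c → First (path (target v)) q e → kind e ≡ send →
                SendJump q (state ℓ c v true) (state (target v) 0 noExit false)

  data ReceiveJump (q r : Fin np) (ℓ′ : Fin NL) (e : Event) : State → State → Set where
    -- No vote of the old batch needs to have reached `q`: the label `ℓ′` of the incoming message
    -- tells through `last` at which cutoff `κ` the batch of `q` ended, and `q` checks that it has
    -- nothing left to do before it.
    receive-jump : ∀ {ℓ c v b κ} → last ℓ′ q ≡ (promise ℓ q , κ) → promise ℓ q ≡ nothing ⊎ promise ℓ q ≡ just r → ℓ′ ≢ ℓ₀ →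
                   DoneBelow q ℓ κ c → First (path ℓ′) q e → kind e ≡ receive → proc (partner e) ≡ r →
                   ReceiveJump q r ℓ′ e (state ℓ c v b) (state ℓ′ 0 noExit false)

  data OwnSend (q : Fin np) : State → Event → Control → State → Set where
    own-send : ∀ {ℓ c v e} → Next q ℓ c e → kind e ≡ send → idx e < cutoff v →
               OwnSend q (state ℓ c v true) e (ℓ , coord (partner e) , v) (state ℓ (suc (coord e)) v true)

  -- Unlike a send, a receive is not compared with the known cutoff: its message was sent before the
  -- exit, and both ends of a message belong to the same node.
  data OwnReceive (q : Fin np) : State → Event → Control → State → Set where
    own-receive : ∀ {ℓ c v e w} → Next q ℓ c e → kind e ≡ receive →
                  OwnReceive q (state ℓ c v true) e (ℓ , coord e , w) (state ℓ (suc (coord e)) (v ⊓ᵛ w) true)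

  -- Voting and entering a batch are not transitions of their own, as every transition must carry a
  -- letter. The vote before a jump is that of a process which leaves `ℓ₀` without having acted
  -- there.
  data SendStep (q : Fin np) (s : State) (e : Event) (x : Control) (s′ : State) : Set where
    stay : ∀ {s₁} → Voting q s s₁ → OwnSend q s₁ e x s′ → SendStep q s e x s′
    jump : ∀ {s₁ s₂ s₃} → Voting q s s₁ → SendJump q s₁ s₂ → Voting q s₂ s₃ → OwnSend q s₃ e x s′ → SendStep q s e x s′

  data ReceiveStep (q : Fin np) (s : State) (e : Event) (x : Control) (s′ : State) : Set where
    stay : ∀ {s₁} → Voting q s s₁ → OwnReceive q s₁ e x s′ → ReceiveStep q s e x s′
    jump : ∀ {s₂ s₃} → ReceiveJump q (proc (partner e)) (proj₁ x) e s s₂ → Voting q s₂ s₃ → OwnReceive q s₃ e x s′ →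
           ReceiveStep q s e x s′

  -- A process without any event has no transition in which to vote, yet the run may leave `ℓ₀` by
  -- its very decision. Such a vote is made part of acceptance; after it the process must have
  -- nothing left to send.
  Accepts : Fin np → State → Set
  Accepts q s = ∃ λ s₁ → Voting q s s₁ × (∀ {e x s₂} → ¬ OwnSend q s₁ e x s₂) × (∀ {s₂} → ¬ SendJump q s₁ s₂)

  Channels : Set
  Channels = Fin np → Fin np → List (Fin nc × Fin controls)

  -- The executed events, latest first, with the vote known to the process after each of them.
  History : Set
  History = List (HEvent × Vote)

  Done : History → HEvent → Set
  Done H x = ∃ λ v → (x , v) ∈ H

  _≺_ : HEvent × Vote → HEvent × Vote → Set
  ((m , e) , _) ≺ ((m′ , e′) , _) = m < m′ ⊎ (m ≡ m′ × coord e < coord e′)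

  ≺-irrefl : ∀ {x v w} → ¬ ((x , v) ≺ (x , w))
  ≺-irrefl (inj₁ lt)       = ℕₚ.<-irrefl refl lt
  ≺-irrefl (inj₂ (_ , lt)) = ℕₚ.<-irrefl refl lt

  hpartner : HEvent → HEvent
  hpartner (m , e) = m , partner e

  module _ {ℓ₁ : Fin NL} (C : Chain ℓ₀ ℓ₁) where

    Carries : HEvent × Vote → Fin nc × Fin controls → Set
    Carries ((m , e) , v) (l , d) = l ≡ label e × control d ≡ (lab C m , coord (partner e) , v)

    record Channel (H : History) (r q : Fin np) (ds : List (Fin nc × Fin controls)) : Set where
      field
        pending  : List (HEvent × Vote)
        carried  : Pointwise Carries pending ds
        sorted   : AllPairs _≺_ pending
        sound    : ∀ {x v} → (x , v) ∈ pending → (x , v) ∈ H × kind (proj₂ x) ≡ send × proc (proj₂ x) ≡ r ×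
                   proc (partner (proj₂ x)) ≡ q × ¬ Done H (hpartner x)
        complete : ∀ {x v} → (x , v) ∈ H → kind (proj₂ x) ≡ send → proc (proj₂ x) ≡ r →
                   proc (partner (proj₂ x)) ≡ q → ¬ Done H (hpartner x) → (x , v) ∈ pending

    -- Votes in the history approximate the true exit from above (`v-low`), improve along causality
    -- (`v-mono`), and are exact at events of the decider (`v-decider` with `v-low`). Hence every
    -- event causally after one of the decider in the same batch carries the exact exit.
    record Global (H : History) (ch : Channels) : Set where
      field
        h-in      : ∀ {x} → Done H x → In C x
        h-down    : ∀ {x y} → Done H x → In C y → HEdge y x → Done H y
        h-order   : AllPairs (λ a b → proj₁ a ≢ proj₁ b × ¬ HEdge (proj₁ a) (proj₁ b)) H
        v-low     : ∀ {m e v} → ((m , e) , v) ∈ H → exit C m ≤ᵛ v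
        v-legit   : ∀ {m e v} → ((m , e) , v) ∈ H → v ≡ noExit ⊎ ∃ λ p → Legit (lab C m) v p
        v-mono    : ∀ {m e f v w} → ((m , e) , v) ∈ H → ((m , f) , w) ∈ H → Edge e f → w ≤ᵛ v
        v-decider : ∀ {m p e v} → Decides C m p → ((m , e) , v) ∈ H → proc e ≡ p → v ≤ᵛ exit C m
        channel   : ∀ r q → Channel H r q (ch r q)

    -- Process q, in state s, is in batch m of C.
    record Local (H : History) (q : Fin np) (s : State) (m : ℕ) : Set where
      field
        m≤len   : m ≤ len C
        lab≡    : lab C m ≡ batch s
        done⇒   : ∀ {m′ e} → Done H (m′ , e) → proc e ≡ q → m′ < m ⊎ (m′ ≡ m × coord e < count s)
        ⇒done   : ∀ {m′ e} → In C (m′ , e) → proc e ≡ q → m′ < m ⊎ (m′ ≡ m × coord e < count s) → Done H (m′ , e)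
        covered : ∀ {e} → Valid (path (lab C m)) e → proc e ≡ q → coord e < count s → idx e < cutoff (exit C m)
        fresh   : voted s ≡ false → count s ≡ 0 × vote s ≡ noExit
        low     : exit C m ≤ᵛ vote s
        below   : ∀ {e v} → ((m , e) , v) ∈ H → proc e ≡ q → vote s ≤ᵛ v
        legit   : vote s ≡ noExit ⊎ ∃ λ p → Legit (lab C m) (vote s) p
        decided : ∀ {m′} → Decides C m′ q → m′ < m ⊎ (m′ ≡ m × vote s ≤ᵛ exit C m)
        -- Had the process named by `must` voted, the chain would go on; in the last batch this vote
        -- is still outstanding.
        free    : m ≡ len C → voted s ≡ true → must (lab C m) ≢ just q
        takes   : 0 < m → Takes (path (lab C m)) q

  -- Holds between transitions but not in the middle of one, when a process has entered a batch and
  -- its first event there is yet to be recorded; therefore it is kept apart from `Local`.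
  Proper : History → Fin np → ℕ → Set
  Proper H q m = 0 < m → ∃ λ e → Done H (m , e) × proc e ≡ q

  -- Knowledge of exits

  exit≤noExit : ∀ {ℓ ℓ′} (C : Chain ℓ ℓ′) {m} → m ≤ len C → exit C m ≤ᵛ noExit
  exit≤noExit C l with ℕₚ.m≤n⇒m<n∨m≡n l
  ... | inj₁ m<  = ℕₚ.<⇒≤ (legit<noExit (proj₂ (proj₂ (legitAt C m<))))
  ... | inj₂ refl = ℕₚ.≤-reflexive (cong toℕ (exit-len C))

  exit<⇒< : ∀ {ℓ ℓ′} (C : Chain ℓ ℓ′) {m v} → m ≤ len C → exit C m ≤ᵛ v → toℕ v < toℕ noExit → m < len C
  exit<⇒< C l le lt with ℕₚ.m≤n⇒m<n∨m≡n l
  ... | inj₁ m<  = m<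
  ... | inj₂ refl = contradiction (subst (λ w → toℕ w ≤ _) (exit-len C) le) (ℕₚ.<⇒≱ lt)

  hminimal : ∀ {ℓ ℓ′} (C : Chain ℓ ℓ′) (xs : List HEvent) → (∀ {x} → x ∈ xs → In C x) → ∀ {x} → x ∈ xs →
             ∃ λ m → m ∈ xs × ∀ {y} → y ∈ xs → ¬ HEdge y m
  hminimal C xs ok {m , e} x∈ = minimal hedge? xs (outer (<-wellFounded m) (⊏-acc _ (on-path (ok x∈)))) x∈
    where
    R : HEvent → HEvent → Set
    R u v = HEdge u v × u ∈ xs

    inner : ∀ {m} → (∀ {m′} → m′ < m → ∀ e → Valid (path (lab C m′)) e → Acc R (m′ , e)) →
            ∀ {e} → Acc (λ u v → u ⊏⟨ path (lab C m) ⟩ v) e → Acc R (m , e)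
    inner ih {e} (acc lower) = acc λ
      { (inj₁ (refl , ed) , u∈) → inner ih (lower (ed , on-path (ok u∈)))
      ; (inj₂ (lt , _) , u∈) → ih lt _ (on-path (ok u∈)) }

    outer : ∀ {m} → Acc _<_ m → ∀ {e} → Acc (λ u v → u ⊏⟨ path (lab C m) ⟩ v) e → Acc R (m , e)
    outer (acc lower) = inner λ lt e v → outer (lower lt) (⊏-acc _ v)

  module _ {ℓ₁ : Fin NL} {C : Chain ℓ₀ ℓ₁} {H : History} {ch : Channels} (g : Global C H ch) where
    open Global g

    done-⊑ : ∀ {m κ e f v} → m ≤ len C → κ ≤ cutoff (exit C m) → e ⊑⟨ take κ (path (lab C m)) ⟩ f →
             ((m , f) , v) ∈ H → ∃ λ w → ((m , e) , w) ∈ H × v ≤ᵛ w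
    done-⊑ l le ε f∈ = _ , f∈ , ℕₚ.≤-refl
    done-⊑ {m} {κ} l le ((ed , ve , _) ◅ rs) f∈ with done-⊑ l le rs f∈
    ... | w , e′∈ , v≤w with ‼-take⁻ κ (path (lab C m)) (at ve)
    ...   | i<κ , eq with h-down (w , e′∈) (inside l (valid eq) (ℕₚ.<-≤-trans i<κ le)) (inj₁ (refl , ed))
    ...     | u , e∈ = u , e∈ , ℕₚ.≤-trans v≤w (v-mono e∈ e′∈ ed)

    in-take : ∀ {m κ e} → m ≤ len C → κ ≤ cutoff (exit C m) → Valid (take κ (path (lab C m))) e → In C (m , e)
    in-take {m} {κ} l le v = let lt , eq = ‼-take⁻ κ (path (lab C m)) (at v) in inside l (valid eq) (ℕₚ.<-≤-trans lt le)

    -- A trigger of the exit node has an event in the prefix that is causally after an event of the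
    -- decider. This event is done by assumption, and the exact vote of the decider has flowed to
    -- it. In `ℓ₀` the process may instead be the decider itself.
    knows-exit : ∀ {q s m p} → Local C H q s m → (d : Decides C m p) →
                 DoneBelow q (lab C m) (cutoff (exit C m)) (count s) →
                 Triggers G (Legit.node (decides⇒legit C d)) q → vote s ≤ᵛ exit C m
    knows-exit {m = m} lo d dn tr with Legit.informs (decides⇒legit C d) _ tr
    ... | inj₂ (_ , refl) with Local.decided lo d
    ...   | inj₁ lt       = contradiction lt (ℕₚ.<-irrefl refl)
    ...   | inj₂ (_ , le) = le
    knows-exit {m = m} lo d dn tr | inj₁ (f₀ , f , _ , vf , p₀ , pf , le)
      with ‼-take⁻ (cutoff (exit C m)) (path (lab C m)) (at vf)
    ... | lt , eq with Local.⇒done lo (in-take (Local.m≤len lo) ℕₚ.≤-refl vf) pf (inj₂ (refl , dn f (valid eq) pf lt))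
    ...   | v , f∈ with done-⊑ (Local.m≤len lo) ℕₚ.≤-refl le f∈
    ...     | w , f₀∈ , v≤w = ℕₚ.≤-trans (Local.below lo f∈ pf) (ℕₚ.≤-trans v≤w (v-decider d f₀∈ p₀))

    module _ {q ℓ c v w m} (lo : Local C H q (state ℓ c v false) m) (lg : Legit (lab C m) w q) (lt : toℕ w < toℕ (exit C m)) where

      private
        Beyond : HEvent → Set
        Beyond (m′ , e) = m < m′ ⊎ (m ≡ m′ × cutoff w ≤ idx e)

        beyond? : ∀ x → Dec (Beyond x)
        beyond? (m′ , e) = (m <? m′) ⊎-dec ((m ℕₚ.≟ m′) ×-dec (cutoff w ≤? idx e))

        cut≤ : cutoff w ≤ cutoff (exit C m)
        cut≤ = cutoff-mono (ℕₚ.<⇒≤ lt)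

        c≡0 : c ≡ 0
        c≡0 = proj₁ (Local.fresh lo refl)

        not-done-yet : ∀ {m′ e} → Done H (m′ , e) → proc e ≡ q → ¬ m ≤ m′
        not-done-yet d pe le with Local.done⇒ lo d pe
        ... | inj₁ m′<m        = ℕₚ.<⇒≱ m′<m le
        ... | inj₂ (refl , lt) = contradiction (subst (_ <_) c≡0 lt) λ ()

        m≤ : ∀ {x} → Beyond x → m ≤ proj₁ x
        m≤ (inj₁ lt)         = ℕₚ.<⇒≤ lt
        m≤ (inj₂ (refl , _)) = ℕₚ.≤-refl

        module First-beyond {mg e} (dn : Done H (mg , e)) (bg : Beyond (mg , e))
                            (min : ∀ {y} → Done H y → Beyond y → ¬ HEdge y (mg , e)) where

          ing : In C (mg , e)
          ing = h-in dn

          none-before : ∀ {y} → In C y → Beyond y → ¬ HEdge y (mg , e)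
          none-before iy b ed = min (h-down dn iy ed) b ed

          is-send : kind e ≡ send
          is-send with kind e in eq
          ... | send    = refl
          ... | receive = contradiction (inj₁ (refl , inj₁ (kind-partner-receive e eq , partner-involutive e)))
                            (none-before (in-partner ing) (same bg))
            where same : Beyond (mg , e) → Beyond (mg , partner e)
                  same (inj₁ x) = inj₁ x
                  same (inj₂ y) = inj₂ y

          in-below : ∀ {f} → Valid (path (lab C mg)) f → coord f < coord e → In C (mg , f)
          in-below {f} vf lt = inside (batch≤ ing) vf (ℕₚ.≤-<-trans (coord≤⇒idx≤ f e (ℕₚ.<⇒≤ lt)) (before ing))

          uninformed : ¬ Triggers G (Legit.node lg) (proc e)
          uninformed tr with Legit.informs lg _ tr
          ... | inj₂ (_ , r≡q) = not-done-yet dn r≡q (m≤ {mg , e} bg)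
          ... | inj₁ (f₀ , f , _ , vf , p₀ , pf , le) =
            let u , f∈ = h-down dn (in-take (Local.m≤len lo) cut≤ vf) (f-before bg)
                _ , f₀∈ , _ = done-⊑ (Local.m≤len lo) cut≤ le f∈
            in not-done-yet (_ , f₀∈) p₀ ℕₚ.≤-refl
            where
            f-before : Beyond (mg , e) → HEdge (m , f) (mg , e)
            f-before (inj₁ m<) = inj₂ (m< , pf)
            f-before (inj₂ (refl , κ≤)) = inj₁ (refl , inj₂ (pf , idx<⇒coord< f e
              (ℕₚ.<-≤-trans (proj₁ (‼-take⁻ (cutoff w) (path (lab C m)) (at vf))) κ≤)))

          impossible : ⊥
          impossible = by bg
            where
            later : ∀ {mg} → m < mg → Done H (mg , e) → In C (mg , e) →
                    (∀ {y} → In C y → Beyond y → ¬ HEdge y (mg , e)) →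
                    (∀ {f} → Valid (path (lab C mg)) f → coord f < coord e → In C (mg , f)) → ⊥
            by : Beyond (mg , e) → ⊥
            by (inj₂ (refl , κ≤)) = uninformed (triggers-tail lg (on-path ing) κ≤ is-send λ f vf pf κ≤f → ℕₚ.≮⇒≥ λ lt →
                  none-before (in-below vf lt) (inj₂ (refl , κ≤f)) (inj₁ (refl , inj₂ (pf , lt))))
            by (inj₁ m<) = later m< dn ing none-before in-below
            later {suc m₁} (s≤s m≤m₁) dn ing none in< with legitAt C (batch≤ ing)
            ... | p₁ , d₁ , lg₁ = by-case (ℕₚ.m≤n⇒m<n∨m≡n m≤m₁)
              where
              first-here : First (path (target (exit C m₁))) (proc e) e
              first-here = subst (λ ℓ → First (path ℓ) (proc e) e) (lab-suc C (batch≤ ing))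
                (on-path ing , refl , λ f vf pf → ℕₚ.≮⇒≥ λ lt →
                  none (in< vf lt) (inj₁ (s≤s m≤m₁)) (inj₁ (refl , inj₂ (pf , lt))))
              by-case : m < m₁ ⊎ m ≡ m₁ → ⊥
              -- The process of `e` triggers the exit of the preceding batch and so has an event
              -- there. As that batch is later than `m`, this event is beyond the cut as well and
              -- below `e`, against minimality.
              by-case (inj₁ m<m₁) with Legit.informs lg₁ _ (triggers-next lg₁ lg₁ ℕₚ.≤-refl first-here is-send (λ _ _ _ κ≤ → ℕₚ.≤⇒≯ κ≤))
              ... | inj₂ (root , _) = contradiction (subst (m <_) (lab-root⇒0 C (ℕₚ.<⇒≤ (batch≤ ing)) root) m<m₁) λ ()
              ... | inj₁ (_ , f , _ , vf , _ , pf , _) =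
                none (in-take (ℕₚ.<⇒≤ (batch≤ ing)) ℕₚ.≤-refl vf) (inj₁ m<m₁) (inj₂ (ℕₚ.≤-refl , pf))
              by-case (inj₂ refl) = uninformed (triggers-next lg lg₁ cut≤ first-here is-send λ f vf pf κ≤ lt →
                none (inside (ℕₚ.<⇒≤ (batch≤ ing)) vf lt) (inj₂ (refl , κ≤)) (inj₂ (ℕₚ.≤-refl , pf)))

      -- The first event beyond a new exit would be a send of a triggering process, which is informed by q; but q has not started.
      none-beyond : ∀ {m′ e} → Done H (m′ , e) → m′ < m ⊎ (m′ ≡ m × idx e < cutoff w)
      none-beyond {m′} {e} (v , e∈) with beyond? (m′ , e)
      ... | no ¬b with ℕₚ.<-cmp m′ m
      ...   | tri< lt _ _    = inj₁ lt
      ...   | tri≈ _ refl _  = inj₂ (refl , ℕₚ.≰⇒> λ le → ¬b (inj₂ (refl , le)))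
      ...   | tri> _ _ gt    = contradiction (inj₁ gt) ¬b
      none-beyond {m′} {e} (v , e∈) | yes b
        with hminimal C (filter beyond? (map proj₁ H)) (λ x∈ → h-in (un-map (proj₁ (∈ₚ.∈-filter⁻ beyond? {xs = map proj₁ H} x∈))))
               (∈ₚ.∈-filter⁺ beyond? (∈ₚ.∈-map⁺ proj₁ e∈) b)
        where
        un-map : ∀ {x} → x ∈ map proj₁ H → Done H x
        un-map x∈ with ∈ₚ.∈-map⁻ proj₁ x∈
        ... | (_ , w) , y∈ , refl = w , y∈
      ... | (mg , eg) , g∈ , min with ∈ₚ.∈-filter⁻ beyond? {xs = map proj₁ H} g∈
      ...   | g∈H , bg with ∈ₚ.∈-map⁻ proj₁ g∈H
      ...     | (_ , u) , y∈ , refl = ⊥-elim (First-beyond.impossible (u , y∈) bg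
                (λ { (w , y∈) by → min (∈ₚ.∈-filter⁺ beyond? (∈ₚ.∈-map⁺ proj₁ y∈) by) }))

  -- Nothing executed lies beyond the new exit, so the history is a history of the shortened chain.
  -- The new decider `q` has no event in batch `m` so far, whence `v-decider` holds vacuously for
  -- the new exit.
  module Recut {ℓ₁ ℓ₂ H ch m w q} {C : Chain ℓ₀ ℓ₁} {C′ : Chain ℓ₀ ℓ₂} (g : Global C H ch) (cuts : Cuts C m w q C′)
               (m≤ : m ≤ len C) (le : w ≤ᵛ exit C m)
               (none : ∀ {m′ e} → Done H (m′ , e) → m′ < m ⊎ (m′ ≡ m × idx e < cutoff w))
               (not-q : ∀ {e} → Done H (m , e) → proc e ≢ q) where
    open Cuts cuts
    open Global g

    done-batch : ∀ {i e} → Done H (i , e) → i ≤ m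
    done-batch d with none d
    ... | inj₁ lt         = ℕₚ.<⇒≤ lt
    ... | inj₂ (refl , _) = ℕₚ.≤-refl

    exit-le : ∀ {i} → i ≤ m → exit C′ i ≤ᵛ exit C i
    exit-le i≤ with ℕₚ.m≤n⇒m<n∨m≡n i≤
    ... | inj₁ i<   = ℕₚ.≤-reflexive (cong toℕ (exit-before i<))
    ... | inj₂ refl = subst (_≤ᵛ exit C m) (sym exit-cut) le

    in⇒ : ∀ {i e} → i ≤ m → In C′ (i , e) → In C (i , e)
    in⇒ i≤ (inside _ v b) = inside (ℕₚ.≤-trans i≤ m≤) (subst (λ ℓ → Valid (path ℓ) _) (lab-cut i≤) v)
                              (ℕₚ.<-≤-trans b (cutoff-mono (exit-le i≤)))

    ≤len : ∀ {i} → i ≤ m → i ≤ len C′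
    ≤len i≤ = subst (_ ≤_) (sym len-cut) (ℕₚ.m≤n⇒m≤1+n i≤)

    done⇒in : ∀ {x} → Done H x → In C′ x
    done⇒in {i , e} d with h-in d
    ... | inside _ v b = inside (≤len (done-batch d)) (subst (λ ℓ → Valid (path ℓ) _) (sym (lab-cut (done-batch d))) v) (small (none d))
      where
      small : i < m ⊎ (i ≡ m × idx e < cutoff w) → idx e < cutoff (exit C′ i)
      small (inj₁ i<)          = subst (λ u → idx e < cutoff u) (sym (exit-before i<)) b
      small (inj₂ (refl , lt)) = subst (λ u → idx e < cutoff u) (sym exit-cut) lt

    hedge-batch : ∀ {x y} → HEdge x y → proj₁ x ≤ proj₁ y
    hedge-batch (inj₁ (refl , _)) = ℕₚ.≤-refl
    hedge-batch (inj₂ (lt , _))   = ℕₚ.<⇒≤ lt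

    recut-global : Global C′ H ch
    recut-global = record
      { h-in = done⇒in
      ; h-down = λ d i ed → h-down d (in⇒ (ℕₚ.≤-trans (hedge-batch ed) (done-batch d)) i) ed
      ; h-order = h-order
      ; v-low = λ e∈ → ℕₚ.≤-trans (exit-le (done-batch (_ , e∈))) (v-low e∈)
      ; v-legit = λ {_} {_} {v} e∈ → subst (λ ℓ → v ≡ noExit ⊎ ∃ λ p → Legit ℓ v p) (sym (lab-cut (done-batch (_ , e∈)))) (v-legit e∈)
      ; v-mono = v-mono
      ; v-decider = decider-ok
      ; channel = λ r q → let open Channel (channel r q) in record
          { pending = pending
          ; carried = pointwise-map (λ x∈ (l≡ , c≡) → l≡ , trans c≡ (cong (λ ℓ → ℓ , _ , _)
              (sym (lab-cut (done-batch (_ , proj₁ (sound x∈))))))) carried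
          ; sorted = sorted ; sound = sound ; complete = complete } }
      where
      decider-ok : ∀ {i p e v} → Decides C′ i p → ((i , e) , v) ∈ H → proc e ≡ p → v ≤ᵛ exit C′ i
      decider-ok d e∈ refl with ℕₚ.m≤n⇒m<n∨m≡n (done-batch (_ , e∈))
      ... | inj₁ i<   = subst (_ ≤ᵛ_) (sym (exit-before i<)) (v-decider (decides-before i< d) e∈ refl)
      ... | inj₂ refl = contradiction (decides-cut d) (not-q (_ , e∈))

    recut-other : ∀ {q′ s i} → q′ ≢ q → Proper H q′ i → Local C H q′ s i → Local C′ H q′ s i
    recut-other {q′} {s} {i} ne pr lo = record
      { m≤len = ≤len i≤m
      ; lab≡ = trans (lab-cut i≤m) lab≡
      ; done⇒ = done⇒
      ; ⇒done = finished
      ; covered = λ v pe lt → let v′ = subst (λ ℓ → Valid (path ℓ) _) (lab-cut i≤m) v in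
          before (done⇒in (⇒done (inside m≤len v′ (covered v′ pe lt)) pe (inj₂ (refl , lt))))
      ; fresh = fresh
      ; low = ℕₚ.≤-trans (exit-le i≤m) low
      ; below = below
      ; legit = subst (λ ℓ → vote s ≡ noExit ⊎ ∃ λ p → Legit ℓ (vote s) p) (sym (lab-cut i≤m)) legit
      ; decided = decided′
      ; free = λ eq → contradiction (subst (_≤ m) (trans eq len-cut) i≤m) (ℕₚ.<⇒≱ ℕₚ.≤-refl)
      ; takes = λ 0<i → subst (λ ℓ → Takes (path ℓ) q′) (sym (lab-cut i≤m)) (takes 0<i) }
      where
      open Local lo
      -- No process is left in a batch that is cut off, as it would have executed an event there.
      proper : ∀ i → Proper H q′ i → i ≤ m
      proper zero    _  = z≤n
      proper (suc i) pr = let e , d , _ = pr (s≤s z≤n) in done-batch d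
      i≤m : i ≤ m
      i≤m = proper i pr
      finished : ∀ {j e} → In C′ (j , e) → proc e ≡ q′ → j < i ⊎ (j ≡ i × coord e < count s) → Done H (j , e)
      finished ie pe (inj₁ j<)          = ⇒done (in⇒ (ℕₚ.≤-trans (ℕₚ.<⇒≤ j<) i≤m) ie) pe (inj₁ j<)
      finished ie pe (inj₂ (refl , lt)) = ⇒done (in⇒ i≤m ie) pe (inj₂ (refl , lt))
      decided′ : ∀ {j} → Decides C′ j q′ → j < i ⊎ (j ≡ i × vote s ≤ᵛ exit C′ i)
      decided′ d with ℕₚ.m≤n⇒m<n∨m≡n (ℕₚ.≤-pred (subst (_ <_) len-cut (decides⇒< C′ d)))
      ... | inj₂ refl = contradiction (decides-cut d) ne
      ... | inj₁ j< with decided (decides-before j< d)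
      ...   | inj₁ lt          = inj₁ lt
      ...   | inj₂ (refl , le) = inj₂ (refl , subst (vote s ≤ᵛ_) (sym (exit-before j<)) le)

    recut-self : ∀ {ℓ c v p} → Local C H q (state ℓ c v false) m → Legit (lab C m) w p → Local C′ H q (state ℓ c w true) m
    recut-self {ℓ} {c} {v} lo lg = record
      { m≤len = ≤len ℕₚ.≤-refl
      ; lab≡ = trans (lab-cut ℕₚ.≤-refl) lab≡
      ; done⇒ = done⇒
      ; ⇒done = finished
      ; covered = λ _ _ lt → contradiction (subst (_ <_) (proj₁ (fresh refl)) lt) λ ()
      ; fresh = λ ()
      ; low = ℕₚ.≤-reflexive (cong toℕ exit-cut)
      ; below = λ e∈ pe → contradiction pe (not-q (_ , e∈))
      ; legit = inj₂ (_ , subst (λ ℓ → Legit ℓ w _) (sym (lab-cut ℕₚ.≤-refl)) lg)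
      ; decided = decided′
      ; free = λ eq → contradiction (subst (_≤ m) (trans eq len-cut) ℕₚ.≤-refl) (ℕₚ.<⇒≱ ℕₚ.≤-refl)
      ; takes = λ 0<m → subst (λ ℓ → Takes (path ℓ) q) (sym (lab-cut ℕₚ.≤-refl)) (takes 0<m) }
      where
      open Local lo
      finished : ∀ {j e} → In C′ (j , e) → proc e ≡ q → j < m ⊎ (j ≡ m × coord e < c) → Done H (j , e)
      finished ie pe (inj₁ j<)          = ⇒done (in⇒ (ℕₚ.<⇒≤ j<) ie) pe (inj₁ j<)
      finished ie pe (inj₂ (refl , lt)) = ⇒done (in⇒ ℕₚ.≤-refl ie) pe (inj₂ (refl , lt))
      decided′ : ∀ {j} → Decides C′ j q → j < m ⊎ (j ≡ m × w ≤ᵛ exit C′ m)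
      decided′ d with ℕₚ.m≤n⇒m<n∨m≡n (ℕₚ.≤-pred (subst (_ <_) len-cut (decides⇒< C′ d)))
      ... | inj₁ j<   = inj₁ j<
      ... | inj₂ refl = inj₂ (refl , ℕₚ.≤-reflexive (cong toℕ (sym exit-cut)))

  -- The invariant, with process q in state s and the other processes in the states given by σ.
  record World (H : History) (ch : Channels) (q : Fin np) (s : State) (m : ℕ) (σ : Fin np → State) (μ : Fin np → ℕ) : Set where
    constructor world
    field
      {final} : Fin NL
      chain   : Chain ℓ₀ final
      plan    : Plan final
      global  : Global chain H ch
      self    : Local chain H q s m
      others  : ∀ {q′} → q′ ≢ q → Local chain H q′ (σ q′) (μ q′)

  unvoted-none : ∀ {ℓ₁} {C : Chain ℓ₀ ℓ₁} {H q ℓ c v m} → Local C H q (state ℓ c v false) m → ∀ {e} → Done H (m , e) → proc e ≢ q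
  unvoted-none lo d pe with Local.done⇒ lo d pe
  ... | inj₁ lt       = ℕₚ.<-irrefl refl lt
  ... | inj₂ (_ , lt) = contradiction (subst (_ <_) (proj₁ (Local.fresh lo refl)) lt) λ ()

  pass-self : ∀ {ℓ₁} {C : Chain ℓ₀ ℓ₁} {H q ℓ c v m} → (m ≡ len C → must (lab C m) ≢ just q) →
              Local C H q (state ℓ c v false) m → Local C H q (state ℓ c noExit true) m
  pass-self {C = C} ne lo with Local.fresh lo refl
  ... | _ , refl = record
    { m≤len = m≤len ; lab≡ = lab≡ ; done⇒ = done⇒ ; ⇒done = ⇒done ; covered = covered ; fresh = λ () ; low = low
    ; below = below ; legit = legit ; decided = decided ; free = λ eq _ → ne eq ; takes = takes }
    where open Local lo

  cast-late : ∀ {ℓ₁} {C : Chain ℓ₀ ℓ₁} {H q ℓ c v m w p} → Legit (lab C m) w p → exit C m ≤ᵛ w →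
              Local C H q (state ℓ c v false) m → Local C H q (state ℓ c w true) m
  cast-late {C = C} {m = m} {w} lg le lo = record
    { m≤len = m≤len ; lab≡ = lab≡ ; done⇒ = done⇒ ; ⇒done = ⇒done ; covered = covered ; fresh = λ () ; low = le
    ; below = λ e∈ pe → contradiction pe (unvoted-none lo (_ , e∈)) ; legit = inj₂ (_ , lg)
    ; decided = decided′
    ; free = λ { refl → contradiction (exit<⇒< C ℕₚ.≤-refl le (legit<noExit lg)) (ℕₚ.<-irrefl refl) }
    ; takes = takes }
    where
    open Local lo
    decided′ : ∀ {j} → Decides C j _ → j < m ⊎ (j ≡ m × w ≤ᵛ exit C m)
    decided′ d with decided d
    ... | inj₁ lt = inj₁ lt
    ... | inj₂ (refl , le′) = inj₂ (refl , ℕₚ.≤-trans (ℕₚ.<⇒≤ (legit<noExit lg)) (subst (_≤ᵛ exit C m) (proj₂ (fresh refl)) le′))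

  -- A vote that does not beat the present exit leaves chain and plan alone. An earlier exit voids
  -- whatever was chained or planned behind the old one, and the plan that comes with the vote takes
  -- its place.
  vote-world : ∀ {H ch q s s′ m σ μ} → (∀ {q′} → q′ ≢ q → Proper H q′ (μ q′)) →
               World H ch q s m σ μ → Voting q s s′ → World H ch q s′ m σ μ
  vote-world pr w already = w
  vote-world pr (world C plan g lo others) (now (pass ne)) =
    world C plan g (pass-self (λ _ eq → ne (trans (cong must (sym (Local.lab≡ lo))) eq)) lo) others
  vote-world {m = m} pr (world C plan g lo others) (now (cast {v = w} lg plan′)) with Local.lab≡ lo | toℕ w <? toℕ (exit C m)
  ... | refl | no ¬lt = world C plan g (cast-late lg (ℕₚ.≮⇒≥ ¬lt) lo) others
  ... | refl | yes lt with cut C m (Local.m≤len lo) lg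
  ...   | C′ , cuts = world C′ plan′ recut-global (recut-self lo lg) (λ ne → recut-other ne (pr ne) (others ne))
    where open Recut g cuts (Local.m≤len lo) (ℕₚ.<⇒≤ lt) (none-beyond g lo lg lt) (unvoted-none lo)

  module _ {ℓ₁ H ch} {C : Chain ℓ₀ ℓ₁} (g : Global C H ch) where
    open Global g

    enter-batch : ∀ {q s m m′} → Local C H q s m → m < m′ → m′ ≤ len C → Takes (path (lab C m′)) q →
                  (∀ {i e} → In C (i , e) → proc e ≡ q → i < m′ → Done H (i , e)) →
                  Local C H q (state (lab C m′) 0 noExit false) m′
    enter-batch {q} {s} {m} {m′} lo m<m′ m′≤ tk all = record
      { m≤len = m′≤ ; lab≡ = refl
      ; done⇒ = λ d pe → inj₁ (earlier (done⇒ d pe))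
      ; ⇒done = λ { ie pe (inj₁ lt) → all ie pe lt ; _ _ (inj₂ (_ , ())) }
      ; covered = λ _ _ () ; fresh = λ _ → refl , refl
      ; low = exit≤noExit C m′≤
      ; below = λ e∈ pe → contradiction (earlier (done⇒ (_ , e∈) pe)) (ℕₚ.<-irrefl refl)
      ; legit = inj₁ refl
      ; decided = λ d → inj₁ (earlier′ (decided d))
      ; free = λ _ () ; takes = λ _ → tk }
      where
      open Local lo
      earlier : ∀ {i} {A : Set} → i < m ⊎ (i ≡ m × A) → i < m′
      earlier (inj₁ lt)         = ℕₚ.<-trans lt m<m′
      earlier (inj₂ (refl , _)) = m<m′
      earlier′ : ∀ {i} → i < m ⊎ (i ≡ m × vote s ≤ᵛ exit C m) → i < m′
      earlier′ = earlier

    -- Suppose the send lay at or beyond the exit. It would be the first event there of its process,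
    -- which is then a trigger of the exit node and knows the exit; but a process sends only before
    -- the cutoff it knows.
    own-send-in : ∀ {q ℓ c v e m} → Local C H q (state ℓ c v true) m → Next q ℓ c e → kind e ≡ send → idx e < cutoff v → In C (m , e)
    own-send-in {q} {c = c} {v} {e} {m} lo (next ve refl _ earlier) ke lt with Local.lab≡ lo | ℕₚ.m≤n⇒m<n∨m≡n (Local.m≤len lo)
    ... | refl | inj₂ refl = in-noExit C refl ve
    ... | refl | inj₁ m< with idx e <? cutoff (exit C m) | decider C m<
    ...   | yes lt′ | _ = inside (Local.m≤len lo) ve lt′
    ...   | no ¬lt | p , d = contradiction (ℕₚ.<-≤-trans lt (cutoff-mono {v} (knows-exit g lo d done-below
              (triggers-tail (decides⇒legit C d) ve κ≤ ke λ f vf pf κ≤f → ℕₚ.≮⇒≥ λ lt′ →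
                 ℕₚ.<⇒≱ (Local.covered lo vf pf (earlier f vf pf lt′)) κ≤f)))) ¬lt
      where
      κ≤ : cutoff (exit C m) ≤ idx e
      κ≤ = ℕₚ.≮⇒≥ ¬lt
      done-below : DoneBelow q (lab C m) (cutoff (exit C m)) c
      done-below f vf pf lt′ = earlier f vf pf (idx<⇒coord< f e (ℕₚ.<-≤-trans lt′ κ≤))

    -- The vote `v` is never smaller than the exit. Since `q` has finished everything before the
    -- cutoff of `v` without passing the exit, it is quiet between the two; so its first send in
    -- `target v` makes it a trigger of the exit node, and it knows the exit.
    send-jump-in : ∀ {q ℓ c v e m} → Local C H q (state ℓ c v true) m → v ≢ noExit → DoneBelow q ℓ (cutoff v) c →
                   First (path (target v)) q e → kind e ≡ send → m < len C × v ≡ exit C m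
    send-jump-in {q} {c = c} {v} {e} {m} lo ne dn fe ke with Local.lab≡ lo | Local.legit lo
    ... | refl | inj₁ eq = contradiction eq ne
    ... | refl | inj₂ (_ , lgv) with exit<⇒< C (Local.m≤len lo) (Local.low lo) (legit<noExit lgv)
    ...   | m< with decider C m<
    ...     | p , d = m< , ≤ᵛ-antisym (knows-exit g lo d (λ f vf pf lt → dn f vf pf (ℕₚ.<-≤-trans lt κ≤)) tr) (Local.low lo)
      where
      κ≤ : cutoff (exit C m) ≤ cutoff v
      κ≤ = cutoff-mono {exit C m} (Local.low lo)
      tr : Triggers G (Legit.node (decides⇒legit C d)) q
      tr = triggers-next (decides⇒legit C d) lgv κ≤ fe ke λ f vf pf κ≤f lt →
             ℕₚ.<⇒≱ (Local.covered lo vf pf (dn f vf pf lt)) κ≤f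

    unique-vote : ∀ {x v w} → (x , v) ∈ H → (x , w) ∈ H → v ≡ w
    unique-vote = go h-order
      where
      go : ∀ {H x v w} → AllPairs (λ a b → proj₁ a ≢ proj₁ b × ¬ HEdge (proj₁ a) (proj₁ b)) H → (x , v) ∈ H → (x , w) ∈ H → v ≡ w
      go (_ ∷ _)  (here refl) (here refl) = refl
      go (r ∷ _)  (here refl) (there w∈)  = contradiction refl (proj₁ (All.lookup r w∈))
      go (r ∷ _)  (there v∈)  (here refl) = contradiction refl (proj₁ (All.lookup r v∈))
      go (_ ∷ rs) (there v∈)  (there w∈)  = go rs v∈ w∈

    module Add {q ℓ c v e w m} (lo : Local C H q (state ℓ c v true) m) (nx : Next q ℓ c e) (ine : In C (m , e))
               (w≤v : w ≤ᵛ v) (low-w : exit C m ≤ᵛ w) (legit-w : w ≡ noExit ⊎ ∃ λ p → Legit (lab C m) w p)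
               (received : kind e ≡ receive → Done H (m , partner e))
               (sender-vote : ∀ {u} → kind e ≡ receive → ((m , partner e) , u) ∈ H → w ≤ᵛ u) where
      open Next nx
      open Local lo

      H′ : History
      H′ = ((m , e) , w) ∷ H

      not-yet : ¬ Done H (m , e)
      not-yet d with done⇒ d is-proc
      ... | inj₁ lt       = ℕₚ.<-irrefl refl lt
      ... | inj₂ (_ , lt) = ℕₚ.<⇒≱ lt not-done

      weaken : ∀ {x} → Done H x → Done H′ x
      weaken (u , x∈) = u , there x∈

      predecessors : ∀ {y} → In C y → HEdge y (m , e) → Done H y
      predecessors {_ , f} iy (inj₂ (lt , pf)) = ⇒done iy (trans pf is-proc) (inj₁ lt)
      predecessors {_ , f} iy (inj₁ (refl , inj₂ (pf , lt))) =
        ⇒done iy (trans pf is-proc) (inj₂ (refl , earlier f (subst (λ ℓ → Valid (path ℓ) f) lab≡ (on-path iy)) (trans pf is-proc) lt))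
      predecessors {_ , f} iy (inj₁ (refl , inj₁ (kf , refl))) =
        subst (λ f′ → Done H (m , f′)) (partner-involutive f) (received (kind-partner-send f kf))

      add-global : ∀ {ch′} → (∀ r q → Channel C H′ r q (ch′ r q)) → Global C H′ ch′
      add-global chs = record
        { h-in = λ { (_ , here refl) → ine ; (u , there x∈) → h-in (u , x∈) }
        ; h-down = λ { (_ , here refl) iy ed → weaken (predecessors iy ed) ; (u , there x∈) iy ed → weaken (h-down (u , x∈) iy ed) }
        ; h-order = All.tabulate (λ {y} y∈ → (λ { refl → not-yet (_ , y∈) }) , (λ ed → not-yet (h-down (_ , y∈) ine ed))) ∷ h-order
        ; v-low = λ { (here refl) → low-w ; (there x∈) → v-low x∈ }
        ; v-legit = λ { (here refl) → legit-w ; (there x∈) → v-legit x∈ }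
        ; v-mono = mono
        ; v-decider = λ { d (here refl) pe → ℕₚ.≤-trans w≤v (own-exit (decided (subst (Decides C m) (trans (sym pe) is-proc) d))) ; d (there x∈) → v-decider d x∈ }
        ; channel = chs }
        where
        own-exit : m < m ⊎ (m ≡ m × v ≤ᵛ exit C m) → v ≤ᵛ exit C m
        own-exit (inj₁ lt)       = contradiction lt (ℕₚ.<-irrefl refl)
        own-exit (inj₂ (_ , le)) = le
        mono : ∀ {i f f′ u u′} → ((i , f) , u) ∈ H′ → ((i , f′) , u′) ∈ H′ → Edge f f′ → u′ ≤ᵛ u
        mono (here refl) (here refl) ed = contradiction ed (edge-coord-irrefl e)
        mono (here refl) (there f′∈) ed = contradiction (h-down (_ , f′∈) ine (inj₁ (refl , ed))) not-yet
        mono (there f∈)  (there f′∈) ed = v-mono f∈ f′∈ ed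
        mono (there f∈)  (here refl) (inj₂ (pf , _)) = ℕₚ.≤-trans w≤v (below f∈ (trans pf is-proc))
        mono {f = f} (there f∈) (here refl) (inj₁ (kf , refl)) =
          sender-vote (kind-partner-send f kf) (subst (λ f → ((m , f) , _) ∈ H) (sym (partner-involutive f)) f∈)

      add-self : Local C H′ q (state ℓ (suc (coord e)) w true) m
      add-self = record
        { m≤len = m≤len ; lab≡ = lab≡
        ; done⇒ = λ { (_ , here refl) _ → inj₂ (refl , ℕₚ.≤-refl) ; {i} {f} (u , there x∈) pe → later {i} {f} (done⇒ (u , x∈) pe) }
        ; ⇒done = finished
        ; covered = covered′
        ; fresh = λ () ; low = low-w
        ; below = λ { (here refl) _ → ℕₚ.≤-refl ; (there x∈) pe → ℕₚ.≤-trans w≤v (below x∈ pe) }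
        ; legit = legit-w
        ; decided = λ d → decided′ (decided d)
        ; free = free ; takes = takes }
        where
        later : ∀ {i f} → i < m ⊎ (i ≡ m × coord f < c) → i < m ⊎ (i ≡ m × coord f < suc (coord e))
        later (inj₁ lt) = inj₁ lt
        later (inj₂ (eq , lt)) = inj₂ (eq , ℕₚ.m≤n⇒m≤1+n (ℕₚ.<-≤-trans lt not-done))
        decided′ : ∀ {i} → i < m ⊎ (i ≡ m × v ≤ᵛ exit C m) → i < m ⊎ (i ≡ m × w ≤ᵛ exit C m)
        decided′ (inj₁ lt) = inj₁ lt
        decided′ (inj₂ (eq , le)) = inj₂ (eq , ℕₚ.≤-trans w≤v le)
        old : ∀ {f} → Valid (path (lab C m)) f → proc f ≡ q → coord f < suc (coord e) → f ≡ e ⊎ coord f < c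
        old {f} vf pf lt with ℕₚ.m≤n⇒m<n∨m≡n (ℕₚ.≤-pred lt)
        ... | inj₁ lt′ = inj₂ (earlier f (subst (λ ℓ → Valid (path ℓ) f) lab≡ vf) pf lt′)
        ... | inj₂ eq  = inj₁ (coord-injective vf (on-path ine) (trans pf (sym is-proc)) eq)
        finished : ∀ {i f} → In C (i , f) → proc f ≡ q → i < m ⊎ (i ≡ m × coord f < suc (coord e)) → Done H′ (i , f)
        finished iy pf (inj₁ lt) = weaken (⇒done iy pf (inj₁ lt))
        finished iy pf (inj₂ (refl , lt)) with old (on-path iy) pf lt
        ... | inj₁ refl = _ , here refl
        ... | inj₂ lt′  = weaken (⇒done iy pf (inj₂ (refl , lt′)))
        covered′ : ∀ {f} → Valid (path (lab C m)) f → proc f ≡ q → coord f < suc (coord e) → idx f < cutoff (exit C m)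
        covered′ vf pf lt with old vf pf lt
        ... | inj₁ refl = before ine
        ... | inj₂ lt′  = covered vf pf lt′

      add-other : ∀ {q′ s i} → q′ ≢ q → Local C H q′ s i → Local C H′ q′ s i
      add-other ne lo′ = record
        { m≤len = L.m≤len ; lab≡ = L.lab≡
        ; done⇒ = λ { (_ , here refl) pe → contradiction (trans (sym pe) is-proc) ne ; (u , there x∈) pe → L.done⇒ (u , x∈) pe }
        ; ⇒done = λ iy pf lt → weaken (L.⇒done iy pf lt)
        ; covered = L.covered ; fresh = L.fresh ; low = L.low
        ; below = λ { (here refl) pe → contradiction (trans (sym pe) is-proc) ne ; (there x∈) pe → L.below x∈ pe }
        ; legit = L.legit ; decided = L.decided ; free = L.free ; takes = L.takes }
        where module L = Local lo′

      still-waiting : ∀ {x} → ¬ Done H x → x ≢ (m , e) → ¬ Done H′ x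
      still-waiting nd ne (_ , here refl) = ne refl
      still-waiting nd ne (u , there x∈)  = nd (u , x∈)

  -- Steps preserve the invariant

  module _ {ℓ₁ : Fin NL} {C : Chain ℓ₀ ℓ₁} {H : History} {ch : Channels} (g : Global C H ch) where
    open Global g

    module Sent {q ℓ c v e m} (lo : Local C H q (state ℓ c v true) m) (nx : Next q ℓ c e) (ine : In C (m , e))
                (ke : kind e ≡ send) where

      open Add g lo nx ine ℕₚ.≤-refl (Local.low lo) (Local.legit lo)
        (λ kr → contradiction (trans (sym ke) kr) send≢receive) (λ kr → contradiction (trans (sym ke) kr) send≢receive) public

      private
        new : HEvent × Vote
        new = (m , e) , v

      not-receiver : ∀ {y} → kind (proj₂ y) ≡ send → hpartner y ≢ (m , e)
      not-receiver {_ , f} ky refl = send≢receive (trans (sym ke) (kind-partner-send f ky))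

      new-waits : ¬ Done H′ (m , partner e)
      new-waits (_ , here eq)   = proc-partner e (cong (proc ∘ proj₂ ∘ proj₁) (sym eq))
      new-waits (u , there x∈) = not-yet (h-down (u , x∈) ine (inj₁ (refl , inj₁ (ke , refl))))

      send-channels : ∀ {ch′ : Channels} {d : Fin controls} → control d ≡ (lab C m , coord (partner e) , v) →
        ch′ q (proc (partner e)) ≡ ch q (proc (partner e)) ++ [ label e , d ] →
        (∀ r r′ → ¬ (r ≡ q × r′ ≡ proc (partner e)) → ch r r′ ≡ ch′ r r′) →
        ∀ r r′ → Channel C H′ r r′ (ch′ r r′)
      send-channels {ch′} {d} c≡ app same r r′ with r Fin.≟ q | r′ Fin.≟ proc (partner e)
      ... | yes refl | yes refl = subst (Channel C H′ r r′) (sym app) record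
        { pending  = pending ++ [ new ]
        ; carried  = Pointwise.++⁺ carried ((refl , c≡) ∷ [])
        ; sorted   = AllPairsₚ.++⁺ sorted ([] ∷ []) (All.tabulate λ {y} y∈ → precedes {y} y∈ ∷ [])
        ; sound    = sound′ ∘ ∈ₚ.∈-++⁻ pending
        ; complete = λ { (here refl) _ _ _ _ → ∈ₚ.∈-++⁺ʳ pending (here refl)
                       ; (there x∈) ks ps pr nd → ∈ₚ.∈-++⁺ˡ (complete x∈ ks ps pr (nd ∘ weaken)) } }
        where
        open Channel (channel r r′)
        precedes : ∀ {y} → y ∈ pending → y ≺ new
        precedes {(i , f) , _} y∈ with sound y∈
        ... | y∈H , _ , py , _ with Local.done⇒ lo {i} {f} (_ , y∈H) py
        ...   | inj₁ lt          = inj₁ lt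
        ...   | inj₂ (refl , lt) = inj₂ (refl , ℕₚ.<-≤-trans lt (Next.not-done nx))
        sound′ : ∀ {x u} → (x , u) ∈ pending ⊎ (x , u) ∈ [ new ] →
                 (x , u) ∈ H′ × kind (proj₂ x) ≡ send × proc (proj₂ x) ≡ r × proc (partner (proj₂ x)) ≡ r′ × ¬ Done H′ (hpartner x)
        sound′ (inj₁ y∈) with sound y∈
        ... | y∈H , ky , py , pp , nd = there y∈H , ky , py , pp , still-waiting nd (not-receiver ky)
        sound′ (inj₂ (here refl)) = here refl , ke , Next.is-proc nx , refl , new-waits
      ... | yes refl | no ne = subst (Channel C H′ r r′) (same r r′ (λ (_ , eq) → ne eq)) record
          { pending = pending ; carried = carried ; sorted = sorted
          ; sound = λ y∈ → let y∈H , ky , py , pp , nd = sound y∈ in there y∈H , ky , py , pp , still-waiting nd (not-receiver ky)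
          ; complete = λ { (here refl) _ ps pr _ → contradiction (sym pr) ne
                         ; (there x∈) ks ps pr nd → complete x∈ ks ps pr (nd ∘ weaken) } }
        where open Channel (channel r r′)
      ... | no ne | _ = subst (Channel C H′ r r′) (same r r′ (λ (eq , _) → ne eq)) record
          { pending = pending ; carried = carried ; sorted = sorted
          ; sound = λ y∈ → let y∈H , ky , py , pp , nd = sound y∈ in there y∈H , ky , py , pp , still-waiting nd (not-receiver ky)
          ; complete = λ { (here refl) _ ps pr _ → contradiction (trans (sym ps) (Next.is-proc nx)) ne
                         ; (there x∈) ks ps pr nd → complete x∈ ks ps pr (nd ∘ weaken) } }
        where open Channel (channel r r′)

    record Head (r q : Fin np) (a : Fin nc × Fin controls) (ds : List (Fin nc × Fin controls)) : Set where
      field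
        top          : HEvent × Vote
        rest         : List (HEvent × Vote)
        carries-top  : Carries C top a
        carries-rest : Pointwise (Carries C) rest ds
        later        : ∀ {y} → y ∈ rest → top ≺ y
        sorted-rest  : AllPairs _≺_ rest
        sound        : ∀ {x v} → (x , v) ∈ top ∷ rest → (x , v) ∈ H × kind (proj₂ x) ≡ send × proc (proj₂ x) ≡ r ×
                       proc (partner (proj₂ x)) ≡ q × ¬ Done H (hpartner x)
        complete     : ∀ {x v} → (x , v) ∈ H → kind (proj₂ x) ≡ send → proc (proj₂ x) ≡ r →
                       proc (partner (proj₂ x)) ≡ q → ¬ Done H (hpartner x) → (x , v) ∈ top ∷ rest

    head : ∀ {r q a ds} → ch r q ≡ a ∷ ds → Head r q a ds
    head {r} {q} eq with ch r q | channel r q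
    head refl | _ | record { pending = t ∷ ts ; carried = c ∷ cs ; sorted = s ∷ ss ; sound = so ; complete = co } = record
      { top = t ; rest = ts ; carries-top = c ; carries-rest = cs ; later = All.lookup s ; sorted-rest = ss ; sound = so ; complete = co }

    -- FIFO order across batches: the message of `f` was sent by the same process before the one at
    -- the head, and it would be queued ahead of it if it were still unreceived.
    received-before : ∀ {r q a ds} (hd : Head r q a ds) → let ((i , _) , _) = Head.top hd in ∀ {j f} → j < i → In C (j , f) →
                      kind f ≡ receive → proc f ≡ q → proc (partner f) ≡ r → ¬ ¬ Done H (j , f)
    received-before {r} {q} hd {j} {f} j<i inf kf pf pr nd with Head.sound hd (here refl)
    ... | top∈ , _ , pt , _ , _ with h-down (_ , top∈) (in-partner inf) (inj₂ (j<i , trans pr (sym pt)))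
    ...   | u , s∈ with Head.complete hd s∈ (kind-partner-receive f kf) pr
                          (trans (cong proc (partner-involutive f)) pf)
                          (λ d → nd (subst (λ f → Done H (j , f)) (partner-involutive f) d))
    ...     | here refl = ℕₚ.<-irrefl refl j<i
    ...     | there s∈′ with Head.later hd s∈′
    ...       | inj₁ lt         = ℕₚ.<⇒≱ j<i (ℕₚ.<⇒≤ lt)
    ...       | inj₂ (refl , _) = ℕₚ.<-irrefl refl j<i

    control-≡ : ∀ {d : Fin controls} {ℓ ℓ′ : Fin NL} {c c′ : ℕ} {v v′ : Vote} → control d ≡ (ℓ , c , v) → control d ≡ (ℓ′ , c′ , v′) →
                ℓ ≡ ℓ′ × c ≡ c′ × v ≡ v′
    control-≡ eq eq′ with trans (sym eq) eq′
    ... | refl = refl , refl , refl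

    -- The message at the head could stem from another batch `i` with the same label. If `i < m`, it
    -- would have been received long ago. If `m < i`, then the message for `e` in batch `m` would
    -- have to be received before it, while `e` is still open.
    own-receive-in : ∀ {q ℓ c v e w m l d ds} → Local C H q (state ℓ c v true) m → Next q ℓ c e → kind e ≡ receive →
                     (hd : Head (proc (partner e)) q (l , d) ds) → control d ≡ (ℓ , coord e , w) →
                     In C (m , e) × Head.top hd ≡ ((m , partner e) , w)
    own-receive-in {q} {e = e} {m = m} lo (next ve pe not-done _) ke hd c≡
      with Head.top hd | Head.carries-top hd | Head.sound hd (here refl) | received-before hd
    ... | (i , f) , u | _ , c≡′ | f∈ , kf , pf , pp , nd | rb with control-≡ c≡′ c≡ | Local.lab≡ lo
    ...   | ℓ≡ , co≡ , refl | refl with ℕₚ.<-cmp i m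
    ...     | tri< i<m _ _ = contradiction (Local.⇒done lo (in-partner (h-in (_ , f∈))) pp (inj₁ i<m)) nd
    ...     | tri≈ _ refl _ with coord-injective (on-path (in-partner (h-in (_ , f∈)))) ve (trans pp (sym pe)) co≡
    ...       | refl = in-partner (h-in (_ , f∈)) , cong (λ f → (i , f) , u) (sym (partner-involutive f))
    own-receive-in {q} {e = e} {m = m} lo (next ve pe not-done _) ke hd c≡
      | (i , f) , u | _ , c≡′ | f∈ , kf , pf , pp , nd | rb | ℓ≡ , co≡ , refl | refl | tri> _ _ m<i =
      ⊥-elim (rb m<i (in-other C (Local.m≤len lo) other ve) ke pe refl λ d → not-before (Local.done⇒ lo d pe))
      where
      other : lab C m ≢ ℓ₀
      other eq = contradiction (subst (m <_) (lab-root⇒0 C (batch≤ (h-in (_ , f∈))) (trans ℓ≡ eq)) m<i) λ ()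
      not-before : ¬ (m < m ⊎ (m ≡ m × coord e < _))
      not-before (inj₁ lt)       = ℕₚ.<-irrefl refl lt
      not-before (inj₂ (_ , lt)) = ℕₚ.<⇒≱ lt not-done

    -- Again the label alone does not determine the batch `i`. If `q` took part in a batch between
    -- `m` and `i`, the promise of `m` would bind its first event there to be a receive from the
    -- same sender. By `received-before` that event would be done, yet `q` has not been there. So
    -- `m` is the last batch of `q` before `i`, and `κ` is its true cutoff.
    receive-jump-in : ∀ {q s ℓ′ κ e w m l d ds} → Local C H q s m → Proper H q m →
      last ℓ′ q ≡ (promise (batch s) q , κ) → promise (batch s) q ≡ nothing ⊎ promise (batch s) q ≡ just (proc (partner e)) →
      ℓ′ ≢ ℓ₀ → DoneBelow q (batch s) κ (count s) → First (path ℓ′) q e → kind e ≡ receive →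
      Head (proc (partner e)) q (l , d) ds → control d ≡ (ℓ′ , coord e , w) →
      ∃ λ i → m < i × i ≤ len C × lab C i ≡ ℓ′ × (∀ {j f} → In C (j , f) → proc f ≡ q → j < i → Done H (j , f))
    receive-jump-in {q} {s} {e = e} {m = m} lo pr last≡ promised ℓ′≢ dn fe@(ve , pe , least) ke hd c≡
      with Head.top hd | Head.carries-top hd | Head.sound hd (here refl) | received-before hd
    ... | (i , f) , u | _ , c≡′ | f∈ , kf , pf , pp , nd | rb with control-≡ c≡′ c≡
    ...   | refl , co≡ , refl with Local.lab≡ lo | coord-injective (on-path (in-partner (h-in (_ , f∈)))) ve (trans pp (sym pe)) co≡
    ...     | refl | refl with ℕₚ.<-cmp i m
    ...       | tri< i<m _ _ = contradiction (Local.⇒done lo (in-partner (h-in (_ , f∈))) pp (inj₁ i<m)) nd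
    ...       | tri≈ _ refl _ = contradiction refl (at-start (batch≤ (h-in (_ , f∈))))
      where
      -- Excludes `i ≡ m`: batch 0 is `ℓ₀`, and in any later batch `q` has already acted, so its
      -- first event `e` there is done.
      at-start : i ≤ len C → i ≢ i
      at-start l refl with zero? i
      ... | inj₁ i≡0 = ℓ′≢ (trans (cong (lab C) i≡0) (lab-0 C))
      ... | inj₂ 0<i with pr 0<i
      ...   | e′ , d′ , pe′ with Local.done⇒ lo d′ pe′
      ...     | inj₁ lt       = ℕₚ.<-irrefl refl lt
      ...     | inj₂ (_ , lt) = nd (Local.⇒done lo (in-partner (h-in (_ , f∈))) pp
                                  (inj₂ (refl , ℕₚ.≤-<-trans (least e′ (on-path (h-in d′)) pe′) lt)))
    ...       | tri> _ _ m<i = i , m<i , i≤ , refl , all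
      where
      i≤ : i ≤ len C
      i≤ = batch≤ (h-in (_ , f∈))
      started : m ≡ 0 ⊎ Takes (path (lab C m)) q
      started with zero? m
      ... | inj₁ m≡0 = inj₁ m≡0
      ... | inj₂ 0<m = inj₂ (Local.takes lo 0<m)
      all : ∀ {j f′} → In C (j , f′) → proc f′ ≡ q → j < i → Done H (j , f′)
      all {j} {f′} inj pj j<i with last-entry C q m<i i≤ started
      ... | inj₁ (none , eq) with ℕₚ.<-cmp j m
      ...   | tri< j<m _ _ = Local.⇒done lo inj pj (inj₁ j<m)
      ...   | tri> _ _ m<j = contradiction (f′ , on-path inj , pj) (none m<j j<i)
      ...   | tri≈ _ refl _ = Local.⇒done lo inj pj (inj₂ (refl , dn f′ (on-path inj) pj
                                (subst (idx f′ <_) (cong proj₂ (trans (sym eq) last≡)) (before inj))))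
      all {j} {f′} inj pj j<i | inj₂ (suc o , m<o , o<i , tk , eq , ne) with takes⇒first tk | legitAt C (ℕₚ.<⇒≤ (ℕₚ.<-≤-trans o<i i≤))
      ... | e₁ , fe₁@(v₁ , p₁ , _) | _ , _ , lg = ⊥-elim (break promised)
        where
        o< : o < len C
        o< = ℕₚ.<⇒≤ (ℕₚ.<-≤-trans o<i i≤)
        unreceived : ¬ Done H (suc o , e₁)
        unreceived d with Local.done⇒ lo d p₁
        ... | inj₁ lt         = ℕₚ.<-asym lt m<o
        ... | inj₂ (refl , _) = ℕₚ.<-irrefl refl m<o
        kept : Keeps (lab C (suc o)) q e₁
        kept = subst (λ ℓ → Keeps ℓ q e₁) (sym (lab-suc C o<))
                 (Legit.kept lg q e₁ (subst (λ ℓ → First (path ℓ) q e₁) (lab-suc C o<) fe₁))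
        broken : proc (partner e) ≡ awaitedBy e₁ → ⊥
        broken aw with kind e₁ in k₁
        ... | send    = proc-partner e (trans pe (trans (sym p₁) (sym aw)))
        ... | receive = rb o<i (in-other C o< (lab-other C o<) v₁) k₁ p₁ (sym aw) unreceived
        break : promise (lab C m) q ≡ nothing ⊎ promise (lab C m) q ≡ just (proc (partner e)) → ⊥
        -- The promise `nothing` can only be that of `ℓ₀`; a batch of `q` in between would have
        -- replaced it.
        break (inj₁ none) = ne (trans (cong proj₁ last≡) none)
        break (inj₂ some) with kept
        ... | inj₁ none = contradiction (trans (sym (trans (cong proj₁ eq) some)) none) λ ()
        ... | inj₂ eq′  = broken (just-injective (trans (sym (trans (cong proj₁ eq) some)) eq′))

    module Received {q ℓ c v w e m} (lo : Local C H q (state ℓ c v true) m) (nx : Next q ℓ c e) (ine : In C (m , e))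
                    (ke : kind e ≡ receive) {a ds} (hd : Head (proc (partner e)) q a ds)
                    (top≡ : Head.top hd ≡ ((m , partner e) , w)) where

      private
        send∈ : ((m , partner e) , w) ∈ H
        send∈ = subst (_∈ H) top≡ (proj₁ (Head.sound hd (here refl)))

      open Add g lo nx ine (⊓ᵛ-≤ˡ v w)
        (⊓ᵛ-elim (exit C m ≤ᵛ_) v w (Local.low lo) (v-low send∈))
        (⊓ᵛ-elim (λ u → u ≡ noExit ⊎ ∃ λ p → Legit (lab C m) u p) v w (Local.legit lo) (v-legit send∈))
        (λ _ → _ , send∈)
        (λ _ u∈ → subst (v ⊓ᵛ w ≤ᵛ_) (unique-vote g send∈ u∈) (⊓ᵛ-≤ʳ v w)) public

      private
        partner-≡ : ∀ {y} → hpartner y ≡ (m , e) → y ≡ (m , partner e)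
        partner-≡ {_ , f} refl = cong (m ,_) (sym (partner-involutive f))

      receive-channels : ∀ {ch′ : Channels} → ch (proc (partner e)) q ≡ a ∷ ch′ (proc (partner e)) q → ch′ (proc (partner e)) q ≡ ds →
        (∀ r r′ → ¬ (r ≡ proc (partner e) × r′ ≡ q) → ch r r′ ≡ ch′ r r′) →
        ∀ r r′ → Channel C H′ r r′ (ch′ r r′)
      receive-channels {ch′} app ds≡ same r r′ with r Fin.≟ proc (partner e) | r′ Fin.≟ q
      ... | yes refl | yes refl = subst (Channel C H′ r r′) (sym ds≡) record
        { pending = rest ; carried = carries-rest ; sorted = sorted-rest
        ; sound = λ y∈ → let y∈H , ky , py , pp , nd = sound (there y∈) in
            there y∈H , ky , py , pp , still-waiting nd λ eq → not-top y∈ (partner-≡ eq)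
        ; complete = λ { (here refl) ks _ _ _ → contradiction (trans (sym ks) ke) send≢receive
                       ; (there x∈) ks ps pr nd → remaining (complete x∈ ks ps pr (nd ∘ weaken)) nd } }
        where
        open Head hd
        not-top : ∀ {y u} → (y , u) ∈ rest → y ≢ (m , partner e)
        not-top {y} {u} y∈ refl = ≺-irrefl {y} {w} {u} (subst (_≺ (y , u)) top≡ (later y∈))
        remaining : ∀ {y u} → (y , u) ∈ top ∷ rest → ¬ Done H′ (hpartner y) → (y , u) ∈ rest
        remaining (there y∈) _ = y∈
        remaining (here refl) nd = contradiction (subst (Done H′ ∘ hpartner ∘ proj₁) (sym top≡)
          (_ , here (cong (λ f → (m , f) , v ⊓ᵛ w) (partner-involutive e)))) nd
      ... | yes refl | no ne = subst (Channel C H′ r r′) (same r r′ (λ (_ , eq) → ne eq)) record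
          { pending = pending ; carried = carried ; sorted = sorted
          ; sound = λ y∈ → let y∈H , ky , py , pp , nd = sound y∈ in
              there y∈H , ky , py , pp , still-waiting nd λ eq → ne (trans (sym pp) (trans (cong (proc ∘ proj₂) eq) (Next.is-proc nx)))
          ; complete = λ { (here refl) ks _ _ _ → contradiction (trans (sym ks) ke) send≢receive
                         ; (there x∈) ks ps pr nd → complete x∈ ks ps pr (nd ∘ weaken) } }
        where open Channel (channel r r′)
      ... | no ne | _ = subst (Channel C H′ r r′) (same r r′ (λ (eq , _) → ne eq)) record
          { pending = pending ; carried = carried ; sorted = sorted
          ; sound = λ y∈ → let y∈H , ky , py , pp , nd = sound y∈ in
              there y∈H , ky , py , pp , still-waiting nd λ eq → ne (trans (sym py) (cong (proc ∘ proj₂) (partner-≡ eq)))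
          ; complete = λ { (here refl) ks _ _ _ → contradiction (trans (sym ks) ke) send≢receive
                         ; (there x∈) ks ps pr nd → complete x∈ ks ps pr (nd ∘ weaken) } }
        where open Channel (channel r r′)

  -- The CFM and the invariant of its configurations

  Transition : Fin np → State → Act (Fin np) (Fin nc × Fin controls) → State → Set
  Transition p s (snd p′ q (l , d)) s′ = p′ ≡ p × ∃ λ e → SendStep p s e (control d) s′ × q ≡ proc (partner e) × l ≡ label e
  Transition p s (rcv p′ q (l , d)) s′ = p′ ≡ p × ∃ λ e → ReceiveStep p s e (control d) s′ × q ≡ proc (partner e) × l ≡ label e

  private
    initial : ∃ λ i → decode i ≡ state ℓ₀ 0 noExit false
    initial = encode (state ℓ₀ 0 noExit false) (s≤s z≤n)

  machine : CFM np (Fin nc × Fin controls)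
  machine = record
    { nst     = λ _ → states
    ; δ       = λ p s a s′ → Transition p (decode s) a (decode s′)
    ; δ-actor = λ { p s (snd _ _ _) s′ (eq , _) → eq ; p s (rcv _ _ _) s′ (eq , _) → eq }
    ; init    = λ _ → proj₁ initial
    ; final   = λ p s → Accepts p (decode s) }

  initial-state : decode (proj₁ initial) ≡ state ℓ₀ 0 noExit false
  initial-state = proj₂ initial

  Conf : Set
  Conf = Config machine
  open Config

  Locals : ∀ {ℓ₁} → Chain ℓ₀ ℓ₁ → History → Conf → Set
  Locals C H c = ∀ q → ∃ λ m → Local C H q (decode (st c q)) m × Proper H q m

  record Inv (H : History) (c : Conf) : Set where
    constructor inv
    field
      {final} : Fin NL
      chain   : Chain ℓ₀ final
      plan    : Plan final
      global  : Global chain H (ch c)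
      locals  : Locals chain H c

  stateOf : Conf → Fin np → State
  stateOf c q = decode (st c q)

  batchOf : ∀ {ℓ₁} {C : Chain ℓ₀ ℓ₁} {H c} → Locals C H c → Fin np → ℕ
  batchOf ls q = proj₁ (ls q)

  update-all : ∀ {c c′ p s} (P : Fin np → State → Set) → stateOf c′ p ≡ s → (∀ r → r ≢ p → st c′ r ≡ st c r) →
    P p s → (∀ {q} → q ≢ p → P q (stateOf c q)) → ∀ q → P q (stateOf c′ q)
  update-all {p = p} P refl same mine others q with q Fin.≟ p
  ... | yes refl = mine
  ... | no ne    = subst (λ i → P q (decode i)) (sym (same q ne)) (others ne)

  letterOf-send : ∀ e → kind e ≡ send → letterOf e ≡ snd (proc e) (proc (partner e)) (label e)
  letterOf-send e ke = cong (λ κ → act κ (proc e) (proc (partner e)) (label e)) ke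

  letterOf-receive : ∀ e → kind e ≡ receive → letterOf e ≡ rcv (proc e) (proc (partner e)) (label e)
  letterOf-receive e ke = cong (λ κ → act κ (proc e) (proc (partner e)) (label e)) ke

  Extends : History → Conf → Act (Fin np) (Fin nc) → Set
  Extends H c a = ∃ λ x → ∃ λ v → Inv ((x , v) ∷ H) c × a ≡ letterOf (proj₂ x)

  module _ {H : History} {c c′ : Conf} {p : Fin np} {μ : Fin np → ℕ} (pr : ∀ {q} → q ≢ p → Proper H q (μ q)) where

    private
      World′ : State → ℕ → Set
      World′ s m = World H (ch c) p s m (stateOf c) μ

    finish-send : ∀ {s₁ s′ e x m q l d} → World′ s₁ m → OwnSend p s₁ e x s′ → control d ≡ x → q ≡ proc (partner e) → l ≡ label e →
      stateOf c′ p ≡ s′ → (∀ r → r ≢ p → st c′ r ≡ st c r) → ch c′ p q ≡ ch c p q ++ [ l , d ] →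
      (∀ r r′ → ¬ (r ≡ p × r′ ≡ q) → ch c r r′ ≡ ch c′ r r′) → Extends H c′ (snd p q l)
    finish-send {e = e} {m = m} (world C plan g lo others) (own-send {v = v} nx@(next _ pe _ _) ke lt) c≡ refl refl st≡ same app rest =
      (m , e) , v ,
      inv C plan (add-global (send-channels {ch c′} (trans c≡ (cong (λ ℓ → ℓ , _ , _) (sym (Local.lab≡ lo)))) app rest))
        (update-all {c} {c′} (λ q s → ∃ λ i → Local C H′ q s i × Proper H′ q i) st≡ same
          (m , add-self , λ _ → e , (_ , here refl) , pe)
          (λ ne → _ , add-other ne (others ne) , λ 0< → let f , d , pf = pr ne 0< in f , weaken d , pf)) ,
      trans (cong (λ p → snd p (proc (partner e)) (label e)) (sym pe)) (sym (letterOf-send e ke))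
      where open Sent g lo nx (own-send-in g lo nx ke lt) ke

    finish-receive : ∀ {s₁ s′ e x m q l d} → World′ s₁ m → OwnReceive p s₁ e x s′ → control d ≡ x → q ≡ proc (partner e) → l ≡ label e →
      stateOf c′ p ≡ s′ → (∀ r → r ≢ p → st c′ r ≡ st c r) → ch c q p ≡ (l , d) ∷ ch c′ q p →
      (∀ r r′ → ¬ (r ≡ q × r′ ≡ p) → ch c r r′ ≡ ch c′ r r′) → Extends H c′ (rcv p q l)
    finish-receive {e = e} {m = m} (world C plan g lo others) (own-receive {v = v} {w = w} nx@(next _ pe _ _) ke) c≡ refl refl st≡ same app rest =
      (m , e) , v ⊓ᵛ w ,
      inv C plan (add-global (receive-channels {ch c′} app refl rest))
        (update-all {c} {c′} (λ q s → ∃ λ i → Local C H′ q s i × Proper H′ q i) st≡ same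
          (m , add-self , λ _ → e , (_ , here refl) , pe)
          (λ ne → _ , add-other ne (others ne) , λ 0< → let f , d , pf = pr ne 0< in f , weaken d , pf)) ,
      trans (cong (λ p → rcv p (proc (partner e)) (label e)) (sym pe)) (sym (letterOf-receive e ke))
      where
      hd = head g app
      valid-top = own-receive-in g lo nx ke hd c≡
      open Received g lo nx (proj₁ valid-top) ke hd (proj₂ valid-top)

    jump-send-world : ∀ {s₁ s₂ m} → World′ s₁ m → SendJump p s₁ s₂ → ∃ λ m′ → World′ s₂ m′
    jump-send-world {m = m} (world C plan g lo others) (send-jump {ℓ} {c = cn} {v} {e} ne dn fe@(ve , pe , _) ke)
      with send-jump-in g lo ne dn fe ke
    ... | m< , refl = suc m , world C plan g (subst (λ ℓ → Local C H p (state ℓ 0 noExit false) (suc m)) (lab-suc C m<)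
            (enter-batch g lo ℕₚ.≤-refl m< (e , subst (λ ℓ → Valid (path ℓ) e) (sym (lab-suc C m<)) ve , pe) all)) others
      where
      all : ∀ {i f} → In C (i , f) → proc f ≡ p → i < suc m → Done H (i , f)
      all {i} {f} inf pf i< with ℕₚ.m≤n⇒m<n∨m≡n (ℕₚ.≤-pred i<)
      ... | inj₁ i<m  = Local.⇒done lo inf pf (inj₁ i<m)
      ... | inj₂ refl = Local.⇒done lo inf pf (inj₂ (refl , dn f (subst (λ ℓ → Valid (path ℓ) f) (Local.lab≡ lo) (on-path inf)) pf (before inf)))

    jump-receive-world : ∀ {s s₂ ℓ e m l d w ds} → World′ s m → Proper H p m → ReceiveJump p (proc (partner e)) ℓ e s s₂ →
      ch c (proc (partner e)) p ≡ (l , d) ∷ ds → control d ≡ (ℓ , coord e , w) → ∃ λ m′ → World′ s₂ m′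
    jump-receive-world {ℓ = ℓ} {e} (world C plan g lo others) prp (receive-jump last≡ promised other dn fe@(ve , pe , _) ke refl) app c≡
      with receive-jump-in g lo prp last≡ promised other dn fe ke (head g app) c≡
    ... | i , m<i , i≤ , refl , all = i , world C plan g (enter-batch g lo m<i i≤ (e , ve , pe) all) others

    step-send : ∀ {s s′ e x m q l d} → World′ s m → SendStep p s e x s′ → control d ≡ x → q ≡ proc (partner e) → l ≡ label e →
      stateOf c′ p ≡ s′ → (∀ r → r ≢ p → st c′ r ≡ st c r) → ch c′ p q ≡ ch c p q ++ [ l , d ] →
      (∀ r r′ → ¬ (r ≡ p × r′ ≡ q) → ch c r r′ ≡ ch c′ r r′) → Extends H c′ (snd p q l)
    step-send w (stay vt own) = finish-send (vote-world pr w vt) own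
    step-send w (jump vt j vt′ own) = let _ , w′ = jump-send-world (vote-world pr w vt) j in finish-send (vote-world pr w′ vt′) own

    step-receive : ∀ {s s′ e x m q l d} → World′ s m → Proper H p m → ReceiveStep p s e x s′ → control d ≡ x → q ≡ proc (partner e) → l ≡ label e →
      stateOf c′ p ≡ s′ → (∀ r → r ≢ p → st c′ r ≡ st c r) → ch c q p ≡ (l , d) ∷ ch c′ q p →
      (∀ r r′ → ¬ (r ≡ q × r′ ≡ p) → ch c r r′ ≡ ch c′ r r′) → Extends H c′ (rcv p q l)
    step-receive w prp (stay vt own) = finish-receive (vote-world pr w vt) own
    step-receive w prp (jump j vt own@(own-receive _ _)) c≡ refl l≡ st≡ same app =
      let _ , w′ = jump-receive-world w prp j app c≡ in finish-receive (vote-world pr w′ vt) own c≡ refl l≡ st≡ same app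

  preserve : ∀ {H c a c′} → Inv H c → Step machine c a c′ → Extends H c′ (h a)
  preserve {H} {c} {snd p q (l , d)} {c′} (inv C plan g ls) ((_ , e , ss , q≡ , l≡) , same , app , rest) =
    step-send {c′ = c′} {μ = batchOf {c = c} ls} (λ {q} _ → proj₂ (proj₂ (ls q)))
      (world C plan g (proj₁ (proj₂ (ls p))) (λ {q} _ → proj₁ (proj₂ (ls q)))) ss refl q≡ l≡ refl same app (λ r r′ n → sym (rest r r′ n))
  preserve {H} {c} {rcv p q (l , d)} {c′} (inv C plan g ls) ((_ , e , rs , q≡ , l≡) , same , app , rest) =
    step-receive {c′ = c′} {μ = batchOf {c = c} ls} (λ {q} _ → proj₂ (proj₂ (ls q)))
      (world C plan g (proj₁ (proj₂ (ls p))) (λ {q} _ → proj₁ (proj₂ (ls q)))) (proj₂ (proj₂ (ls p))) rs refl q≡ l≡ refl same app (λ r r′ n → sym (rest r r′ n))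

  -- Progress along a planned run

  -- In `C` alone the last batch counts in full, its exit being `noExit`, whereas `F` may cut it. So
  -- passing to `C` is unconditional, while the converse needs a condition on the last batch.
  in-restrict : ∀ {ℓ ℓ₁ ℓ₂} (C : Chain ℓ ℓ₁) (F : Chain ℓ₁ ℓ₂) {i e} → i ≤ len C → In (C ⊕ F) (i , e) → In C (i , e)
  in-restrict C F {i} {e} i≤ (inside _ v b) with ℕₚ.m≤n⇒m<n∨m≡n i≤
  ... | inj₂ eq = in-noExit C eq (subst (λ ℓ → Valid (path ℓ) e) (lab-⊕ C F i≤) v)
  ... | inj₁ i< = inside i≤ (subst (λ ℓ → Valid (path ℓ) e) (lab-⊕ C F i≤) v) (subst (λ w → idx e < cutoff w) (exit-⊕ˡ C F i<) b)

  in-extend : ∀ {ℓ ℓ₁ ℓ₂} (C : Chain ℓ ℓ₁) (F : Chain ℓ₁ ℓ₂) {i e} → (i ≡ len C → idx e < cutoff (exit (C ⊕ F) i)) →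
              In C (i , e) → In (C ⊕ F) (i , e)
  in-extend C F {i} {e} small (inside i≤ v b) =
    inside (subst (i ≤_) (sym (len-⊕ C F)) (ℕₚ.≤-trans i≤ (ℕₚ.m≤m+n _ _))) (subst (λ ℓ → Valid (path ℓ) e) (sym (lab-⊕ C F i≤)) v) (b′ (ℕₚ.m≤n⇒m<n∨m≡n i≤))
    where
    b′ : i < len C ⊎ i ≡ len C → idx e < cutoff (exit (C ⊕ F) i)
    b′ (inj₂ eq) = small eq
    b′ (inj₁ i<) = subst (λ w → idx e < cutoff w) (sym (exit-⊕ˡ C F i<)) b

  -- The chain C of exits decided so far is to be continued by F to the planned run D; whoever is to decide
  -- the first exit of F has not voted yet.
  record Heading {ℓ*} (D : Chain ℓ₀ ℓ*) (H : History) (ch : Channels) (q : Fin np) (s : State) (m : ℕ)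
                 (σ : Fin np → State) (μ : Fin np → ℕ) : Set where
    constructor heading
    field
      {mid}        : Fin NL
      C            : Chain ℓ₀ mid
      F            : Chain mid ℓ*
      joined       : C ⊕ F ≡ D
      fin          : Final ℓ*
      global       : Global C H ch
      self         : Local C H q s m
      waits        : Decides F 0 q → m ≡ len C → voted s ≡ false
      others       : ∀ {p} → p ≢ q → Local C H p (σ p) (μ p)
      waits-others : ∀ {p} → p ≢ q → Decides F 0 p → μ p ≡ len C → voted (σ p) ≡ false

  -- The exit of batch `m` is settled, hence known to its decider, while a process that has not
  -- voted knows only `noExit`. In `ℓ₀` nobody is obliged.
  unobliged : ∀ {ℓ₁} {C : Chain ℓ₀ ℓ₁} {H q ℓ c v m} → Local C H q (state ℓ c v false) m → m < len C → must (lab C m) ≢ just q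
  unobliged {C = C} {m = m} lo m< eq with lab C m Fin.≟ ℓ₀ | legitAt C m<
  ... | yes root | _ = contradiction (trans (sym eq) (trans (cong must root) must₀)) λ ()
  ... | no other | p , d , lg with just-injective (trans (sym (proj₁ (Legit.obliged lg other))) eq)
  ...   | refl with Local.decided lo d | Local.fresh lo refl
  ...     | inj₁ lt       | _ = ℕₚ.<-irrefl refl lt
  ...     | inj₂ (_ , le) | _ , refl = ℕₚ.<⇒≱ (legit<noExit lg) le

  -- The process votes as the plan wants. If it is in the last batch of `C` and decides the first
  -- exit of `F`, it casts that vote, which moves the exit from `F` to `C`. In all other cases it
  -- passes, which is allowed since `must` names nobody but that decider.
  vote-heading : ∀ {ℓ*} {D : Chain ℓ₀ ℓ*} {H ch q ℓ c v b m σ μ} → (∀ {p} → p ≢ q → Proper H p (μ p)) →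
                 Heading D H ch q (state ℓ c v b) m σ μ →
                 ∃ λ v′ → Voting q (state ℓ c v b) (state ℓ c v′ true) × Heading D H ch q (state ℓ c v′ true) m σ μ
  vote-heading {b = true} pr hd = _ , already , hd
  vote-heading {q = q} {b = false} {m} pr (heading C F joined fin g lo ws los wos) with m ℕₚ.≟ len C
  ... | no ne = noExit , now (pass (subst (λ ℓ → must ℓ ≢ just q) (Local.lab≡ lo) not-obliged)) ,
        heading C F joined fin g (pass-self (λ _ → not-obliged) lo) (λ _ eq → contradiction eq ne) los wos
    where
    not-obliged : must (lab C m) ≢ just q
    not-obliged = unobliged lo (ℕₚ.≤∧≢⇒< (Local.m≤len lo) ne)
  vote-heading {q = q} {ℓ} {b = false} {m} pr (heading C [] joined fin g lo ws los wos) | yes refl =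
    noExit , now (pass (subst (λ ℓ → must ℓ ≢ just q) (Local.lab≡ lo) not-obliged)) ,
    heading C [] joined fin g (pass-self (λ _ → not-obliged) lo) (λ ()) los wos
    where
    not-obliged : must (lab C (len C)) ≢ just q
    not-obliged eq = contradiction (trans (sym eq) (trans (cong must (lab-len C)) (proj₂ fin))) λ ()
  vote-heading {q = q} {b = false} {m} {μ = μ} pr (heading C (ext w p lg F) joined fin g lo ws los wos) | yes refl with q Fin.≟ p
  ... | no ne = noExit , now (pass (subst (λ ℓ → must ℓ ≢ just q) (Local.lab≡ lo) not-obliged)) ,
        heading C (ext w p lg F) joined fin g (pass-self (λ _ → not-obliged) lo) (λ eq _ → contradiction eq ne) los wos
    where
    not-obliged : must (lab C (len C)) ≢ just q
    not-obliged eq with lab C (len C) Fin.≟ ℓ₀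
    ... | yes root = contradiction (trans (sym eq) (trans (cong must root) must₀)) λ ()
    ... | no other = ne (sym (just-injective (trans (sym (proj₁ (Legit.obliged lg λ root → other (trans (lab-len C) root))))
                       (trans (cong must (sym (lab-len C))) eq))))
  ... | yes refl = w , now (cast (subst (λ ℓ → Legit ℓ w q) (trans (sym (lab-len C)) (Local.lab≡ lo)) lg) (_ , F , fin)) ,
        heading (C ⊕ ext w q lg []) F (trans (⊕-assoc C (ext w q lg []) F) joined) fin
          recut-global (recut-self lo lg′)
          (λ _ eq → contradiction (trans eq (Cuts.len-cut cuts)) λ m≡ → ℕₚ.1+n≢n (sym m≡))
          (λ ne → recut-other ne (pr ne) (los ne))
          (λ ne _ eq → contradiction (Local.m≤len (los ne)) (ℕₚ.<⇒≱ (ℕₚ.≤-reflexive (sym (trans eq (Cuts.len-cut cuts))))))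
    where
    cuts = extend-cuts C lg
    lg′ : Legit (lab C (len C)) w q
    lg′ = subst (λ ℓ → Legit ℓ w q) (sym (lab-len C)) lg
    lt : toℕ w < toℕ (exit C (len C))
    lt = subst (λ u → toℕ w < toℕ u) (sym (exit-len C)) (legit<noExit lg)
    open Recut g cuts ℕₚ.≤-refl (ℕₚ.<⇒≤ lt) (none-beyond g lo lg′ lt) (unvoted-none lo)

  record Enabled {ℓ*} (D : Chain ℓ₀ ℓ*) (H : History) (x : HEvent) : Set where
    field
      in-D     : In D x
      not-done : ¬ Done H x
      preds    : ∀ {y} → In D y → HEdge y x → Done H y

  module _ {ℓ* mid} (C : Chain ℓ₀ mid) (F : Chain mid ℓ*) {H ch} (g : Global C H ch) {n e} (en : Enabled (C ⊕ F) H (n , e)) where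
    open Enabled en
    open Global g

    predecessor-done : ∀ {i f} → n ≤ len C → In C (i , f) → proc f ≡ proc e → i < n ⊎ (i ≡ n × coord f < coord e) → Done H (i , f)
    predecessor-done n≤ inf pf (inj₁ i<n) =
      preds (in-extend C F (λ { refl → contradiction n≤ (ℕₚ.<⇒≱ i<n) }) inf) (inj₂ (i<n , pf))
    predecessor-done {f = f} n≤ inf pf (inj₂ (refl , lt)) =
      preds (in-extend C F (λ _ → ℕₚ.≤-<-trans (coord≤⇒idx≤ f e (ℕₚ.<⇒≤ lt)) (before in-D)) inf) (inj₁ (refl , inj₂ (pf , lt)))

    module _ {σ : Fin np → State} {μ : Fin np → ℕ} {ℓ c v m} (lo : Local C H (proc e) (state ℓ c v true) m) (fin : Final ℓ*)
             (ws : ¬ (Decides F 0 (proc e) × m ≡ len C))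
             (los : ∀ {p} → p ≢ proc e → Local C H p (σ p) (μ p))
             (wos : ∀ {p} → p ≢ proc e → Decides F 0 p → μ p ≡ len C → voted (σ p) ≡ false) where

      -- The decider of the first exit of F does not wait any more, as the next event is causally after it.
      batch-committed : n ≤ len C
      batch-committed with n ≤? len C
      ... | yes le = le
      ... | no ¬le = ⊥-elim (beyond (ℕₚ.≰⇒> ¬le))
        where
        is-send : len C < n → kind e ≡ send
        is-send lt with kind e in eq
        ... | send    = refl
        ... | receive = contradiction (batch≤ (h-in (preds (in-partner in-D) (inj₁ (refl , inj₁ (kind-partner-receive e eq , partner-involutive e))))))
                          (ℕₚ.<⇒≱ lt)

        beyond : len C < n → ⊥
        beyond lt = from n refl lt
          where
          from : ∀ i → i ≡ n → len C < i → ⊥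
          from (suc i) refl (s≤s C≤i) with legitAt (C ⊕ F) (batch≤ in-D)
          ... | p , d , lg with Legit.informs lg _ (triggers-next lg lg ℕₚ.≤-refl
                  (subst (λ ℓ → First (path ℓ) (proc e) e) (lab-suc (C ⊕ F) (batch≤ in-D))
                    (on-path in-D , refl , λ f vf pf → ℕₚ.≮⇒≥ λ lt′ → ℕₚ.<⇒≱ lt (batch≤ (h-in (preds
                      (inside (batch≤ in-D) vf (ℕₚ.≤-<-trans (coord≤⇒idx≤ f e (ℕₚ.<⇒≤ lt′)) (before in-D)))
                      (inj₁ (refl , inj₂ (pf , lt′))))))))
                  (is-send lt) (λ _ _ _ κ≤ → ℕₚ.≤⇒≯ κ≤))
          -- A local choice in `ℓ₀`: the decider of the exit is the process of `e` itself. It is in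
          -- batch 0 and has voted, so `F` cannot be waiting for it.
          ...   | inj₂ (root , refl) with lab-root⇒0 (C ⊕ F) (ℕₚ.<⇒≤ (batch≤ in-D)) root
          ...     | refl with ℕₚ.n≤0⇒n≡0 C≤i
          ...       | C≡0 = ws (decides-⊕ C F (subst (λ j → Decides (C ⊕ F) j (proc e)) (sym C≡0) d) ,
                              trans (ℕₚ.n≤0⇒n≡0 (subst (m ≤_) C≡0 (Local.m≤len lo))) (sym C≡0))
          from (suc i) refl (s≤s C≤i) | p , d , lg | inj₁ (f₀ , f , _ , vf , p₀ , pf , le) with ‼-take⁻ (cutoff (exit (C ⊕ F) i)) (path (lab (C ⊕ F) i)) (at vf)
          ... | f< , eq with preds (inside (ℕₚ.<⇒≤ (batch≤ in-D)) (valid eq) f<) (inj₂ (ℕₚ.≤-refl , pf))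
          ...   | u , f∈ with ℕₚ.≤-antisym (batch≤ (h-in (u , f∈))) C≤i
          ...     | refl with done-⊑ g {κ = cutoff (exit (C ⊕ F) (len C))} ℕₚ.≤-refl small
                           (subst (λ ℓ → f₀ ⊑⟨ take (cutoff (exit (C ⊕ F) (len C))) (path ℓ) ⟩ f) (lab-⊕ C F ℕₚ.≤-refl) le) f∈
            where
            small : cutoff (exit (C ⊕ F) (len C)) ≤ cutoff (exit C (len C))
            small = cutoff-mono {exit (C ⊕ F) (len C)} {exit C (len C)} (subst (exit (C ⊕ F) (len C) ≤ᵛ_) (sym (exit-len C)) (ℕₚ.<⇒≤ (legit<noExit lg)))
          ...       | _ , f₀∈ , _ with p Fin.≟ proc e
          ...         | yes refl = contradiction (Local.done⇒ lo (_ , f₀∈) p₀) λ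
                          { (inj₁ lt′) → ℕₚ.<⇒≱ lt′ (Local.m≤len lo) ; (inj₂ (eq′ , _)) → ws (decides-⊕ C F d , sym eq′) }
          ...         | no ne = contradiction (Local.done⇒ (los ne) (_ , f₀∈) p₀) λ
                          { (inj₁ lt′) → ℕₚ.<⇒≱ lt′ (Local.m≤len (los ne))
                          ; (inj₂ (eq′ , lt′)) → contradiction (subst (coord f₀ <_)
                              (proj₁ (Local.fresh (los ne) (wos ne (decides-⊕ C F d) (sym eq′)))) lt′) λ () }

    next-own : ∀ {ℓ c v} → n ≤ len C → Local C H (proc e) (state ℓ c v true) n → Next (proc e) ℓ c e × In C (n , e)
    next-own {c = c} n≤ lo with Local.lab≡ lo
    ... | refl = next (on-path ine) refl
            (ℕₚ.≮⇒≥ λ lt → not-done (Local.⇒done lo ine refl (inj₂ (refl , lt))))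
            (λ f vf pf lt → own (Local.done⇒ lo (predecessor-done n≤ (inside n≤ vf (ℕₚ.≤-<-trans (coord≤⇒idx≤ f e (ℕₚ.<⇒≤ lt)) (before ine))) pf (inj₂ (refl , lt))) pf)) ,
          ine
      where
      ine : In C (n , e)
      ine = in-restrict C F n≤ in-D
      own : ∀ {a} → n < n ⊎ (n ≡ n × a < c) → a < c
      own (inj₁ lt)       = contradiction lt (ℕₚ.<-irrefl refl)
      own (inj₂ (_ , lt)) = lt

    module Ahead {s m} (lo : Local C H (proc e) s m) (n≤ : n ≤ len C) (m<n : m < n) where

      ine : In C (n , e)
      ine = in-restrict C F n≤ in-D

      same-batch : ∀ {i f} → In C (i , f) → proc f ≡ proc e → i < n → i < m ⊎ (i ≡ m × coord f < count s)
      same-batch inf pf i<n = Local.done⇒ lo (predecessor-done n≤ inf pf (inj₁ i<n)) pf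

      entered : Local C H (proc e) (state (lab C n) 0 noExit false) n
      entered = enter-batch g lo m<n n≤ (e , on-path ine , refl) λ inf pf i<n → predecessor-done n≤ inf pf (inj₁ i<n)

      first-event : First (path (lab C n)) (proc e) e
      first-event = on-path ine , refl , λ f vf pf → ℕₚ.≮⇒≥ λ lt → late (Local.done⇒ lo (predecessor-done n≤
        (inside n≤ vf (ℕₚ.≤-<-trans (coord≤⇒idx≤ f e (ℕₚ.<⇒≤ lt)) (before ine))) pf (inj₂ (refl , lt))) pf)
        where
        late : ∀ {A : Set} → ¬ (n < m ⊎ (n ≡ m × A))
        late (inj₁ lt)         = ℕₚ.<-asym lt m<n
        late (inj₂ (refl , _)) = ℕₚ.<-irrefl refl m<n

      done-below : DoneBelow (proc e) (lab C m) (cutoff (exit C m)) (count s)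
      done-below f vf pf lt with same-batch (inside (Local.m≤len lo) vf lt) pf m<n
      ... | inj₁ lt′       = contradiction lt′ (ℕₚ.<-irrefl refl)
      ... | inj₂ (_ , lt′) = lt′

      -- The first send in batch `n` makes its process a trigger of the exit before `n`. So it has
      -- an event in the batch right before `n`, or that batch is `ℓ₀`; either way `m` is that
      -- batch, and `knows-exit` applies.
      send-knows : kind e ≡ send → n ≡ suc m × vote s ≡ exit C m
      send-knows ke = from n refl m<n
        where
        from : ∀ i → i ≡ n → m < i → n ≡ suc m × vote s ≡ exit C m
        from (suc i) refl (s≤s m≤i) with legitAt C n≤
        ... | p , d , _ = known (ℕₚ.≤-antisym m≤i i≤m)
          where
          tr : Triggers G (Legit.node (decides⇒legit C d)) (proc e)
          tr = triggers-next (decides⇒legit C d) (decides⇒legit C d) ℕₚ.≤-refl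
                 (subst (λ ℓ → First (path ℓ) (proc e) e) (lab-suc C n≤) first-event) ke (λ _ _ _ κ≤ → ℕₚ.≤⇒≯ κ≤)
          i≤m : i ≤ m
          i≤m with Legit.informs (decides⇒legit C d) _ tr
          ... | inj₂ (root , _) = subst (_≤ m) (sym (lab-root⇒0 C (ℕₚ.<⇒≤ n≤) root)) z≤n
          ... | inj₁ (_ , f , _ , vf , _ , pf , _) with same-batch (in-take g (ℕₚ.<⇒≤ n≤) ℕₚ.≤-refl vf) pf ℕₚ.≤-refl
          ...   | inj₁ lt         = ℕₚ.<⇒≤ lt
          ...   | inj₂ (refl , _) = ℕₚ.≤-refl
          known : m ≡ i → suc i ≡ suc m × vote s ≡ exit C m
          known refl = refl , ≤ᵛ-antisym (knows-exit g lo d done-below tr) (Local.low lo)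

      send-jumps : kind e ≡ send → voted s ≡ true → SendJump (proc e) s (state (lab C n) 0 noExit false)
      send-jumps ke refl with Local.lab≡ lo | send-knows ke
      ... | refl | refl , refl = subst (λ ℓ → SendJump (proc e) s (state ℓ 0 noExit false)) (sym (lab-suc C n≤))
              (send-jump (λ eq → ℕₚ.<-irrefl (cong toℕ eq) (legit<noExit (proj₂ (proj₂ (legitAt C n≤))))) done-below
                (subst (λ ℓ → First (path ℓ) (proc e) e) (lab-suc C n≤) first-event) ke)

      -- A batch strictly between `m` and `n` with an event of the process would contain an
      -- unfinished predecessor of `e`. So by `last-entry` the promise pending in `n` is that of
      -- `m`, and `e` keeps it.
      receive-jumps : kind e ≡ receive → ReceiveJump (proc e) (proc (partner e)) (lab C n) e s (state (lab C n) 0 noExit false)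
      receive-jumps ke = from n refl m<n
        where
        started : m ≡ 0 ⊎ Takes (path (lab C m)) (proc e)
        started with zero? m
        ... | inj₁ m≡0 = inj₁ m≡0
        ... | inj₂ 0<m = inj₂ (Local.takes lo 0<m)
        from : ∀ i → i ≡ n → m < i → ReceiveJump (proc e) (proc (partner e)) (lab C n) e s (state (lab C n) 0 noExit false)
        from (suc i) refl _ with last-entry C (proc e) m<n n≤ started
        ... | inj₂ (o , m<o , o<n , (f , vf , pf) , _) = contradiction (same-batch (in-other C o≤ (other o m<o o≤) vf) pf o<n) λ
                { (inj₁ lt) → ℕₚ.<-asym lt m<o ; (inj₂ (refl , _)) → ℕₚ.<-irrefl refl m<o }
          where
          o≤ : o ≤ len C
          o≤ = ℕₚ.≤-trans (ℕₚ.<⇒≤ o<n) n≤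
          other : ∀ o → m < o → o ≤ len C → lab C o ≢ ℓ₀
          other (suc o) _ o≤ = lab-other C o≤
        ... | inj₁ (_ , eq) with Local.lab≡ lo
        ...   | refl = receive-jump eq (promised kept) (lab-other C n≤) done-below first-event ke refl
          where
          kept : Keeps (lab C (suc i)) (proc e) e
          kept = subst (λ ℓ → Keeps ℓ (proc e) e) (sym (lab-suc C n≤))
                   (Legit.kept (proj₂ (proj₂ (legitAt C n≤))) (proc e) e (subst (λ ℓ → First (path ℓ) (proc e) e) (lab-suc C n≤) first-event))
          promised : Keeps (lab C (suc i)) (proc e) e →
                     promise (lab C m) (proc e) ≡ nothing ⊎ promise (lab C m) (proc e) ≡ just (proc (partner e))
          promised (inj₁ none) = inj₁ (trans (sym (cong proj₁ eq)) none)
          promised (inj₂ some) = inj₂ (trans (sym (cong proj₁ eq)) (trans some (cong (λ κ → just (awaited κ (proc e) (proc (partner e)))) ke)))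

    -- A message ahead of that of `e` in the channel would, by `fifo` or by its smaller batch
    -- number, have its receive before `e` on the same process. That receive is a predecessor of
    -- `e`, hence done.
    message-ready : n ≤ len C → kind e ≡ receive → ∃ λ l → ∃ λ d → ∃ λ ds → ∃ λ w → ch (proc (partner e)) (proc e) ≡ (l , d) ∷ ds ×
                    l ≡ label e × control d ≡ (lab C n , coord e , w) × ((n , partner e) , w) ∈ H
    message-ready n≤ ke with preds (in-partner in-D) (inj₁ (refl , inj₁ (kind-partner-receive e ke , partner-involutive e)))
    ... | w , s∈ with ch (proc (partner e)) (proc e) | channel (proc (partner e)) (proc e)
    ...   | ds | record { pending = ps ; carried = cs ; sorted = ss ; sound = so ; complete = co }
      with co s∈ (kind-partner-receive e ke) refl (cong proc (partner-involutive e))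
             (λ d → not-done (subst (λ f → Done H (n , f)) (partner-involutive e) d))
    message-ready n≤ ke | w , s∈ | (l , d) ∷ ds | record { carried = (l≡ , d≡) ∷ cs } | here refl =
      l , d , ds , w , refl , trans l≡ (label-partner e) , trans d≡ (cong (λ f → lab C n , coord f , w) (partner-involutive e)) , s∈
    message-ready n≤ ke | w , s∈ | _ ∷ ds | record { pending = ((i , f) , u) ∷ ps ; sorted = lt ∷ _ ; sound = so } | there s∈′ with so (here refl)
    ... | f∈ , kf , pf , pp , nd = contradiction (predecessor-done n≤ (in-partner (h-in (u , f∈))) pp (earlier (All.lookup lt s∈′))) nd
      where
      earlier : i < n ⊎ (i ≡ n × coord f < coord (partner e)) → i < n ⊎ (i ≡ n × coord (partner f) < coord e)
      earlier (inj₁ lt)          = inj₁ lt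
      earlier (inj₂ (refl , lt)) = inj₂ (refl , subst (λ f′ → coord (partner f) < coord f′) (partner-involutive e)
        (fifo (on-path (h-in (u , f∈))) (on-path (h-in (w , s∈))) kf (kind-partner-receive e ke) pf
          (trans pp (sym (cong proc (partner-involutive e)))) lt))

  final₀ : Final ℓ₀
  final₀ = subst₂ (λ a b → Walk a b (path ℓ₀)) (sym start₀) end₀ (consecutive⇒walk path₀) , must₀

  Waits : ∀ {ℓ ℓ′ mid} → Chain ℓ mid → Chain mid ℓ′ → Fin np → ℕ → State → Set
  Waits C F q m s = Decides F 0 q → m ≡ len C → voted s ≡ false

  record Toward {ℓ*} (D : Chain ℓ₀ ℓ*) (H : History) (c : Conf) : Set where
    constructor toward
    field
      {mid}    : Fin NL
      C        : Chain ℓ₀ mid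
      F        : Chain mid ℓ*
      joined   : C ⊕ F ≡ D
      fin      : Final ℓ*
      global   : Global C H (ch c)
      stations : ∀ q → ∃ λ m → Local C H q (stateOf c q) m × Proper H q m × Waits C F q m (stateOf c q)

  setState : Conf → Fin np → Fin states → Fin np → Fin states
  setState c p i r with r Fin.≟ p
  ... | yes _ = i
  ... | no _  = st c r

  setState-here : ∀ c p i → setState c p i p ≡ i
  setState-here c p i with p Fin.≟ p
  ... | yes _ = refl
  ... | no ne = contradiction refl ne

  setState-other : ∀ c p i r → r ≢ p → setState c p i r ≡ st c r
  setState-other c p i r ne with r Fin.≟ p
  ... | yes eq = contradiction eq ne
  ... | no _   = refl

  setChannel : Conf → Fin np → Fin np → List (Fin nc × Fin controls) → Channels
  setChannel c p q ds r r′ with (r Fin.≟ p) ×-dec (r′ Fin.≟ q)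
  ... | yes _ = ds
  ... | no _  = ch c r r′

  setChannel-here : ∀ c p q ds → setChannel c p q ds p q ≡ ds
  setChannel-here c p q ds with (p Fin.≟ p) ×-dec (q Fin.≟ q)
  ... | yes _ = refl
  ... | no ne = contradiction (refl , refl) ne

  setChannel-other : ∀ c p q ds r r′ → ¬ (r ≡ p × r′ ≡ q) → ch c r r′ ≡ setChannel c p q ds r r′
  setChannel-other c p q ds r r′ ne with (r Fin.≟ p) ×-dec (r′ Fin.≟ q)
  ... | yes eq = contradiction eq ne
  ... | no _   = refl

  module _ {ℓ*} {D : Chain ℓ₀ ℓ*} {H : History} {c : Conf} {n : ℕ} {e : Event} (en : Enabled D H (n , e)) (μ : Fin np → ℕ)
           (pr : ∀ {p} → p ≢ proc e → Proper H p (μ p)) where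

    Advance : Set
    Advance = ∃ λ a → ∃ λ c′ → ∃ λ v → Step machine c a c′ × h a ≡ letterOf e × Toward D (((n , e) , v) ∷ H) c′

    private
      Heading′ : State → ℕ → Set
      Heading′ s m = Heading D H (ch c) (proc e) s m (stateOf c) μ

    perform-send : ∀ {ℓ cn v} → kind e ≡ send → Heading′ (state ℓ cn v true) n →
      (∀ {x s′} → OwnSend (proc e) (state ℓ cn v true) e x s′ → SendStep (proc e) (stateOf c (proc e)) e x s′) → Advance
    perform-send {ℓ} {cn} {v} ke (heading C F refl fin g lo ws los wos) route with next-own C F g en (Local.m≤len lo) lo
    ... | nx , ine with encodeControl ℓ (ℕₚ.m<n⇒m<1+n (coord<K {ℓ} {partner e} (valid (at (Next.is-valid nx))))) v
                      | encode (state ℓ (suc (coord e)) v true) (s≤s (coord<K {ℓ} {e} (Next.is-valid nx)))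
    ...   | d , d≡ | i , i≡ = snd (proc e) (proc (partner e)) (label e , d) , c′ , v ,
            ( (refl , e , subst₂ (SendStep (proc e) (stateOf c (proc e)) e) (sym d≡) (sym state≡) (route (own-send nx ke small)) , refl , refl)
            , setState-other c (proc e) i , setChannel-here c (proc e) (proc (partner e)) _
            , λ r r′ ne → sym (setChannel-other c _ _ _ r r′ ne)) ,
            sym (letterOf-send e ke) ,
            toward C F refl fin
              (add-global (send-channels {ch c′} (trans d≡ (cong (λ ℓ → ℓ , _ , _) (sym (Local.lab≡ lo))))
                (setChannel-here c (proc e) (proc (partner e)) _) (setChannel-other c _ _ _)))
              (update-all {c} {c′} (λ q s → ∃ λ m → Local C H′ q s m × Proper H′ q m × Waits C F q m s) state≡ (setState-other c (proc e) i)
                (n , add-self , (λ _ → e , (_ , here refl) , refl) , ws)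
                (λ ne → _ , add-other ne (los ne) , (λ 0< → let f , dn , pf = pr ne 0< in f , weaken dn , pf) , wos ne))
      where
      open Sent g lo nx ine ke
      c′ : Conf
      c′ = conf (setState c (proc e) i) (setChannel c (proc e) (proc (partner e)) (ch c (proc e) (proc (partner e)) ++ [ label e , d ]))
      state≡ : stateOf c′ (proc e) ≡ state ℓ (suc (coord e)) v true
      state≡ = trans (cong decode (setState-here c (proc e) i)) i≡
      small : idx e < cutoff v
      small = ℕₚ.<-≤-trans (before ine) (cutoff-mono {exit C n} (Local.low lo))

    perform-receive : ∀ {ℓ cn v} → kind e ≡ receive → Heading′ (state ℓ cn v true) n →
      (∀ {x s′} → OwnReceive (proc e) (state ℓ cn v true) e x s′ → ReceiveStep (proc e) (stateOf c (proc e)) e x s′) → Advance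
    perform-receive {ℓ} {cn} {v} ke (heading C F refl fin g lo ws los wos) route
      with next-own C F g en (Local.m≤len lo) lo | message-ready C F g en (Local.m≤len lo) ke
    ... | nx , ine | l , d , ds , w , ch≡ , refl , d≡ , _
      with encode (state ℓ (suc (coord e)) (v ⊓ᵛ w) true) (s≤s (coord<K {ℓ} {e} (Next.is-valid nx)))
    ...   | i , i≡ = rcv (proc e) (proc (partner e)) (label e , d) , c′ , v ⊓ᵛ w ,
            ( (refl , e , subst₂ (ReceiveStep (proc e) (stateOf c (proc e)) e) (sym d≡′) (sym state≡) (route (own-receive nx ke)) , refl , refl)
            , setState-other c (proc e) i , trans ch≡ (cong (_ ∷_) (sym (setChannel-here c (proc (partner e)) (proc e) ds)))
            , λ r r′ ne → sym (setChannel-other c _ _ _ r r′ ne)) ,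
            sym (letterOf-receive e ke) ,
            toward C F refl fin
              (add-global (receive-channels {ch c′} (trans ch≡ (cong (_ ∷_) (sym (setChannel-here c (proc (partner e)) (proc e) ds))))
                (setChannel-here c (proc (partner e)) (proc e) ds) (setChannel-other c _ _ _)))
              (update-all {c} {c′} (λ q s → ∃ λ m → Local C H′ q s m × Proper H′ q m × Waits C F q m s) state≡ (setState-other c (proc e) i)
                (n , add-self , (λ _ → e , (_ , here refl) , refl) , ws)
                (λ ne → _ , add-other ne (los ne) , (λ 0< → let f , dn , pf = pr ne 0< in f , weaken dn , pf) , wos ne))
      where
      d≡′ : control d ≡ (ℓ , coord e , w)
      d≡′ = trans d≡ (cong (λ ℓ → ℓ , _ , _) (Local.lab≡ lo))
      hd = head g ch≡
      open Received g lo nx ine ke hd (proj₂ (own-receive-in g lo nx ke hd d≡′))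
      c′ : Conf
      c′ = conf (setState c (proc e) i) (setChannel c (proc (partner e)) (proc e) ds)
      state≡ : stateOf c′ (proc e) ≡ state ℓ (suc (coord e)) (v ⊓ᵛ w) true
      state≡ = trans (cong decode (setState-here c (proc e) i)) i≡

    -- In `perform` the vote comes before it is clear how the process moves, whereas the machine
    -- leaves a batch by a receive without voting in it. The jump is carried back to the state
    -- before the vote.
    rejump : ∀ {r ℓ′ ℓ cn v v′ b b′ s₂} → ReceiveJump (proc e) r ℓ′ e (state ℓ cn v b) s₂ → ReceiveJump (proc e) r ℓ′ e (state ℓ cn v′ b′) s₂
    rejump (receive-jump l p o d f k q) = receive-jump l p o d f k q

    perform : ∀ {s m} → s ≡ stateOf c (proc e) → Heading′ s m → Advance
    perform {state ℓ cn v b} {m} s≡ hd with vote-heading pr hd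
    ... | v₁ , vt , hd₁@(heading C F refl fin g lo ws los wos) with ℕₚ.<-cmp n m
      | batch-committed C F g en lo fin (λ (d , eq) → contradiction (ws d eq) λ ()) los wos
    ...   | tri< n<m _ _ | n≤ = contradiction (Local.⇒done lo (in-restrict C F n≤ (Enabled.in-D en)) refl (inj₁ n<m)) (Enabled.not-done en)
    ...   | tri≈ _ refl _ | n≤ = by-kind (kind e) refl
      where
      by-kind : ∀ κ → kind e ≡ κ → Advance
      by-kind send    ke = perform-send ke hd₁ λ own → subst (λ s → SendStep (proc e) s e _ _) s≡ (stay vt own)
      by-kind receive ke = perform-receive ke hd₁ λ own → subst (λ s → ReceiveStep (proc e) s e _ _) s≡ (stay vt own)
    ...   | tri> _ _ m<n | n≤ with vote-heading pr (heading C F refl fin g entered (λ _ _ → refl) los wos)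
      where open Ahead C F g en lo n≤ m<n
    ...     | v₂ , vt₂ , hd₂ = by-kind (kind e) refl
      where
      open Ahead C F g en lo n≤ m<n
      jumped : ∀ {x s₃ s′} → ReceiveJump (proc e) (proc (partner e)) (lab C n) e (state ℓ cn v b) (state (lab C n) 0 noExit false) →
               Voting (proc e) (state (lab C n) 0 noExit false) s₃ → batch s₃ ≡ lab C n → OwnReceive (proc e) s₃ e x s′ →
               ReceiveStep (proc e) (state ℓ cn v b) e x s′
      jumped j vt refl own@(own-receive _ _) = jump j vt own
      by-kind : ∀ κ → kind e ≡ κ → Advance
      by-kind send    ke = perform-send ke hd₂ λ own → subst (λ s → SendStep (proc e) s e _ _) s≡ (jump vt (send-jumps ke refl) vt₂ own)
      by-kind receive ke = perform-receive ke hd₂ λ own →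
        subst (λ s → ReceiveStep (proc e) s e _ _) s≡ (jumped (rejump (receive-jumps ke)) vt₂ refl own)

  progress : ∀ {ℓ*} {D : Chain ℓ₀ ℓ*} {H c n e} → Toward D H c → Enabled D H (n , e) →
             ∃ λ a → ∃ λ c′ → ∃ λ v → Step machine c a c′ × h a ≡ letterOf e × Toward D (((n , e) , v) ∷ H) c′
  progress {e = e} (toward C F joined fin g sts) en =
    perform en (λ p → proj₁ (sts p)) (λ {p} _ → proj₁ (proj₂ (proj₂ (sts p)))) refl
      (heading C F joined fin g (proj₁ (proj₂ (sts (proc e)))) (proj₂ (proj₂ (proj₂ (sts (proc e)))))
        (λ {p} _ → proj₁ (proj₂ (sts p))) (λ {p} _ → proj₂ (proj₂ (proj₂ (sts p)))))

  Executed : History → List HEvent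
  Executed = map proj₁

  executed⇒done : ∀ {H x} → x ∈ Executed H → Done H x
  executed⇒done x∈ with ∈ₚ.∈-map⁻ proj₁ x∈
  ... | (_ , v) , y∈ , refl = v , y∈

  done⇒executed : ∀ {H x} → Done H x → x ∈ Executed H
  done⇒executed (_ , x∈) = ∈ₚ.∈-map⁺ proj₁ x∈

  data Schedule {ℓ*} (D : Chain ℓ₀ ℓ*) (X : List HEvent) : List HEvent → Set where
    []  : (∀ {x} → In D x → x ∈ X) → Schedule D X []
    add : ∀ {x es} → In D x → x ∉ X → (∀ {y} → In D y → HEdge y x → y ∈ X) → Schedule D (x ∷ X) es → Schedule D X (x ∷ es)

  execute : ∀ {ℓ*} {D : Chain ℓ₀ ℓ*} {H c es} → Toward D H c → Schedule D (Executed H) es →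
            ∃ λ w → ∃ λ c′ → ∃ λ H′ → Run machine c w c′ × map h w ≡ map (letterOf ∘ proj₂) es × Toward D H′ c′ × (∀ {x} → In D x → Done H′ x)
  execute tw ([] all) = [] , _ , _ , done , refl , tw , λ i → executed⇒done (all i)
  execute tw (add i x∉ ps sch) with progress tw (record { in-D = i ; not-done = λ d → x∉ (done⇒executed d) ; preds = λ iy ed → executed⇒done (ps iy ed) })
  ... | a , c′ , v , stp , a≡ , tw′ with execute tw′ sch
  ...   | w , c″ , H″ , run , w≡ , tw″ , all = a ∷ w , c″ , H″ , step stp run , cong₂ _∷_ a≡ w≡ , tw″ , all

  -- Acceptance

  decides-unique : ∀ {ℓ ℓ′} (C : Chain ℓ ℓ′) {m p q} → Decides C m p → Decides C m q → p ≡ q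
  decides-unique (ext _ _ _ C) {zero}  refl refl = refl
  decides-unique (ext _ _ _ C) {suc m} d    d′   = decides-unique C d d′

  decides-⊕⁺ : ∀ {ℓ ℓ₁ ℓ₂} (C : Chain ℓ ℓ₁) (F : Chain ℓ₁ ℓ₂) {p} → Decides F 0 p → Decides (C ⊕ F) (len C) p
  decides-⊕⁺ []            F d = d
  decides-⊕⁺ (ext _ _ _ C) F d = decides-⊕⁺ C F d

  module _ {ℓ*} {D : Chain ℓ₀ ℓ*} {H ch} (fin : Final ℓ*) (g : Global D H ch) (all : ∀ {x} → In D x → Done H x) where

    settled-send : ∀ {q s m e x s′} → Local D H q s m → ¬ OwnSend q s e x s′
    settled-send lo (own-send nx ke lt) with Local.done⇒ lo (all (own-send-in g lo nx ke lt)) (Next.is-proc nx)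
    ... | inj₁ lt′       = ℕₚ.<-irrefl refl lt′
    ... | inj₂ (_ , lt′) = ℕₚ.<⇒≱ lt′ (Next.not-done nx)

    settled-jump : ∀ {q s m s′} → Local D H q s m → ¬ SendJump q s s′
    settled-jump lo (send-jump {e = e} ne dn fe@(ve , pe , _) ke) with send-jump-in g lo ne dn fe ke
    ... | m< , refl with Local.done⇒ lo (all (in-other D m< (lab-other D m<) (subst (λ ℓ → Valid (path ℓ) e) (sym (lab-suc D m<)) ve))) pe
    ...   | inj₁ lt       = ℕₚ.<-asym lt ℕₚ.≤-refl
    ...   | inj₂ (eq , _) = ℕₚ.1+n≢n eq

    settled-vote : ∀ {q s m} → Local D H q s m → ∃ λ s₁ → Voting q s s₁ × Local D H q s₁ m
    settled-vote {s = state ℓ c v true} lo = _ , already , lo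
    settled-vote {q} {state ℓ c v false} {m} lo = _ , now (pass (subst (λ ℓ → must ℓ ≢ just q) (Local.lab≡ lo) not-obliged)) , pass-self (λ _ → not-obliged) lo
      where
      not-obliged : must (lab D m) ≢ just q
      not-obliged eq with ℕₚ.m≤n⇒m<n∨m≡n (Local.m≤len lo)
      ... | inj₁ m<   = unobliged lo m< eq
      ... | inj₂ refl = contradiction (trans (sym eq) (trans (cong must (lab-len D)) (proj₂ fin))) λ ()

    settled-accepts : ∀ {q s m} → Local D H q s m → Accepts q s
    settled-accepts lo with settled-vote lo
    ... | s₁ , vt , lo₁ = s₁ , vt , settled-send lo₁ , settled-jump lo₁

    settled-channels : ∀ p q → ch p q ≡ []
    settled-channels p q with ch p q in eq
    ... | []     = refl
    ... | a ∷ ds with Head.sound (head g {p} {q} eq) (here refl)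
    ...   | x∈ , _ , _ , _ , nd = contradiction (all (in-partner (Global.h-in g (_ , x∈)))) nd

  -- The decider of a batch other than `ℓ₀` takes part in that batch, so it has voted once all
  -- events are done. Only an exit from `ℓ₀` can still be undecided then.
  still-waiting-root : ∀ {mid ℓ*} (C : Chain ℓ₀ mid) {v p} (lg : Legit mid v p) (F : Chain (target v) ℓ*) {H s m} →
    (∀ {x} → In (C ⊕ ext v p lg F) x → Done H x) → Local C H p s m → (m ≡ len C → voted s ≡ false) →
    len C ≡ 0 × m ≡ len C × voted s ≡ false
  still-waiting-root {mid} C {v} {p} lg F {m = m} all lo ws with mid Fin.≟ ℓ₀
  ... | yes root = C≡0 , m≡ , ws m≡
    where
    C≡0 : len C ≡ 0
    C≡0 = lab-root⇒0 C ℕₚ.≤-refl (trans (lab-len C) root)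
    m≡ : m ≡ len C
    m≡ = trans (ℕₚ.n≤0⇒n≡0 (subst (m ≤_) C≡0 (Local.m≤len lo))) (sym C≡0)
  ... | no other with proj₂ (Legit.obliged lg other)
  ...   | e , ve , pe with Local.done⇒ lo (all {len C , e} (in-extend C (ext v p lg F)
            (λ _ → subst (λ w → idx e < cutoff w) (sym (exit-⊕ C (ext v p lg F))) (subst (idx e <_) (sym (Legit.full lg other)) (‼-< (path mid) (at ve))))
            (in-noExit C refl (subst (λ ℓ → Valid (path ℓ) e) (sym (lab-len C)) ve)))) pe
  ...     | inj₁ lt = contradiction (Local.m≤len lo) (ℕₚ.<⇒≱ lt)
  ...     | inj₂ (refl , lt) = contradiction (subst (coord e <_) (proj₁ (Local.fresh lo (ws refl))) lt) λ ()

  -- If an exit from `ℓ₀` is undecided after all events, the vote in `Accepts` of its decider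
  -- settles it. No further exit can be undecided afterwards: it would again be an exit from `ℓ₀`,
  -- whose decider has just voted.
  accept : ∀ {ℓ*} {D : Chain ℓ₀ ℓ*} {H c} → Toward D H c → (∀ {x} → In D x → Done H x) → Accepting machine c
  accept {H = H} {c} (toward C [] refl fin g sts) all =
    (λ q → settled-accepts fin g′ all (subst (λ E → Local E H q (stateOf c q) _) (sym (⊕-[] C)) (proj₁ (proj₂ (sts q))))) ,
    settled-channels fin g′ all
    where
    g′ : Global (C ⊕ []) H (ch c)
    g′ = subst (λ E → Global E H (ch c)) (sym (⊕-[] C)) g
  accept {H = H} {c} (toward C (ext v p lg F) refl fin g sts) all
    with still-waiting-root C lg F all (proj₁ (proj₂ (sts p))) (proj₂ (proj₂ (proj₂ (sts p))) refl)
       | vote-heading {μ = λ q → proj₁ (sts q)} (λ {q} _ → proj₁ (proj₂ (proj₂ (sts q))))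
           (heading {σ = stateOf c} C (ext v p lg F) refl fin g (proj₁ (proj₂ (sts p))) (proj₂ (proj₂ (proj₂ (sts p))))
             (λ {q} _ → proj₁ (proj₂ (sts q))) (λ {q} _ → proj₂ (proj₂ (proj₂ (sts q)))))
  ... | C≡0 , _ | _ , vt , heading C₁ (ext v₁ p₁ lg₁ F₁) joined fin₁ g₁ lo₁ ws₁ los₁ wos₁ = ⊥-elim absurd
    where
    all₁ : ∀ {x} → In (C₁ ⊕ ext v₁ p₁ lg₁ F₁) x → Done H x
    all₁ {x} = subst (λ E → In E x → Done H x) (sym joined) all
    absurd : ⊥
    absurd with p₁ Fin.≟ p
    ... | yes refl = contradiction (proj₂ (proj₂ (still-waiting-root C₁ lg₁ F₁ all₁ lo₁ (ws₁ refl)))) λ ()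
    ... | no ne with still-waiting-root C₁ lg₁ F₁ all₁ (los₁ ne) (wos₁ ne refl)
    ...   | C₁≡0 , _ = ne (decides-unique (C ⊕ ext v p lg F)
              (subst₂ (λ E m → Decides E m p₁) joined C₁≡0 (decides-⊕⁺ C₁ (ext v₁ p₁ lg₁ F₁) refl))
              (subst (λ m → Decides (C ⊕ ext v p lg F) m p) C≡0 (decides-⊕⁺ C (ext v p lg F) refl)))
  ... | C≡0 , _ | _ , vt , heading C₁ [] joined fin₁ g₁ lo₁ ws₁ los₁ wos₁ = finals , settled-channels fin₁ g₁ all₁
    where
    all₁ : ∀ {x} → In C₁ x → Done H x
    all₁ {x} = subst (λ E → In E x → Done H x) (trans (sym joined) (⊕-[] C₁)) all
    finals : ∀ q → Accepts q (stateOf c q)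
    finals q with q Fin.≟ p
    ... | yes refl = _ , vt , settled-send fin₁ g₁ all₁ lo₁ , settled-jump fin₁ g₁ all₁ lo₁
    ... | no ne    = settled-accepts fin₁ g₁ all₁ (los₁ ne)

  abstract

    hevents : ∀ {ℓ ℓ′} → Chain ℓ ℓ′ → List HEvent
    hevents C = concat (map (λ m → map (m ,_) (filter (λ e → idx e <? cutoff (exit C m)) (events (path (lab C m))))) (upTo (suc (len C))))

    ∈-hevents⁺ : ∀ {ℓ ℓ′} (C : Chain ℓ ℓ′) {x} → In C x → x ∈ hevents C
    ∈-hevents⁺ C {m , e} (inside m≤ v b) = ∈ₚ.∈-concat⁺′
      (∈ₚ.∈-map⁺ (m ,_) (∈ₚ.∈-filter⁺ (λ e → idx e <? cutoff (exit C m)) (∈-events⁺ v) b))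
      (∈ₚ.∈-map⁺ (λ m → map (m ,_) (filter (λ e → idx e <? cutoff (exit C m)) (events (path (lab C m))))) (∈ₚ.∈-upTo⁺ (s≤s m≤)))

    ∈-hevents⁻ : ∀ {ℓ ℓ′} (C : Chain ℓ ℓ′) {x} → x ∈ hevents C → In C x
    ∈-hevents⁻ C x∈ with ∈ₚ.∈-concat⁻′ (map (λ m → map (m ,_) (filter (λ e → idx e <? cutoff (exit C m)) (events (path (lab C m))))) (upTo (suc (len C)))) x∈
    ... | _ , x∈ys , ys∈ with ∈ₚ.∈-map⁻ (λ m → map (m ,_) (filter (λ e → idx e <? cutoff (exit C m)) (events (path (lab C m))))) ys∈
    ...   | m , m∈ , refl with ∈ₚ.∈-map⁻ (m ,_) x∈ys
    ...     | e , e∈ , refl with ∈ₚ.∈-filter⁻ (λ e → idx e <? cutoff (exit C m)) {xs = events (path (lab C m))} e∈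
    ...       | e∈′ , b = inside (ℕₚ.≤-pred (∈ₚ.∈-upTo⁻ m∈)) (∈-events⁻ e∈′) b

  _≟ᴴ_ : DecidableEquality HEvent
  _≟ᴴ_ = ≡-dec ℕₚ._≟_ _≟ᴱ_

  done? : ∀ H x → Dec (Done H x)
  done? H x with Any.any? (x ≟ᴴ_) (Executed H)
  ... | yes x∈ = yes (executed⇒done x∈)
  ... | no x∉  = no (x∉ ∘ done⇒executed)

  -- A minimal event that is not executed would be a send, which its process is able to perform.
  all-done : ∀ {ℓ₁} {C : Chain ℓ₀ ℓ₁} {H ch} {σ : Fin np → State} {μ : Fin np → ℕ} → Global C H ch → (∀ q → Local C H q (σ q) (μ q)) →
             (∀ p q → ch p q ≡ []) → (∀ q → voted (σ q) ≡ true) → (∀ q {e x s} → ¬ OwnSend q (σ q) e x s) →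
             (∀ q {s} → ¬ SendJump q (σ q) s) → ∀ {x} → In C x → Done H x
  all-done {C = C} {H} {ch} {σ} {μ} g lo empty vd no-send no-jump {x} ix with done? H x
  ... | yes d = d
  ... | no ¬d with hminimal C (filter (λ y → ¬? (done? H y)) (hevents C))
                     (λ y∈ → ∈-hevents⁻ C (proj₁ (∈ₚ.∈-filter⁻ (λ y → ¬? (done? H y)) {xs = hevents C} y∈)))
                     (∈ₚ.∈-filter⁺ (λ y → ¬? (done? H y)) (∈-hevents⁺ C ix) ¬d)
  ...   | (n , e) , e∈ , min with ∈ₚ.∈-filter⁻ (λ y → ¬? (done? H y)) {xs = hevents C} e∈
  ...     | e∈′ , nd = ⊥-elim (stuck (kind e) refl)
    where
    ine : In C (n , e)
    ine = ∈-hevents⁻ C e∈′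
    earlier : ∀ {y} → In C y → HEdge y (n , e) → Done H y
    earlier {y} iy ed with done? H y
    ... | yes d  = d
    ... | no ¬d′ = contradiction ed (min (∈ₚ.∈-filter⁺ (λ y → ¬? (done? H y)) (∈-hevents⁺ C iy) ¬d′))
    en : Enabled (C ⊕ []) H (n , e)
    en = subst (λ E → Enabled E H (n , e)) (sym (⊕-[] C)) (record { in-D = ine ; not-done = nd ; preds = earlier })
    sends : kind e ≡ send → ∀ {s m} → σ (proc e) ≡ s → μ (proc e) ≡ m → voted s ≡ true → ⊥
    sends ke {state ℓ c v true} {m} s≡ m≡ refl with ℕₚ.<-cmp n m
    ... | tri< n<m _ _ = nd (Local.⇒done (lo (proc e)) ine refl (inj₁ (subst (n <_) (sym m≡) n<m)))
    ... | tri≈ _ refl _ = no-send (proc e) (subst (λ s → OwnSend (proc e) s e (ℓ , coord (partner e) , v) (state ℓ (suc (coord e)) v true)) (sym s≡)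
            (own-send (proj₁ (next-own C [] g en (batch≤ ine) self)) ke
              (ℕₚ.<-≤-trans (before ine) (cutoff-mono {exit C n} {v} (Local.low self)))))
      where self : Local C H (proc e) (state ℓ c v true) n
            self = subst₂ (Local C H (proc e)) s≡ m≡ (lo (proc e))
    ... | tri> _ _ m<n = no-jump (proc e) (subst (λ s → SendJump (proc e) s (state (lab C n) 0 noExit false)) (sym s≡) (send-jumps ke refl))
      where self : Local C H (proc e) (state ℓ c v true) m
            self = subst₂ (Local C H (proc e)) s≡ m≡ (lo (proc e))
            open Ahead C [] g en self (batch≤ ine) m<n
    stuck : ∀ κ → kind e ≡ κ → ⊥
    stuck send    ke = sends ke refl refl (vd (proc e))
    stuck receive ke with message-ready C [] g en (batch≤ ine) ke
    ... | _ , _ , _ , _ , eq , _ with trans (sym (empty (proc (partner e)) (proc e))) eq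
    ...   | ()

  voting⇒voted : ∀ {q s s₁} → Voting q s s₁ → voted s₁ ≡ true
  voting⇒voted already = refl
  voting⇒voted (now _) = refl

  -- Acceptance supplies one vote for each process. These are performed one at a time in the order
  -- of the processes, as each of them may cut the chain that the next one has to refer to.
  module Silent {H : History} {c : Conf} (μ : Fin np → ℕ) (pr : ∀ q → Proper H q (μ q))
                (σ : Fin np → State) (vt : ∀ q → Voting q (stateOf c q) (σ q)) where

    mixed : ∀ {i : ℕ} (q : Fin np) → Dec (toℕ q < i) → State
    mixed q (yes _) = σ q
    mixed q (no _)  = stateOf c q

    record Stage (i : ℕ) : Set where
      field
        {mid}  : Fin NL
        C      : Chain ℓ₀ mid
        plan   : Plan mid
        global : Global C H (ch c)
        locals : ∀ q → Local C H q (mixed q (toℕ q <? i)) (μ q)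

    next-stage : ∀ {i} → i < np → Stage i → Stage (suc i)
    next-stage {i} i< sg = record { C = chain ; plan = World.plan w ; global = World.global w ; locals = local }
      where
      open Stage sg
      q = Fin.fromℕ< i<
      unmixed : ∀ (d : Dec (toℕ q < i)) → mixed q d ≡ stateOf c q
      unmixed (yes lt) = contradiction (subst (_< i) (Finₚ.toℕ-fromℕ< i<) lt) (ℕₚ.<-irrefl refl)
      unmixed (no _)   = refl
      w : World H (ch c) q (σ q) (μ q) (λ p → mixed p (toℕ p <? i)) μ
      w = vote-world (λ _ → pr _) (world C plan global (subst (λ s → Local C H q s (μ q)) (unmixed (toℕ q <? i)) (locals q)) (λ {p} _ → locals p)) (vt q)
      open World w using (chain)
      new : ∀ (d : Dec (toℕ q < suc i)) → Local chain H q (mixed q d) (μ q)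
      new (yes _) = World.self w
      new (no ¬lt) = contradiction (s≤s (ℕₚ.≤-reflexive (Finₚ.toℕ-fromℕ< i<))) ¬lt
      old : ∀ p → p ≢ q → (d : Dec (toℕ p < i)) → Local chain H p (mixed p d) (μ p) → (d′ : Dec (toℕ p < suc i)) → Local chain H p (mixed p d′) (μ p)
      old p ne (yes lt) lo (yes _)   = lo
      old p ne (yes lt) lo (no ¬lt)  = contradiction (ℕₚ.m≤n⇒m≤1+n lt) ¬lt
      old p ne (no ¬lt) lo (yes lt)  = contradiction (Finₚ.toℕ-injective (trans (ℕₚ.≤-antisym (ℕₚ.≤-pred lt) (ℕₚ.≮⇒≥ ¬lt)) (sym (Finₚ.toℕ-fromℕ< i<)))) ne
      old p ne (no ¬lt) lo (no _)    = lo
      local : ∀ p → Local chain H p (mixed p (toℕ p <? suc i)) (μ p)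
      local p with p Fin.≟ q
      ... | yes refl = new (toℕ q <? suc i)
      ... | no ne    = old p ne (toℕ p <? i) (World.others w ne) (toℕ p <? suc i)

    stage : Stage 0 → ∀ i → i ≤ np → Stage i
    stage s₀ zero    _ = s₀
    stage s₀ (suc i) l = next-stage l (stage s₀ i (ℕₚ.<⇒≤ l))

    mixed-all : ∀ q (d : Dec (toℕ q < np)) → mixed q d ≡ σ q
    mixed-all q (yes _) = refl
    mixed-all q (no ¬lt) = contradiction (Finₚ.toℕ<n q) ¬lt

  Complete : History → Conf → Set
  Complete H c = ∃ λ ℓ* → Σ (Chain ℓ₀ ℓ*) λ C → Final ℓ* × Global C H (ch c) × (∀ {x} → In C x → Done H x)

  -- After the silent votes all events of the chain are done, but the plan may still go on. In `ℓ₀`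
  -- this is harmless, since the default run itself reaches `sf`. In any other batch the decider has
  -- taken part and voted, which contradicts `free`.
  accepted : ∀ {H c} → Inv H c → Accepting machine c → Complete H c
  accepted {H} {c} (inv C₀ plan₀ g₀ ls) (fins , empty) = final-chain plan
    where
    vt : ∀ q → Voting q (stateOf c q) (proj₁ (fins q))
    vt q = proj₁ (proj₂ (fins q))
    open Silent {H} {c} (λ q → proj₁ (ls q)) (λ q → proj₂ (proj₂ (ls q))) (λ q → proj₁ (fins q)) vt
    all-voted : Stage np
    all-voted = stage (record { C = C₀ ; plan = plan₀ ; global = g₀ ; locals = λ q → proj₁ (proj₂ (ls q)) }) np ℕₚ.≤-refl
    open Stage all-voted
    local : ∀ q → Local C H q (proj₁ (fins q)) (proj₁ (ls q))
    local q = subst (λ s → Local C H q s _) (mixed-all q (toℕ q <? np)) (locals q)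
    all : ∀ {x} → In C x → Done H x
    all = all-done global local empty (λ q → voting⇒voted (vt q)) (λ q → proj₁ (proj₂ (proj₂ (fins q)))) (λ q → proj₂ (proj₂ (proj₂ (fins q))))
    final-chain : Plan mid → Complete H c
    final-chain (_ , [] , fin) = mid , C , fin , global , all
    final-chain (_ , ext v p lg F , fin) with mid Fin.≟ ℓ₀
    ... | yes root = mid , C , subst Final (sym root) final₀ , global , all
    ... | no other with Legit.obliged lg other
    ...   | must≡ , e , ve , pe with all (in-noExit C refl (subst (λ ℓ → Valid (path ℓ) e) (sym (lab-len C)) ve))
    ...     | d with Local.done⇒ (local p) d pe
    ...       | inj₁ lt = contradiction (Local.m≤len (local p)) (ℕₚ.<⇒≱ lt)
    ...       | inj₂ (eq , _) = contradiction (trans (cong must (trans (cong (lab C) (sym eq)) (lab-len C))) must≡)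
                  (Local.free (local p) (sym eq) (voting⇒voted (vt p)))

  initially : Global {ℓ₀} [] [] (λ _ _ → [])
  initially = record
    { h-in = λ { (_ , ()) } ; h-down = λ { (_ , ()) } ; h-order = [] ; v-low = λ () ; v-legit = λ () ; v-mono = λ () ; v-decider = λ ()
    ; channel = λ r q → record { pending = [] ; carried = [] ; sorted = [] ; sound = λ () ; complete = λ () } }

  local₀ : ∀ q → Local {ℓ₀} [] [] q (state ℓ₀ 0 noExit false) 0
  local₀ q = record
    { m≤len = z≤n ; lab≡ = refl ; done⇒ = λ { (_ , ()) } ; ⇒done = λ { _ _ (inj₁ ()) ; _ _ (inj₂ (_ , ())) } ; covered = λ _ _ ()
    ; fresh = λ _ → refl , refl ; low = ℕₚ.≤-refl ; below = λ () ; legit = inj₁ refl ; decided = λ () ; free = λ _ () ; takes = λ () }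

  start-inv : Inv [] (initConfig machine)
  start-inv = inv [] (_ , [] , final₀) initially λ q → 0 , subst (λ s → Local [] [] q s 0) (sym initial-state) (local₀ q) , λ ()

  start-toward : ∀ {ℓ*} (D : Chain ℓ₀ ℓ*) → Final ℓ* → Toward D [] (initConfig machine)
  start-toward D fin = toward [] D refl fin initially λ q →
    0 , subst (λ s → Local [] [] q s 0) (sym initial-state) (local₀ q) , (λ ()) , λ _ _ → cong voted initial-state

  -- In `ℓ₀` the decider of the planned exit may have passed already; the plan is given up for the
  -- default run. In any other batch the process named by `must` cannot have passed, so the plan is
  -- still open.
  toward-some : ∀ {H c} → Inv H c → ∃ λ ℓ* → Σ (Chain ℓ₀ ℓ*) λ D → Toward D H c
  toward-some {H} {c} (inv {mid} C (ℓ* , F , fin) g ls) with mid Fin.≟ ℓ₀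
  ... | yes root = _ , C ⊕ [] , toward C [] refl (subst Final (sym root) final₀) g λ q → _ , proj₁ (proj₂ (ls q)) , proj₂ (proj₂ (ls q)) , λ ()
  ... | no other = _ , C ⊕ F , toward C F refl fin g λ q → _ , proj₁ (proj₂ (ls q)) , proj₂ (proj₂ (ls q)) , wait F q
    where
    wait : ∀ {ℓ} (F : Chain mid ℓ) q → Waits C F q (proj₁ (ls q)) (stateOf c q)
    wait (ext v p lg _) q refl eq with voted (stateOf c q) in vd
    ... | false = refl
    ... | true  = contradiction (trans (cong must (trans (cong (lab C) eq) (lab-len C))) (proj₁ (Legit.obliged lg other)))
                    (Local.free (proj₁ (proj₂ (ls q))) eq vd)

-- Planning the batches of a run

module Cycles {np nc : ℕ} (G : MSG (Fin np) (Fin nc)) where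

  open Walks G public

  star⇒consecutive : ∀ {x y} → Star τ x y → ∃ λ ds → Consecutive (just x) ds × lastOf (just x) ds ≡ just y
  star⇒consecutive ε = [] , [] , refl
  star⇒consecutive (t ◅ ts) with star⇒consecutive ts
  ... | ds , cs , eq = _ ∷ ds , edge t ∷ cs , eq

  default : Fin k → List (Fin k)
  default x = proj₁ (star⇒consecutive (reachf x))

  default-consecutive : ∀ x → Consecutive (just x) (default x)
  default-consecutive x = proj₁ (proj₂ (star⇒consecutive (reachf x)))

  default-end : ∀ x → lastOf (just x) (default x) ≡ just sf
  default-end x = proj₂ (proj₂ (star⇒consecutive (reachf x)))

  M : ℕ
  M = maxOver λ x → length (default x)

  NonEmpty : Fin k → Set
  NonEmpty s = Node.size s ≢ 0

  no-step-after : ∀ {x b} → just x ≡ just sf → ¬ τ x b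
  no-step-after refl t = sf-noOut _ t

  -- Comparing a walk with a fixed path to the final node exhibits a choice node, without deciding τ.
  diverge : ∀ {x} ds → Consecutive (just x) ds → lastOf (just x) ds ≡ just sf → ∀ {ms} → Walk (just x) (just sf) ms →
            length ms ≤ length ds ⊎ ∃ λ c → ∃ λ ns → ∃ λ rest → ms ≡ ns ++ rest × length ns ≤ length ds ×
              Walk (just x) (just c) ns × ChoiceNode G c × Walk (just c) (just sf) rest
  diverge ds cs eq [] = inj₁ z≤n
  diverge [] cs eq (keep (edge t) w)   = contradiction t (no-step-after eq)
  diverge [] cs eq (skip (edge t) z w) = contradiction t (no-step-after eq)
  diverge (b′ ∷ ds) (edge t′ ∷ cs) eq (keep {b = b} (edge t) w) with b Fin.≟ b′
  ... | no ne = inj₂ (_ , [] , _ , refl , z≤n , [] , (b , b′ , t , t′ , ne) , keep (edge t) w)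
  ... | yes refl with diverge ds cs eq w
  ...   | inj₁ le = inj₁ (s≤s le)
  ...   | inj₂ (c , ns , rest , refl , le , w₁ , ch , w₂) = inj₂ (c , b ∷ ns , rest , refl , s≤s le , keep (edge t) w₁ , ch , w₂)
  diverge (b′ ∷ ds) (edge t′ ∷ cs) eq (skip {b = b} (edge t) z w) with b Fin.≟ b′
  ... | no ne = inj₂ (_ , [] , _ , refl , z≤n , [] , (b , b′ , t , t′ , ne) , skip (edge t) z w)
  ... | yes refl with diverge ds cs eq w
  ...   | inj₁ le = inj₁ (ℕₚ.m≤n⇒m≤1+n le)
  ...   | inj₂ (c , ns , rest , refl , le , w₁ , ch , w₂) = inj₂ (c , ns , rest , refl , ℕₚ.m≤n⇒m≤1+n le , skip (edge t) z w₁ , ch , w₂)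

  split-first : ∀ {a u b ms} → Walk a (just u) (b ∷ ms) → Walk a (just b) (b ∷ []) × Walk (just b) (just u) ms
  split-first (keep e w) = keep e [] , w
  split-first (skip e z w) with split-first w
  ... | w₁ , w₂ = skip e z w₁ , w₂

  -- Each round runs to a choice node `c` and on to the next listed node `b`. As `b` has events, a
  -- cycle from `c` back to an equal later choice contains an event.
  data Choices : ℕ → Fin k → List (Fin k) → Set where
    stop : ∀ {x ms} → Walk (just x) (just sf) ms → Choices 0 x ms
    more : ∀ {r x c b ns ms} → Walk (just x) (just c) ns → length ns ≤ M → ChoiceNode G c → Walk (just c) (just b) (b ∷ []) →
           NonEmpty b → Choices r b ms → Choices (suc r) x (ns ++ b ∷ ms)

  choices : ∀ r {x ms} → Walk (just x) (just sf) ms → All NonEmpty ms → length ms ≤ r * suc M ⊎ Choices r x ms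
  choices zero w ne = inj₂ (stop w)
  choices (suc r) {x} w ne with diverge (default x) (default-consecutive x) (default-end x) w
  ... | inj₁ le = inj₁ (ℕₚ.≤-trans le (ℕₚ.≤-trans (maxOver-ub (length ∘ default) x) (ℕₚ.≤-trans (ℕₚ.n≤1+n M) (ℕₚ.m≤m+n (suc M) _))))
  ... | inj₂ (c , ns , [] , refl , le , w₁ , ch , w₂) = inj₁ (subst (_≤ suc r * suc M) (sym (cong length (Listₚ.++-identityʳ ns)))
          (ℕₚ.≤-trans le (ℕₚ.≤-trans (maxOver-ub (length ∘ default) x) (ℕₚ.≤-trans (ℕₚ.n≤1+n M) (ℕₚ.m≤m+n (suc M) _)))))
  ... | inj₂ (c , ns , b ∷ ms , refl , le , w₁ , ch , w₂) with Allₚ.++⁻ʳ ns ne | split-first w₂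
  ...   | nb ∷ nms | w₃ , w₄ with choices r w₄ nms
  ...     | inj₂ cs  = inj₂ (more w₁ (ℕₚ.≤-trans le (maxOver-ub (length ∘ default) x)) ch w₃ nb cs)
  ...     | inj₁ le′ = inj₁ (subst (_≤ suc r * suc M) (sym (trans (Listₚ.length-++ ns) (ℕₚ.+-suc (length ns) (length ms))))
              (s≤s (ℕₚ.+-mono-≤ (ℕₚ.≤-trans le (maxOver-ub (length ∘ default) x)) le′)))

  choice : ∀ {r x ms} → Choices r x ms → Fin r → Fin k
  choice (more {c = c} _ _ _ _ _ cs) zero    = c
  choice (more _ _ _ _ _ cs)         (suc i) = choice cs i

  whole : ∀ {r x ms} → Choices r x ms → Walk (just x) (just sf) ms
  whole (stop w) = w
  whole (more w₁ _ _ w₂ _ cs) = w₁ ++ʷ (w₂ ++ʷ whole cs)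

  private
    lengthen : ∀ r (ns : List (Fin k)) b xs → length ns ≤ M → length xs ≤ r * suc M → length (ns ++ b ∷ xs) ≤ suc r * suc M
    lengthen r ns b xs le le′ = subst (_≤ suc r * suc M) (sym (trans (Listₚ.length-++ ns) (ℕₚ.+-suc (length ns) (length xs)))) (s≤s (ℕₚ.+-mono-≤ le le′))

  to-choice : ∀ {r x ms} (cs : Choices r x ms) i → ∃ λ ns → ∃ λ rest → ms ≡ ns ++ rest × length ns ≤ r * suc M ×
              Walk (just x) (just (choice cs i)) ns × Walk (just (choice cs i)) (just sf) rest
  to-choice (more {ns = ns} {ms} w₁ le _ w₂ _ cs) zero = ns , _ ∷ ms , refl ,
    ℕₚ.≤-trans le (ℕₚ.≤-trans (ℕₚ.n≤1+n M) (ℕₚ.m≤m+n (suc M) _)) , w₁ , w₂ ++ʷ whole cs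
  to-choice (more {r} {b = b} {ns = ns} w₁ le _ w₂ _ cs) (suc i) with to-choice cs i
  ... | xs , rest , refl , le′ , w₃ , w₄ = ns ++ b ∷ xs , rest , sym (Listₚ.++-assoc ns (b ∷ xs) rest) ,
          lengthen r ns b xs le le′ , w₁ ++ʷ (w₂ ++ʷ w₃) , w₄

  record Cut (n : ℕ) (x : Fin k) (ms : List (Fin k)) : Set where
    field
      c b            : Fin k
      before cycle rest : List (Fin k)
      splits   : ms ≡ (before ++ b ∷ cycle) ++ rest
      short    : length (before ++ b ∷ cycle) ≤ n
      nonempty : NonEmpty b
      is-choice : ChoiceNode G c
      walk₁    : Walk (just x) (just c) before
      walk₂    : Walk (just c) (just c) (b ∷ cycle)
      walk₃    : Walk (just c) (just sf) rest

  cut-between : ∀ {r x ms} (cs : Choices r x ms) {i j} → i Fin.< j → choice cs i ≡ choice cs j → Cut (r * suc M) x ms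
  cut-between (more {r} {c = c} {b} {ns} w₁ le ch w₂ nb cs) {zero} {suc j} _ eq with choice cs j | to-choice cs j
  cut-between (more {r} {c = c} {b} {ns} w₁ le ch w₂ nb cs) {zero} {suc j} _ refl | _ | xs , rest , refl , le′ , w₃ , w₄ = record
    { before = ns ; cycle = xs ; rest = rest ; splits = sym (Listₚ.++-assoc ns (b ∷ xs) rest) ; short = lengthen r ns b xs le le′
    ; nonempty = nb ; is-choice = ch ; walk₁ = w₁ ; walk₂ = w₂ ++ʷ w₃ ; walk₃ = w₄ }
  cut-between (more {r} {b = b} {ns = ns} w₁ le ch w₂ nb cs) {suc i} {suc j} (s≤s lt) eq with cut-between cs {i} {j} lt eq
  ... | record { b = b′ ; before = before ; cycle = cycle ; rest = rest ; splits = refl ; short = short ; nonempty = nonempty ; is-choice = is-choice ; walk₁ = v₁ ; walk₂ = v₂ ; walk₃ = v₃ } = record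
    { before = ns ++ b ∷ before ; cycle = cycle ; rest = rest
    ; splits = trans (sym (Listₚ.++-assoc ns (b ∷ before ++ b′ ∷ cycle) rest)) (cong (_++ rest) (sym (Listₚ.++-assoc ns (b ∷ before) (b′ ∷ cycle))))
    ; short = subst (λ xs → length xs ≤ suc r * suc M) (sym (Listₚ.++-assoc ns (b ∷ before) (b′ ∷ cycle))) (lengthen r ns b _ le short)
    ; nonempty = nonempty ; is-choice = is-choice ; walk₁ = w₁ ++ʷ (w₂ ++ʷ v₁) ; walk₂ = v₂ ; walk₃ = v₃ }

  -- Among `suc k` choices two are at the same node. Every round uses at most `M` nodes before the
  -- choice, the length of a default path, and one more for `b`; this gives the bound.
  find-cut : ∀ {x ms} → Walk (just x) (just sf) ms → All NonEmpty ms → length ms ≤ suc k * suc M ⊎ Cut (suc k * suc M) x ms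
  find-cut w ne with choices (suc k) w ne
  ... | inj₁ le = inj₁ le
  ... | inj₂ cs with Finₚ.pigeonhole (ℕₚ.n<1+n k) (choice cs)
  ...   | i , j , i<j , eq = inj₂ (cut-between cs i<j eq)

  module _ (cc : ControllableChoice G) where

    -- A leader of a local choice starts every nonempty cycle through it.
    cycle-informs : ∀ {c b ns} → ChoiceNode G c → Walk (just c) (just c) (b ∷ ns) → NonEmpty b →
                    ∃ λ p → Takes (b ∷ ns) p × ∀ r → Triggers G c r → Informed (b ∷ ns) p r
    cycle-informs {c} {b} {ns} ch w nb with cc c ch
    ... | inj₂ (_ , ctrl) with walk⇒edge {i = 0} w refl
    ...   | s₁ , t , σ , θ = resolving⇒informed θ (ctrl s₁ t σ)
    cycle-informs {c} {b} {ns} ch w nb | inj₁ (p , _ , only) with initialSend ns nb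
    ... | x , ks , fx with only _ (triggers w ks fx)
    ...   | refl = p , ((0 , b , x) , valid refl , refl) , λ r tr → (0 , b , x) , (0 , b , x) , valid refl , valid refl , refl , sym (only r tr) , ε

  trim : ∀ {y z} (σ : Path G y z) {x} → τ x y → ∃ λ ms → Thin σ ms × Walk (just x) (just z) ms × All NonEmpty ms
  trim ⟦ y ⟧ t with Node.size y ℕₚ.≟ 0
  ... | yes z = [] , skip₁ z , skip (edge t) z [] , []
  ... | no ne = y ∷ [] , keep₁ , keep (edge t) [] , ne ∷ []
  trim (y ∷⟨ t′ ⟩ σ) t with Node.size y ℕₚ.≟ 0 | trim σ t′
  ... | yes z | ms , θ , w , ne = ms , skip z θ , skip (edge t) z w , ne
  ... | no ny | ms , θ , w , ne = y ∷ ms , keep θ , keep (edge t) w , ny ∷ ne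

  record Departure {x} (σ : Path G x sf) (ds : List (Fin k)) : Set where
    field
      j         : ℕ
      j≤        : j ≤ length ds
      c         : Fin k
      at-c      : lastOf (just x) (take j ds) ≡ just c
      is-choice : ChoiceNode G c
      stem      : Path G x c
      thin-stem : Thin stem (x ∷ take j ds)
      ms        : List (Fin k)
      walk      : Walk (just c) (just sf) ms
      nonempty  : All NonEmpty ms
      thin      : Thin σ ((x ∷ take j ds) ++ ms)

  -- The comparison of `diverge` for the whole run. Before the departure nodes without events stay
  -- listed, as they are on the path of `ℓ₀`; after it they are trimmed.
  follow : ∀ {x} ds → Consecutive (just x) ds → lastOf (just x) ds ≡ just sf → (σ : Path G x sf) → Thin σ (x ∷ ds) ⊎ Departure σ ds
  follow []       cs eq ⟦ _ ⟧ = inj₁ keep₁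
  follow (_ ∷ _) (edge t ∷ _) eq ⟦ _ ⟧ = contradiction t (sf-noOut _)
  follow []       cs eq (x ∷⟨ t ⟩ σ) = contradiction t (no-step-after eq)
  follow (b ∷ ds) (edge t′ ∷ cs) eq (_∷⟨_⟩_ x {y} t σ) with y Fin.≟ b
  ... | no ne with trim σ t
  ...   | ms , θ , w , nes = inj₂ record
          { j = 0 ; j≤ = z≤n ; c = x ; at-c = refl ; is-choice = y , b , t , t′ , ne ; stem = ⟦ x ⟧ ; thin-stem = keep₁
          ; ms = ms ; walk = w ; nonempty = nes ; thin = keep θ }
  follow (b ∷ ds) (edge t′ ∷ cs) eq (_∷⟨_⟩_ x {y} t σ) | yes refl with follow ds cs eq σ
  ... | inj₁ θ = inj₁ (keep θ)
  ... | inj₂ d = inj₂ record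
          { j = suc j ; j≤ = s≤s j≤ ; c = c ; at-c = at-c ; is-choice = is-choice ; stem = x ∷⟨ t ⟩ stem ; thin-stem = keep thin-stem
          ; ms = ms ; walk = walk ; nonempty = nonempty ; thin = keep thin }
    where open Departure d

-- Coding of labels

module _ {A : Set} where

  -- Lists of bounded length are coded as vectors with gaps. Any vector can be read back as a list
  -- within the bound, so every code denotes an admissible path.
  pad : ∀ n (xs : List A) → length xs ≤ n → Vec (Maybe A) n
  pad zero    xs       _        = []
  pad (suc n) []       _        = nothing ∷ pad n [] z≤n
  pad (suc n) (x ∷ xs) (s≤s le) = just x ∷ pad n xs le

  unpad : ∀ {n} → Vec (Maybe A) n → List A
  unpad []             = []
  unpad (nothing ∷ xs) = unpad xs
  unpad (just x ∷ xs)  = x ∷ unpad xs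

  unpad-pad : ∀ n (xs : List A) le → unpad (pad n xs le) ≡ xs
  unpad-pad zero    []       le       = refl
  unpad-pad (suc n) []       le       = unpad-pad n [] z≤n
  unpad-pad (suc n) (x ∷ xs) (s≤s le) = cong (x ∷_) (unpad-pad n xs le)

  length-unpad : ∀ {n} (xs : Vec (Maybe A) n) → length (unpad xs) ≤ n
  length-unpad []             = z≤n
  length-unpad (nothing ∷ xs) = ℕₚ.m≤n⇒m≤1+n (length-unpad xs)
  length-unpad (just x ∷ xs)  = s≤s (length-unpad xs)

module Coded {np nc : ℕ} (G : MSG (Fin np) (Fin nc)) where

  open Cycles G public

  -- What planning has to know about the labels: every combination of field values within the bounds
  -- is the content of some label other than `ℓ₀`.
  record Ample (Λ : Labels G) : Set where
    open Labels Λ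
    field
      default-path : path ℓ₀ ≡ s₀ ∷ default s₀
      room         : suc k * suc M ≤ K
      make         : ∀ (a z : Fin k) ns → length ns ≤ K → (l : Fin np → Maybe (Fin np) × ℕ) → (∀ q → proj₂ (l q) ≤ K) →
                     (o : Fin np → Fin np) (m : Maybe (Fin np)) →
                     ∃ λ ℓ → ℓ ≢ ℓ₀ × start ℓ ≡ just a × end ℓ ≡ z × path ℓ ≡ ns × (∀ q → last ℓ q ≡ l q) × (∀ q → out ℓ q ≡ o q) × must ℓ ≡ m

  private
    -- The first summand accommodates the default path from `s₀`, the second a batch found by
    -- `find-cut`.
    bound : ℕ
    bound = length (s₀ ∷ default s₀) + suc k * suc M

    -- The boolean marks the default run.
    Label : Set
    Label = Bool × Maybe (Fin k) × Fin k × Vec (Maybe (Fin k)) bound × Vec (Maybe (Fin np) × Fin (suc bound)) np × Vec (Fin np) np × Maybe (Fin np)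

    abstract

      coding : Coding Label
      coding = boolCoding ×ᶜ maybeCoding (finCoding k) ×ᶜ finCoding k ×ᶜ vecCoding (maybeCoding (finCoding k)) bound ×ᶜ
               vecCoding (maybeCoding (finCoding np) ×ᶜ finCoding (suc bound)) np ×ᶜ vecCoding (finCoding np) np ×ᶜ maybeCoding (finCoding np)

    module Label (l : Label) where
      is-default : Bool
      is-default = proj₁ l
      start : Maybe (Fin k)
      start = proj₁ (proj₂ l)
      end : Fin k
      end = proj₁ (proj₂ (proj₂ l))
      path : List (Fin k)
      path = unpad (proj₁ (proj₂ (proj₂ (proj₂ l))))
      last : Fin np → Maybe (Fin np) × ℕ
      last q = let r , κ = Vec.lookup (proj₁ (proj₂ (proj₂ (proj₂ (proj₂ l))))) q in r , toℕ κ
      out : Fin np → Fin np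
      out q = Vec.lookup (proj₁ (proj₂ (proj₂ (proj₂ (proj₂ (proj₂ l)))))) q
      must : Maybe (Fin np)
      must = proj₂ (proj₂ (proj₂ (proj₂ (proj₂ (proj₂ l)))))

    D≤ : length (s₀ ∷ default s₀) ≤ bound
    D≤ = ℕₚ.m≤m+n _ _

    default-label : Label
    default-label = true , nothing , s₀ , pad bound (s₀ ∷ default s₀) D≤ , Vec.tabulate (λ _ → nothing , zero) , Vec.tabulate (λ q → q) , nothing

    open Coding coding

    decoded-default : from (to default-label) ≡ default-label
    decoded-default = from-to default-label

    decoded-path : Label.path (from (to default-label)) ≡ s₀ ∷ default s₀
    decoded-path = trans (cong Label.path decoded-default) (unpad-pad bound (s₀ ∷ default s₀) D≤)

  labels : Labels G
  labels = record
    { NL = codes ; K = bound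
    ; start = λ ℓ → Label.start (from ℓ) ; end = λ ℓ → Label.end (from ℓ) ; path = λ ℓ → Label.path (from ℓ)
    ; last = λ ℓ → Label.last (from ℓ) ; out = λ ℓ → Label.out (from ℓ) ; must = λ ℓ → Label.must (from ℓ)
    ; path≤ = λ ℓ → length-unpad (proj₁ (proj₂ (proj₂ (proj₂ (from ℓ)))))
    ; ℓ₀ = to default-label
    ; start₀ = cong Label.start decoded-default ; must₀ = cong Label.must decoded-default
    ; path₀ = subst (Consecutive nothing) (sym decoded-path) (enter ∷ default-consecutive s₀)
    ; end₀ = trans (cong (lastOf nothing) decoded-path) (default-end s₀) }

  ample : Ample labels
  ample = record
    { default-path = decoded-path
    ; room = ℕₚ.m≤n+m (suc k * suc M) (length (s₀ ∷ default s₀))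
    ; make = make }
    where
    make : ∀ (a z : Fin k) ns → length ns ≤ bound → (l : Fin np → Maybe (Fin np) × ℕ) → (∀ q → proj₂ (l q) ≤ bound) →
           (o : Fin np → Fin np) (m : Maybe (Fin np)) → _
    make a z ns le l l≤ o m = to fields , other , cong Label.start eq , cong Label.end eq ,
        trans (cong Label.path eq) (unpad-pad bound ns le) ,
        (λ q → trans (cong (λ x → Label.last x q) eq) (last≡ q)) ,
        (λ q → trans (cong (λ x → Label.out x q) eq) (Vecₚ.lookup∘tabulate o q)) ,
        cong Label.must eq
      where
      fields : Label
      fields = false , just a , z , pad bound ns le , Vec.tabulate (λ q → proj₁ (l q) , Fin.fromℕ< (s≤s (l≤ q))) , Vec.tabulate o , m
      eq : from (to fields) ≡ fields
      eq = from-to fields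
      last≡ : ∀ q → Label.last fields q ≡ l q
      last≡ q = trans (cong (λ (r , κ) → r , toℕ κ) (Vecₚ.lookup∘tabulate (λ q → proj₁ (l q) , Fin.fromℕ< (s≤s (l≤ q))) q))
                      (cong (proj₁ (l q) ,_) (Finₚ.toℕ-fromℕ< _))
      other : to fields ≢ to default-label
      other same = contradiction (trans (sym (cong Label.is-default eq)) (trans (cong (Label.is-default ∘ from) same) (cong Label.is-default decoded-default))) λ ()

-- From runs to chains of batches

module Planning {np nc : ℕ} (G : MSG (Fin np) (Fin nc)) (cc : ControllableChoice G) (Λ : Labels G) (A : Coded.Ample G Λ) where

  open Coded G using (diverge; find-cut; Cut; cycle-informs; NonEmpty; M; default; default-consecutive; default-end; follow; Departure)
  open Coded.Ample A
  open Protocol G Λ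
  open Config

  flat : ∀ {ℓ ℓ′} → Chain ℓ ℓ′ → List (Fin k)
  flat {ℓ} []            = path ℓ
  flat {ℓ} (ext v _ _ C) = take (cutoff v) (path ℓ) ++ flat C

  Pending : Set
  Pending = Fin np → Maybe (Fin np) × ℕ

  Agrees : Pending → List (Fin k) → Set
  Agrees l ms = ∀ q → proj₁ (l q) ≡ nothing ⊎ (∀ e → First ms q e → proj₁ (l q) ≡ just (awaitedBy e))

  record Planned (u : Fin k) (ms : List (Fin k)) (l : Pending) : Set where
    field
      ℓ         : Fin NL
      other     : ℓ ≢ ℓ₀
      starts    : start ℓ ≡ just u
      last≡     : ∀ q → last ℓ q ≡ l q
      {ℓ*}      : Fin NL
      F         : Chain ℓ ℓ*
      fin       : Final ℓ*
      flat≡     : flat F ≡ ms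
      walk-from : ∃ λ z → Walk (just u) (just z) (path ℓ)
      kept      : ∀ q e → First (path ℓ) q e → Keeps ℓ q e

  nextAwaited : List (Fin k) → Fin np → Fin np
  nextAwaited ms q with first? ms q
  ... | inj₁ (e , _) = awaitedBy e
  ... | inj₂ _       = q

  nextAwaited-first : ∀ {ms q e} → First ms q e → nextAwaited ms q ≡ awaitedBy e
  nextAwaited-first {ms} {q} fe with first? ms q
  ... | inj₁ (_ , fe′) = cong awaitedBy (first-unique fe′ fe)
  ... | inj₂ ¬t        = contradiction (_ , proj₁ fe , proj₁ (proj₂ fe)) ¬t

  update : Pending → List (Fin k) → List (Fin k) → Pending
  update l ns rest q with first? ns q
  ... | inj₁ _ = just (nextAwaited rest q) , length ns
  ... | inj₂ _ = l q

  update-agrees : ∀ {l} ns rest → Agrees l (ns ++ rest) → Agrees (update l ns rest) rest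
  update-agrees ns rest ag q with first? ns q
  ... | inj₁ _ = inj₂ λ e fe → cong just (nextAwaited-first fe)
  ... | inj₂ ¬t with ag q
  ...   | inj₁ none = inj₁ none
  ...   | inj₂ some = inj₂ λ e fe → some (shift (length ns) e) (first-++ʳ ns ¬t fe)

  update-≤ : ∀ {l} ns rest → length ns ≤ K → (∀ q → proj₂ (l q) ≤ K) → ∀ q → proj₂ (update l ns rest q) ≤ K
  update-≤ ns rest le l≤ q with first? ns q
  ... | inj₁ _ = le
  ... | inj₂ _ = l≤ q

  update-in : ∀ l ns rest {q} → Takes ns q → update l ns rest q ≡ (just (nextAwaited rest q) , length ns)
  update-in l ns rest {q} t with first? ns q
  ... | inj₁ _ = refl
  ... | inj₂ ¬t = contradiction t ¬t

  update-out : ∀ l ns rest {q} → ¬ Takes ns q → update l ns rest q ≡ l q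
  update-out l ns rest {q} ¬t with first? ns q
  ... | inj₁ (e , v , p , _) = contradiction (e , v , p) ¬t
  ... | inj₂ _ = refl

  keeps : ∀ {l ns ℓ} rest → Agrees l (ns ++ rest) → path ℓ ≡ ns → (∀ q → last ℓ q ≡ l q) →
          ∀ q e → First (path ℓ) q e → Keeps ℓ q e
  keeps {ℓ = ℓ} rest ag refl last≡ q e fe with ag q
  ... | inj₁ none = inj₁ (trans (cong proj₁ (last≡ q)) none)
  ... | inj₂ some = inj₂ (trans (cong proj₁ (last≡ q)) (some e (first-++ rest fe)))

  take-all : ∀ {n} (xs : List (Fin k)) → n ≡ length xs → take n xs ≡ xs
  take-all []       refl = refl
  take-all (x ∷ xs) refl = cong (x ∷_) (take-all xs refl)

  -- Every cut removes at least the node `b`, so the rest gets shorter. The promises of a batch are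
  -- read off from the actual rest of the walk; hence the pending promises agree with what is to
  -- come at each stage, and the next batches keep them.
  plan : ∀ {u ms} (l : Pending) → Acc _<_ (length ms) → (∀ q → proj₂ (l q) ≤ K) → Agrees l ms →
         Walk (just u) (just sf) ms → All NonEmpty ms → Planned u ms l
  plan {u} {ms} l (acc shorter) l≤ ag w ne with find-cut w ne
  -- The rest fits into one final batch: no decider, and as promised sender everybody gets itself,
  -- which stands for no receive.
  ... | inj₁ le with make u sf ms (ℕₚ.≤-trans le room) l l≤ (λ q → q) nothing
  ...   | ℓ , other , starts , _ , path≡ , last≡ , _ , must≡ = record
    { ℓ = ℓ ; other = other ; starts = starts ; last≡ = last≡ ; F = [] ; flat≡ = path≡
    ; fin = subst₂ (λ a ns → Walk a (just sf) ns) (sym starts) (sym path≡) w , must≡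
    ; walk-from = sf , subst (Walk (just u) (just sf)) (sym path≡) w
    ; kept = keeps {l} {ms} [] (subst (Agrees l) (sym (Listₚ.++-identityʳ ms)) ag) path≡ last≡ }
  plan {u} l (acc shorter) l≤ ag w ne | inj₂ record
      { c = c ; b = b ; before = before ; cycle = cycle ; rest = rest ; splits = refl ; short = short
      ; nonempty = nonempty ; is-choice = is-choice ; walk₁ = walk₁ ; walk₂ = walk₂ ; walk₃ = walk₃ }
    with cycle-informs cc is-choice walk₂ nonempty
  ... | p , tp , informed = record
    { ℓ = ℓ ; other = other ; starts = starts ; last≡ = last≡ ; F = ext v p legit next-F ; fin = P.fin
    ; flat≡ = cong₂ _++_ whole-path P-flat
    ; walk-from = c , subst (Walk (just u) (just c)) (sym path≡) (walk₁ ++ʷ walk₂)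
    ; kept = keeps {l} {ns} rest ag path≡ last≡ }
    where
    ns : List (Fin k)
    ns = before ++ b ∷ cycle
    ns≤ : length ns ≤ K
    ns≤ = ℕₚ.≤-trans short room
    rest< : length rest < length (ns ++ rest)
    rest< = subst (length rest <_) (sym (trans (Listₚ.length-++ ns) (cong (_+ length rest)
              (trans (Listₚ.length-++ before) (ℕₚ.+-suc (length before) (length cycle)))))) (s≤s (ℕₚ.m≤n+m _ _))
    continuation : Planned c rest (update l ns rest)
    continuation = plan (update l ns rest) (shorter rest<) (update-≤ {l} ns rest ns≤ l≤) (update-agrees {l} ns rest ag) walk₃ (Allₚ.++⁻ʳ ns ne)
    module P = Planned continuation
    made = make u c ns ns≤ l l≤ (nextAwaited rest) (just p)
    ℓ = proj₁ made
    other : ℓ ≢ ℓ₀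
    other = proj₁ (proj₂ made)
    starts : start ℓ ≡ just u
    starts = proj₁ (proj₂ (proj₂ made))
    end≡ : end ℓ ≡ c
    end≡ = proj₁ (proj₂ (proj₂ (proj₂ made)))
    path≡ : path ℓ ≡ ns
    path≡ = proj₁ (proj₂ (proj₂ (proj₂ (proj₂ made))))
    last≡ : ∀ q → last ℓ q ≡ l q
    last≡ = proj₁ (proj₂ (proj₂ (proj₂ (proj₂ (proj₂ made)))))
    out≡ : ∀ q → out ℓ q ≡ nextAwaited rest q
    out≡ = proj₁ (proj₂ (proj₂ (proj₂ (proj₂ (proj₂ (proj₂ made))))))
    must≡ : must ℓ ≡ just p
    must≡ = proj₂ (proj₂ (proj₂ (proj₂ (proj₂ (proj₂ (proj₂ made))))))
    vote-made = mkVote ns≤ P.ℓ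
    v : Vote
    v = proj₁ vote-made
    cutoff≡ : cutoff v ≡ length (path ℓ)
    cutoff≡ = trans (proj₁ (proj₂ vote-made)) (cong length (sym path≡))
    target≡ : target v ≡ P.ℓ
    target≡ = proj₂ (proj₂ vote-made)
    whole-path : take (cutoff v) (path ℓ) ≡ ns
    whole-path = trans (take-all (path ℓ) cutoff≡) path≡
    last-target : ∀ q → last (target v) q ≡ update l ns rest q
    last-target q = trans (cong (λ ℓ → last ℓ q) target≡) (P.last≡ q)
    next-F : Chain (target v) P.ℓ*
    next-F = subst (λ ℓ → Chain ℓ P.ℓ*) (sym target≡) P.F
    P-flat : flat next-F ≡ rest
    P-flat = trans (flat-subst target≡) P.flat≡
      where flat-subst : ∀ {ℓ} (eq : ℓ ≡ P.ℓ) → flat (subst (λ ℓ → Chain ℓ P.ℓ*) (sym eq) P.F) ≡ flat P.F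
            flat-subst refl = refl
    legit : Legit ℓ v p
    legit = record
      { node = c ; node-root = λ eq → contradiction eq other ; node-end = λ _ → end≡
      ; full = λ _ → cutoff≡ ; cutoff≤ = ℕₚ.≤-reflexive cutoff≡
      ; walk-to = subst₂ (λ a xs → Walk a (just c) xs) (sym starts) (sym whole-path) (walk₁ ++ʷ walk₂)
      ; starts = trans (cong start target≡) P.starts
      ; not-root = λ eq → P.other (trans (sym target≡) eq)
      ; obliged = λ _ → must≡ , subst (λ xs → Takes xs p) (sym path≡) (takes-++ʳ before tp)
      ; informs = λ r tr → inj₁ (subst (λ xs → Informed xs p r) (sym whole-path) (informed-++ʳ before (informed r tr)))
      ; last-in = λ { q (inj₁ eq) → contradiction eq other
                    ; q (inj₂ t) → trans (last-target q) (trans (update-in l ns rest (subst (λ xs → Takes xs q) path≡ t))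
                        (cong₂ _,_ (trans (cong just (sym (out≡ q))) (sym (promise-other other))) (sym (proj₁ (proj₂ vote-made))))) }
      ; last-out = λ q _ ¬t → trans (last-target q) (trans (update-out l ns rest (λ t → ¬t (subst (λ xs → Takes xs q) (sym path≡) t))) (sym (last≡ q)))
      ; kept = λ q e fe → subst (λ ℓ → Keeps ℓ q e) (sym target≡)
                 (P.kept q e (subst (λ ℓ → First (path ℓ) q e) target≡ fe))
      ; walk-from = let z , w = P.walk-from in z , subst (λ ℓ → Walk (just c) (just z) (path ℓ)) (sym target≡) w }

  plan-run : (ρ : Path G s₀ sf) → ∃ λ ℓ* → Σ (Chain ℓ₀ ℓ*) λ D → Final ℓ* × Thin ρ (flat D)
  plan-run ρ with follow (default s₀) (default-consecutive s₀) (default-end s₀) ρ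
  ... | inj₁ θ = ℓ₀ , [] , final₀ , subst (Thin ρ) (sym default-path) θ
  ... | inj₂ d = P.ℓ* , ext v (proj₁ decision) legit next-F , P.fin ,
          subst (Thin ρ) (sym (cong₂ _++_ stem-path P-flat)) thin
    where
    open Departure d
    κ≤ : suc j ≤ length (path ℓ₀)
    κ≤ = subst (suc j ≤_) (cong length (sym default-path)) (s≤s j≤)
    pending : Pending
    -- The path of `ℓ₀` starts with `s₀` itself, so `j` nodes after it make a cutoff of `suc j`. It
    -- is recorded even without a promise, as receivers learn their cutoff from it.
    pending q = nothing , suc j
    planned : Planned c ms pending
    planned = plan pending (<-wellFounded _) (λ _ → ℕₚ.≤-trans κ≤ (path≤ ℓ₀)) (λ _ → inj₁ refl) walk nonempty
    module P = Planned planned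
    vote-made = mkVote (ℕₚ.≤-trans κ≤ (path≤ ℓ₀)) P.ℓ
    v : Vote
    v = proj₁ vote-made
    cutoff≡ : cutoff v ≡ suc j
    cutoff≡ = proj₁ (proj₂ vote-made)
    target≡ : target v ≡ P.ℓ
    target≡ = proj₂ (proj₂ vote-made)
    stem-path : take (cutoff v) (path ℓ₀) ≡ s₀ ∷ take j (default s₀)
    stem-path = cong₂ take cutoff≡ default-path
    next-F : Chain (target v) P.ℓ*
    next-F = subst (λ ℓ → Chain ℓ P.ℓ*) (sym target≡) P.F
    P-flat : flat next-F ≡ ms
    P-flat = trans (flat-subst target≡) P.flat≡
      where flat-subst : ∀ {ℓ} (eq : ℓ ≡ P.ℓ) → flat (subst (λ ℓ → Chain ℓ P.ℓ*) (sym eq) P.F) ≡ flat P.F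
            flat-subst refl = refl
    at-node : lastOf nothing (take (cutoff v) (path ℓ₀)) ≡ just c
    at-node = trans (cong (lastOf nothing) stem-path) at-c
    decision : ∃ λ p → ∀ r → Triggers G c r → Informed (s₀ ∷ take j (default s₀)) p r ⊎ r ≡ p
    -- The exit node is reached from `s₀` here, not by a cycle, so the resolving event is that of a
    -- path from `s₀`. In a local choice the leader is the only trigger and needs no event before
    -- the exit.
    decision with cc c is-choice
    ... | inj₁ (p , _ , only) = p , λ r tr → inj₂ (only r tr)
    ... | inj₂ (ctrl , _) = let p , _ , inf = resolving⇒informed thin-stem (ctrl stem) in p , λ r tr → inj₁ (inf r tr)
    informs : ∀ r → Triggers G c r → Informed (take (cutoff v) (path ℓ₀)) (proj₁ decision) r ⊎ (ℓ₀ ≡ ℓ₀ × r ≡ proj₁ decision)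
    informs r tr with proj₂ decision r tr
    ... | inj₁ inf = inj₁ (subst (λ xs → Informed xs (proj₁ decision) r) (sym stem-path) inf)
    ... | inj₂ eq  = inj₂ (refl , eq)
    legit : Legit ℓ₀ v (proj₁ decision)
    legit = record
      { node = c ; node-root = λ _ → at-node ; node-end = λ ne → contradiction refl ne
      ; full = λ ne → contradiction refl ne ; cutoff≤ = subst (_≤ length (path ℓ₀)) (sym cutoff≡) κ≤
      ; walk-to = subst₂ (λ a b → Walk a b (take (cutoff v) (path ℓ₀))) (sym start₀) at-node (consecutive⇒walk (consecutive-take (cutoff v) path₀))
      ; starts = trans (cong start target≡) P.starts
      ; not-root = λ eq → P.other (trans (sym target≡) eq)
      ; obliged = λ ne → contradiction refl ne
      ; informs = informs
      ; last-in = λ q _ → trans (cong (λ ℓ → last ℓ q) target≡) (trans (P.last≡ q) (cong₂ _,_ (sym (promise-root refl)) (sym cutoff≡)))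
      ; last-out = λ q ne → contradiction refl ne
      ; kept = λ q e fe → subst (λ ℓ → Keeps ℓ q e) (sym target≡)
                 (P.kept q e (subst (λ ℓ → First (path ℓ) q e) target≡ fe))
      ; walk-from = let z , w = P.walk-from in z , subst (λ ℓ → Walk (just c) (just z) (path ℓ)) (sym target≡) w }

  flat-walk : ∀ {ℓ ℓ*} (C : Chain ℓ ℓ*) → Final ℓ* → Walk (start ℓ) (just sf) (flat C)
  flat-walk []             (w , _) = w
  flat-walk (ext v p lg C) fin = Legit.walk-to lg ++ʷ subst (λ a → Walk a (just sf) (flat C)) (Legit.starts lg) (flat-walk C fin)

  flat-path : ∀ {ℓ*} (C : Chain ℓ₀ ℓ*) → Final ℓ* → Σ (Path G s₀ sf) λ ρ → Thin ρ (flat C)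
  flat-path C fin = from-root (subst (λ a → Walk a (just sf) (flat C)) start₀ (flat-walk C fin))
    where
    from-root : ∀ {ns} → Walk nothing (just sf) ns → Σ (Path G s₀ sf) λ ρ → Thin ρ ns
    from-root (keep enter w)   = let σ , θ , _ = walk⇒path w in σ , θ
    from-root (skip enter z w) = let σ , _ , θ = walk⇒path w in σ , θ z

  -- Linearizations

  offset : ∀ {ℓ ℓ′} → Chain ℓ ℓ′ → ℕ → ℕ
  offset C             zero    = 0
  offset []            (suc m) = 0
  offset (ext v _ _ C) (suc m) = cutoff v + offset C m

  flatten : ∀ {ℓ ℓ′} → Chain ℓ ℓ′ → HEvent → Event
  flatten C (m , e) = shift (offset C m) e

  length-cut : ∀ {ℓ v p} → Legit ℓ v p → length (take (cutoff v) (path ℓ)) ≡ cutoff v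
  length-cut {ℓ} {v} lg = trans (Listₚ.length-take (cutoff v) (path ℓ)) (ℕₚ.m≤n⇒m⊓n≡m (Legit.cutoff≤ lg))

  in-suc : ∀ {ℓ ℓ′ v p m e} {lg : Legit ℓ v p} {C : Chain (target v) ℓ′} → In (ext v p lg C) (suc m , e) → In C (m , e)
  in-suc (inside (s≤s l) v b) = inside l v b

  flatten-valid : ∀ {ℓ ℓ′} (C : Chain ℓ ℓ′) {m e} → In C (m , e) → Valid (flat C) (flatten C (m , e))
  flatten-valid []              {zero}  (inside _ v _) = valid (at v)
  flatten-valid (ext v p lg C) {zero} (inside _ vd b) = valid (‼-++ˡ (take (cutoff v) (path _)) (‼-take⁺ (cutoff v) (path _) b (at vd)))
  flatten-valid {ℓ} (ext v p lg C) {suc m} {e} i = valid (trans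
    (cong ((take (cutoff v) (path ℓ) ++ flat C) ‼_) (trans (ℕₚ.+-assoc (cutoff v) _ _) (cong (_+ (offset C m + idx e)) (sym (length-cut lg)))))
    (trans (‼-++ʳ (take (cutoff v) (path ℓ)) (offset C m + idx e)) (at (flatten-valid C (in-suc i)))))

  unflatten : ∀ {ℓ ℓ′} (C : Chain ℓ ℓ′) {f} → Valid (flat C) f → ∃ λ x → In C x × flatten C x ≡ f
  unflatten [] {f} v = (0 , f) , inside z≤n v (idx<noExit v) , refl
  unflatten {ℓ} (ext v p lg C) {i , x} vd with ‼-++⁻ (take (cutoff v) (path ℓ)) (at vd)
  ... | inj₁ eq = let lt , eq′ = ‼-take⁻ (cutoff v) (path ℓ) eq in (0 , i , x) , inside z≤n (valid eq′) lt , refl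
  ... | inj₂ (j , refl , eq) with unflatten C {j , x} (valid eq)
  ...   | (m , e) , inside l w b , refl = (suc m , e) , inside (s≤s l) w b ,
          cong (_, x) (trans (ℕₚ.+-assoc (cutoff v) (offset C m) (idx e)) (cong (_+ (offset C m + idx e)) (sym (length-cut lg))))

  flatten-< : ∀ {ℓ ℓ′} (C : Chain ℓ ℓ′) {m m′ e e′} → In C (m , e) → In C (m′ , e′) → m < m′ →
              idx (flatten C (m , e)) < idx (flatten C (m′ , e′))
  flatten-< (ext v p lg C) {zero}  {suc m′} (inside _ _ b) _ _ = ℕₚ.<-≤-trans b (ℕₚ.≤-trans (ℕₚ.m≤m+n _ _) (ℕₚ.m≤m+n _ _))
  flatten-< (ext v p lg C) {suc m} {suc m′} {e} {e′} i i′ (s≤s lt) =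
    subst₂ _<_ (sym (ℕₚ.+-assoc (cutoff v) _ _)) (sym (ℕₚ.+-assoc (cutoff v) _ _)) (ℕₚ.+-monoʳ-< (cutoff v) (flatten-< C (in-suc i) (in-suc i′) lt))
  flatten-< [] {m} {suc m′} _ (inside () _ _) _

  shift-injective : ∀ o {e f} → shift o e ≡ shift o f → e ≡ f
  shift-injective o {i , x} {j , y} eq = cong₂ (λ i x → i , x) (ℕₚ.+-cancelˡ-≡ o _ _ (cong proj₁ eq)) (cong proj₂ eq)

  flatten-injective : ∀ {ℓ ℓ′} (C : Chain ℓ ℓ′) {x y} → In C x → In C y → flatten C x ≡ flatten C y → x ≡ y
  flatten-injective C {m , e} {m′ , e′} i i′ eq with ℕₚ.<-cmp m m′
  ... | tri< lt _ _ = contradiction (flatten-< C i i′ lt) (ℕₚ.<-irrefl (cong idx eq))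
  ... | tri> _ _ gt = contradiction (flatten-< C i′ i gt) (ℕₚ.<-irrefl (cong idx (sym eq)))
  ... | tri≈ _ refl _ = cong (m ,_) (shift-injective (offset C m) eq)

  flatten-edge : ∀ {ℓ ℓ′} (C : Chain ℓ ℓ′) {x y} → In C x → In C y → HEdge x y → Edge (flatten C x) (flatten C y)
  flatten-edge C {m , e} {_ , f} i i′ (inj₁ (refl , ed)) = shift-edge (offset C m) {e} {f} ed
  flatten-edge C {m , e} {m′ , f} i i′ (inj₂ (lt , pe)) = inj₂ (pe , idx<⇒coord< (flatten C (m , e)) (flatten C (m′ , f)) (flatten-< C i i′ lt))

  flatten-edge⁻ : ∀ {ℓ ℓ′} (C : Chain ℓ ℓ′) {x y} → In C x → In C y → Edge (flatten C x) (flatten C y) → HEdge x y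
  flatten-edge⁻ C {x} {y} i i′ (inj₁ (ke , eq)) with flatten-injective C (in-partner i) i′ eq
  ... | refl = inj₁ (refl , inj₁ (ke , refl))
  flatten-edge⁻ C {m , e} {m′ , f} i i′ (inj₂ (pe , lt)) with ℕₚ.<-cmp m m′
  ... | tri< l _ _ = inj₂ (l , pe)
  ... | tri> _ _ gt = contradiction (idx<⇒coord< (flatten C (m′ , f)) (flatten C (m , e)) (flatten-< C i′ i gt)) (ℕₚ.<⇒≯ lt)
  ... | tri≈ _ refl _ = inj₁ (refl , inj₂ (pe , ℕₚ.+-cancelˡ-< (offset C m * B) _ _
          (subst₂ _<_ (coord-shift (offset C m) e) (coord-shift (offset C m) f) lt)))

  tabulate-schedule : ∀ {ℓ*} {D : Chain ℓ₀ ℓ*} n (x : Fin n → HEvent) X → (∀ i → In D (x i)) → (∀ i → x i ∉ X) →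
    (∀ {i j} → x i ≡ x j → i ≡ j) → (∀ {y} → In D y → y ∈ X ⊎ ∃ λ i → x i ≡ y) →
    (∀ {i y} → In D y → HEdge y (x i) → y ∈ X ⊎ ∃ λ j → j Fin.< i × x j ≡ y) → Schedule D X (tabulate x)
  tabulate-schedule zero x X ins new inj all pred = [] λ i → complete (all i)
    where complete : ∀ {y} → y ∈ X ⊎ (∃ λ i → x i ≡ y) → y ∈ X
          complete (inj₁ y∈) = y∈
  tabulate-schedule (suc n) x X ins new inj all pred =
    add (ins zero) (new zero) (λ iy ed → first (pred iy ed))
      (tabulate-schedule n (x ∘ suc) (x zero ∷ X) (ins ∘ suc)
        (λ { i (here eq) → contradiction (inj eq) λ () ; i (there p) → new (suc i) p })
        (λ eq → Finₚ.suc-injective (inj eq)) (λ iy → all′ (all iy)) (λ {i} iy ed → pred′ (pred {suc i} iy ed)))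
    where
    first : ∀ {y} → y ∈ X ⊎ (∃ λ j → toℕ j < 0 × x j ≡ y) → y ∈ X
    first (inj₁ y∈) = y∈
    all′ : ∀ {y} → y ∈ X ⊎ (∃ λ i → x i ≡ y) → y ∈ x zero ∷ X ⊎ ∃ λ i → x (suc i) ≡ y
    all′ (inj₁ y∈)           = inj₁ (there y∈)
    all′ (inj₂ (zero , eq))  = inj₁ (here (sym eq))
    all′ (inj₂ (suc i , eq)) = inj₂ (i , eq)
    pred′ : ∀ {i y} → y ∈ X ⊎ (∃ λ j → j Fin.< suc i × x j ≡ y) → y ∈ x zero ∷ X ⊎ ∃ λ j → j Fin.< i × x (suc j) ≡ y
    pred′ (inj₁ y∈)                    = inj₁ (there y∈)
    pred′ (inj₂ (zero , _ , eq))       = inj₁ (here (sym eq))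
    pred′ (inj₂ (suc j , s≤s lt , eq)) = inj₂ (j , lt , eq)

  linearization⇒schedule : ∀ {ℓ*} (D : Chain ℓ₀ ℓ*) {ρ : Path G s₀ sf} (θ : Thin ρ (flat D)) {w} → Lin (bmscOf G ρ) w →
                           ∃ λ es → Schedule D [] es × map (letterOf ∘ proj₂) es ≡ w
  linearization⇒schedule D {ρ} θ {w} (π , inj , ordered , w≡) = tabulate x ,
      tabulate-schedule (size ρ) x [] ins (λ _ ()) x-injective (λ iy → inj₂ (onto iy)) (λ {i} iy ed → inj₂ (preceding {i} iy ed)) ,
      trans (Listₚ.map-tabulate x (letterOf ∘ proj₂)) (trans (Listₚ.tabulate-cong letters) (sym w≡))
    where
    placed : ∀ i → ∃ λ y → In D y × flatten D y ≡ toEvent θ (π i)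
    placed i = unflatten D (toEvent-valid θ (π i))
    x : Fin (size ρ) → HEvent
    x i = proj₁ (placed i)
    ins : ∀ i → In D (x i)
    ins i = proj₁ (proj₂ (placed i))
    flat-x : ∀ i → flatten D (x i) ≡ toEvent θ (π i)
    flat-x i = proj₂ (proj₂ (placed i))
    x-injective : ∀ {i j} → x i ≡ x j → i ≡ j
    x-injective {i} {j} eq = inj (toEvent-injective θ (trans (sym (flat-x i)) (trans (cong (flatten D) eq) (flat-x j))))
    onto : ∀ {y} → In D y → ∃ λ i → x i ≡ y
    onto iy with fromEvent θ (flatten-valid D iy)
    ... | t , eq with injective⇒surjective π inj t
    ...   | i , refl = i , flatten-injective D (ins i) iy (trans (flat-x i) eq)
    preceding : ∀ {i y} → In D y → HEdge y (x i) → ∃ λ j → j Fin.< i × x j ≡ y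
    preceding {i} iy ed with onto iy
    ... | j , refl = j , ℕₚ.≤∧≢⇒< (ordered j i (toEvent-edge⁻ θ edge′ ◅ ε)) differ , refl
      where
      edge′ : Edge (toEvent θ (π j)) (toEvent θ (π i))
      edge′ = subst₂ Edge (flat-x j) (flat-x i) (flatten-edge D (ins j) (ins i) ed)
      differ : toℕ j ≢ toℕ i
      differ eq with Finₚ.toℕ-injective eq
      ... | refl = edge-coord-irrefl _ edge′
    letters : ∀ i → letterOf (proj₂ (x i)) ≡ letter (bmscOf G ρ) (π i)
    letters i = trans (cong letterOf (flat-x i)) (sym (letter-toEvent θ (π i)))

  list⇒linearization : ∀ {ℓ*} (C : Chain ℓ₀ ℓ*) {ρ : Path G s₀ sf} (θ : Thin ρ (flat C)) es →
    (∀ {x} → x ∈ es → In C x) → (∀ {x} → In C x → x ∈ es) → AllPairs (λ x y → y ≢ x × ¬ HEdge y x) es →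
    Lin (bmscOf G ρ) (map (letterOf ∘ proj₂) es)
  list⇒linearization C {ρ} θ es ins all ord = π , π-injective , ordered , word
    where
    in-lookup : ∀ i → In C (List.lookup es i)
    in-lookup i = ins (∈ₚ.∈-lookup i)
    f : Fin (length es) → Fin (size ρ)
    f i = proj₁ (fromEvent θ (flatten-valid C (in-lookup i)))
    f-event : ∀ i → toEvent θ (f i) ≡ flatten C (List.lookup es i)
    f-event i = proj₂ (fromEvent θ (flatten-valid C (in-lookup i)))
    lookup-injective : ∀ {i j} → List.lookup es i ≡ List.lookup es j → i ≡ j
    lookup-injective {i} {j} eq with Finₚ.<-cmp i j
    ... | tri< lt _ _ = contradiction (sym eq) (proj₁ (allPairs-lookup ord lt))
    ... | tri≈ _ e _  = e
    ... | tri> _ _ gt = contradiction eq (proj₁ (allPairs-lookup ord gt))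
    f-injective : ∀ {i j} → f i ≡ f j → i ≡ j
    f-injective {i} {j} eq = lookup-injective (flatten-injective C (in-lookup i) (in-lookup j)
      (trans (sym (f-event i)) (trans (cong (toEvent θ) eq) (f-event j))))
    position′ : ∀ t → ∃ λ i → flatten C (List.lookup es i) ≡ toEvent θ t
    position′ t with unflatten C (toEvent-valid θ t)
    ... | y , iy , eq = Any.index (all iy) , trans (cong (flatten C) (sym (Anyₚ.lookup-index (all iy)))) eq
    position′-injective : ∀ {t u} → proj₁ (position′ t) ≡ proj₁ (position′ u) → t ≡ u
    position′-injective {t} {u} eq = toEvent-injective θ (trans (sym (proj₂ (position′ t)))
      (trans (cong (flatten C ∘ List.lookup es) eq) (proj₂ (position′ u))))
    length≡ : length es ≡ size ρ
    length≡ = ℕₚ.≤-antisym (Finₚ.injective⇒≤ f-injective) (Finₚ.injective⇒≤ position′-injective)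
    π : Fin (size ρ) → Fin (size ρ)
    π = f ∘ Fin.cast (sym length≡)
    toℕ-cast-injective : ∀ {i j : Fin (size ρ)} → Fin.cast (sym length≡) i ≡ Fin.cast (sym length≡) j → i ≡ j
    toℕ-cast-injective {i} {j} eq = Finₚ.toℕ-injective
      (trans (sym (Finₚ.toℕ-cast (sym length≡) i)) (trans (cong toℕ eq) (Finₚ.toℕ-cast (sym length≡) j)))
    π-injective : ∀ {i j} → π i ≡ π j → i ≡ j
    π-injective eq = toℕ-cast-injective (f-injective eq)
    edge⇒< : ∀ i j → VEdge (bmscOf G ρ) (f i) (f j) → i Fin.< j
    edge⇒< i j ed with Finₚ.<-cmp i j
      | flatten-edge⁻ C (in-lookup i) (in-lookup j) (subst₂ Edge (f-event i) (f-event j) (toEvent-edge θ ed))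
    ... | tri< lt _ _ | _ = lt
    ... | tri≈ _ refl _ | _ = contradiction (toEvent-edge θ ed) (edge-coord-irrefl (toEvent θ (f i)))
    ... | tri> _ _ gt | hed = contradiction hed (proj₂ (allPairs-lookup ord gt))
    π-edge : ∀ i j → VEdge (bmscOf G ρ) (π i) (π j) → i Fin.< j
    π-edge i j ed = subst₂ _<_ (Finₚ.toℕ-cast (sym length≡) i) (Finₚ.toℕ-cast (sym length≡) j) (edge⇒< _ _ ed)
    -- The visual order passes through intermediate events. Each of them has a position in the word,
    -- because the injection `π` is onto.
    along : ∀ {t u} → _≤v_ (bmscOf G ρ) t u → ∀ i j → t ≡ π i → u ≡ π j → toℕ i ≤ toℕ j
    along ε i j eq eq′ = ℕₚ.≤-reflexive (cong toℕ (π-injective (trans (sym eq) eq′)))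
    along (_◅_ {j = t′} ed rs) i j eq eq′ =
      let i′ , eq″ = injective⇒surjective π π-injective t′ in
      ℕₚ.≤-trans (ℕₚ.<⇒≤ (π-edge i i′ (subst₂ (VEdge (bmscOf G ρ)) eq (sym eq″) ed))) (along rs i′ j (sym eq″) eq′)
    ordered : ∀ i j → _≤v_ (bmscOf G ρ) (π i) (π j) → toℕ i ≤ toℕ j
    ordered i j le = along le i j refl refl
    word : map (letterOf ∘ proj₂) es ≡ tabulate (λ i → letter (bmscOf G ρ) (π i))
    word = trans (cong (map (letterOf ∘ proj₂)) (sym (Listₚ.tabulate-lookup es)))
      (trans (Listₚ.map-tabulate (List.lookup es) (letterOf ∘ proj₂))
      (trans (tabulate-cast length≡ (letterOf ∘ proj₂ ∘ List.lookup es))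
        (Listₚ.tabulate-cong λ i → let i′ = Fin.cast (sym length≡) i in
          sym (trans (letter-toEvent θ (f i′)) (cong letterOf (f-event i′))))))

  topological : ∀ {ℓ*} (D : Chain ℓ₀ ℓ*) X U → Acc _<_ (length U) → (∀ {x} → x ∈ U → In D x × x ∉ X) →
                (∀ {x} → In D x → x ∈ X ⊎ x ∈ U) → ∃ λ es → Schedule D X es
  topological D X [] _ _ all = [] , [] λ i → complete (all i)
    where complete : ∀ {x} → x ∈ X ⊎ x ∈ [] → x ∈ X
          complete (inj₁ x∈) = x∈
  topological D X U@(_ ∷ _) (acc shorter) ok all with hminimal D U (proj₁ ∘ ok) (here refl)
  ... | g , g∈ , min = let es , sch = rest in g ∷ es , add (proj₁ (ok g∈)) (proj₂ (ok g∈)) (λ iy ed → earlier ed (all iy)) sch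
    where
    earlier : ∀ {y} → HEdge y g → y ∈ X ⊎ y ∈ U → y ∈ X
    earlier ed (inj₁ y∈) = y∈
    earlier ed (inj₂ y∈) = contradiction ed (min y∈)
    U′ : List HEvent
    U′ = filter (λ x → ¬? (x ≟ᴴ g)) U
    rest : ∃ λ es → Schedule D (g ∷ X) es
    rest = topological D (g ∷ X) U′ (shorter (Listₚ.filter-notAll (λ x → ¬? (x ≟ᴴ g)) U (Any.map (λ eq ne → ne (sym eq)) g∈)))
      (λ x∈ → let x∈U , ne = ∈ₚ.∈-filter⁻ (λ x → ¬? (x ≟ᴴ g)) {xs = U} x∈ in
        proj₁ (ok x∈U) , λ { (here eq) → ne eq ; (there p) → proj₂ (ok x∈U) p })
      (λ {x} i → split x (all i))
      where
      split : ∀ x → x ∈ X ⊎ x ∈ U → x ∈ g ∷ X ⊎ x ∈ U′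
      split x (inj₁ x∈) = inj₁ (there x∈)
      split x (inj₂ x∈) with x ≟ᴴ g
      ... | yes eq = inj₁ (here eq)
      ... | no ne  = inj₂ (∈ₚ.∈-filter⁺ (λ x → ¬? (x ≟ᴴ g)) x∈ ne)

  -- Deadlock-freedom and the language of the machine

  preserve-run : ∀ {H c w c′} → Inv H c → Run machine c w c′ →
                 ∃ λ es → ∃ λ H′ → Inv H′ c′ × Executed H′ ≡ es ʳ++ Executed H × map h w ≡ map (letterOf ∘ proj₂) es
  preserve-run iv done = [] , _ , iv , refl , refl
  preserve-run iv (step stp run) with preserve iv stp
  ... | x , v , iv′ , a≡ with preserve-run iv′ run
  ...   | es , H′ , iv″ , ex≡ , w≡ = x ∷ es , H′ , iv″ , ex≡ , cong₂ _∷_ a≡ w≡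

  -- The invariant provides a chain to head for; any topological order of its remaining events can
  -- be executed and ends in an accepting configuration.
  deadlock-free : DeadlockFree machine
  deadlock-free c w run with preserve-run start-inv run
  ... | _ , H , iv , _ with toward-some iv
  ...   | _ , D , tw with topological D (Executed H) (filter (λ x → ¬? (done? H x)) (hevents D)) (<-wellFounded _)
            (λ x∈ → let x∈D , nd = ∈ₚ.∈-filter⁻ (λ x → ¬? (done? H x)) {xs = hevents D} x∈ in ∈-hevents⁻ D x∈D , nd ∘ executed⇒done)
            remaining
    where
    remaining : ∀ {x} → In D x → x ∈ Executed H ⊎ x ∈ filter (λ x → ¬? (done? H x)) (hevents D)
    remaining {x} i with done? H x
    ... | yes d = inj₁ (done⇒executed d)
    ... | no nd = inj₂ (∈ₚ.∈-filter⁺ (λ x → ¬? (done? H x)) (∈-hevents⁺ D i) nd)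
  ...     | es , sch with execute tw sch
  ...       | w′ , c′ , H′ , run′ , _ , tw′ , all = c′ , w′ , run′ , accept tw′ all

  complete-language : ∀ w → LangMSG G w → ∃ λ w′ → LangCFM machine w′ × map h w′ ≡ w
  complete-language w (ρ , lin) with plan-run ρ
  ... | _ , D , fin , θ with linearization⇒schedule D θ lin
  ...   | es , sch , letters with execute (start-toward D fin) sch
  ...     | w′ , c′ , H′ , run , w≡ , tw , all = w′ , (c′ , run , accept tw all) , trans w≡ letters

  sound-language : ∀ w → LangCFM machine w → LangMSG G (map h w)
  sound-language w (c , run , accepting) with preserve-run start-inv run
  ... | es , H , iv , ex≡ , w≡ with accepted iv accepting
  ...   | _ , C , fin , g , all with flat-path C fin
  ...     | ρ , θ = ρ , subst (Lin (bmscOf G ρ)) (sym w≡) (list⇒linearization C θ es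
              (λ x∈ → Global.h-in g (executed⇒done (subst (_ ∈_) (sym ex≡) (∈-ʳ++⁺ es (inj₁ x∈)))))
              (λ i → executed (∈-ʳ++⁻ es (subst (_ ∈_) ex≡ (done⇒executed (all i)))))
              (proj₁ (allPairs-ʳ++ es (subst (AllPairs _) ex≡ (AllPairsₚ.map⁺ (Global.h-order g))))))
    where
    executed : ∀ {x} → x ∈ es ⊎ x ∈ [] → x ∈ es
    executed (inj₁ x∈) = x∈

theorem2 : ∀ {np nc : ℕ} (G : MSG (Fin np) (Fin nc)) → ControllableChoice G →
    ∃ λ (nd : ℕ) → Σ (CFM np (Fin nc × Fin nd)) λ A →
    DeadlockFree A ×
    (∀ w → LangMSG G w → ∃ λ w' → LangCFM A w' × map h w' ≡ w) ×
    (∀ w' → LangCFM A w' → LangMSG G (map h w'))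
theorem2 G cc = Protocol.controls G labels , Protocol.machine G labels , deadlock-free , complete-language , sound-language
  where
  open Coded G using (labels; ample)
  open Planning G cc labels ample using (deadlock-free; complete-language; sound-language)
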